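{- Let $\zeta_5$ be a primitive fifth root of unity and write $c=\zeta_5+\zeta_5^4$. Then $$\frac{1}{(q;q)_\infty}\left(\sum_{n=-\infty}^\infty\frac{q^{3n^2+2n}}{(1-\zeta_5q^{3n})(1-\zeta_5^{ -1}q^{3n})}-\sum_{n=-\infty}^\infty \frac{q^{3n^2+4n+1}}{(1-\zeta_5q^{3n+1})(1-\zeta_5^{ -1}q^{3n+1})}\right)=(q^{25};q^{25})_\infty\sum_{j=0}^{3}q^jA_{35j}(q^5),$$ where $$A_{350}(q)=\frac{3+c}{5}\frac{[q^2;q^5]_\infty}{[q;q^5]_\infty^2}-q\frac{[q^2;q^{15}]_\infty}{[q,q^4,q^5,q^6;q^{15}]_\infty},\qquad A_{351}(q)=\frac{ -2+c}{5}\frac{1}{[q;q^5]_\infty}-c\,q\frac{1}{[q^3,q^5,q^7;q^{15}]_\infty},$$ $$A_{352}(q)=\frac{1+2c}{5}\frac{1}{[q^2;q^5]_\infty}-c\frac{1}{[q,q^5,q^6;q^{15}]_\infty},\qquad A_{353}(q)=\frac{ -1+3c}{5}\frac{[q;q^5]_\infty}{[q^2;q^5]_\infty^2}+(-1+c)\,q\frac{[q;q^{15}]_\infty}{[q^2,q^3,q^5,q^7;q^{15}]_\infty}.$$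
   Context: $(a;q)_\infty=\prod_{j\ge0}(1-aq^j)$; $[z;q]_\infty=(z;q)_\infty(q/z;q)_\infty$ and $[z_1,\dots,z_k;q]_\infty=[z_1;q]_\infty\cdots[z_k;q]_\infty$. -}

module Defs where

open import Data.Nat as ℕ using (ℕ; zero; suc; _∸_)
open import Data.Nat.DivMod using (_%_; _/_)
open import Data.Integer as ℤ using (ℤ; +_; -[1+_])
open import Data.Rational as ℚ using (ℚ; 0ℚ; 1ℚ; 1/_; ≢-nonZero)
open import Data.Rational.Properties using () renaming (_≟_ to _≟ℚ_)
open import Relation.Nullary using (yes; no)
open import Relation.Binary.PropositionalEquality using (_≡_)

-- The cyclotomic field ℚ(ζ₅) = ℚ[ζ]/(1+ζ+ζ²+ζ³+ζ⁴), elements written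
-- uniquely as  a₀ + a₁ζ + a₂ζ² + a₃ζ³  (ζ = a primitive fifth root of 1).

record K : Set where
  constructor ⟨_,_,_,_⟩
  field
    a₀ a₁ a₂ a₃ : ℚ
open K public

-- normalise a "5-term" expression b₀ + b₁ζ + … + b₄ζ⁴ using ζ⁴ = -1-ζ-ζ²-ζ³
norm5 : ℚ → ℚ → ℚ → ℚ → ℚ → K
norm5 b₀ b₁ b₂ b₃ b₄ = ⟨ b₀ ℚ.- b₄ , b₁ ℚ.- b₄ , b₂ ℚ.- b₄ , b₃ ℚ.- b₄ ⟩

fromℚ : ℚ → K
fromℚ r = ⟨ r , 0ℚ , 0ℚ , 0ℚ ⟩

0K 1K ζ : K
0K = fromℚ 0ℚ
1K = fromℚ 1ℚ
ζ  = ⟨ 0ℚ , 1ℚ , 0ℚ , 0ℚ ⟩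

infixl 6 _+K_ _-K_
infixl 7 _*K_

_+K_ : K → K → K
⟨ a , b , c , d ⟩ +K ⟨ a' , b' , c' , d' ⟩ = ⟨ a ℚ.+ a' , b ℚ.+ b' , c ℚ.+ c' , d ℚ.+ d' ⟩

-K_ : K → K
-K ⟨ a , b , c , d ⟩ = ⟨ ℚ.- a , ℚ.- b , ℚ.- c , ℚ.- d ⟩

_-K_ : K → K → K
x -K y = x +K (-K y)

-- product of polynomials in ζ of degree ≤ 3, reduced with ζ⁵ = 1 then normalised
_*K_ : K → K → K
⟨ a₀ , a₁ , a₂ , a₃ ⟩ *K ⟨ b₀ , b₁ , b₂ , b₃ ⟩ =
  let p₀ = a₀ ℚ.* b₀
      p₁ = a₀ ℚ.* b₁ ℚ.+ a₁ ℚ.* b₀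
      p₂ = a₀ ℚ.* b₂ ℚ.+ a₁ ℚ.* b₁ ℚ.+ a₂ ℚ.* b₀
      p₃ = a₀ ℚ.* b₃ ℚ.+ a₁ ℚ.* b₂ ℚ.+ a₂ ℚ.* b₁ ℚ.+ a₃ ℚ.* b₀
      p₄ = a₁ ℚ.* b₃ ℚ.+ a₂ ℚ.* b₂ ℚ.+ a₃ ℚ.* b₁
      p₅ = a₂ ℚ.* b₃ ℚ.+ a₃ ℚ.* b₂
      p₆ = a₃ ℚ.* b₃
  in norm5 (p₀ ℚ.+ p₅) (p₁ ℚ.+ p₆) p₂ p₃ p₄

-- Galois automorphisms σ_k : ζ ↦ ζ^k  (k = 2, 3, 4)
σ₂ σ₃ σ₄ : K → K
σ₂ ⟨ a₀ , a₁ , a₂ , a₃ ⟩ = norm5 a₀ a₃ a₁ 0ℚ a₂   -- ζ↦ζ², ζ²↦ζ⁴, ζ³↦ζ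
σ₃ ⟨ a₀ , a₁ , a₂ , a₃ ⟩ = norm5 a₀ a₂ 0ℚ a₁ a₃   -- ζ↦ζ³, ζ²↦ζ, ζ³↦ζ⁴
σ₄ ⟨ a₀ , a₁ , a₂ , a₃ ⟩ = norm5 a₀ 0ℚ a₃ a₂ a₁   -- ζ↦ζ⁴, ζ²↦ζ³, ζ³↦ζ²

-- field inverse: x⁻¹ = σ₂x σ₃x σ₄x / N(x), with N(x) = x σ₂x σ₃x σ₄x ∈ ℚ
-- (convention 0⁻¹ = 0)
invℚ : ℚ → ℚ
invℚ r with r ≟ℚ 0ℚ
... | yes _  = 0ℚ
... | no r≢0 = 1/_ r {{≢-nonZero r≢0}}

invK : K → K
invK x = let y = σ₂ x *K σ₃ x *K σ₄ x in fromℚ (invℚ (a₀ (x *K y))) *K y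

c : K
c = ζ +K (ζ *K ζ *K ζ *K ζ)

ζ⁻¹ : K
ζ⁻¹ = invK ζ

_/5 : ℤ → K
n /5 = fromℚ (n ℚ./ 5)

-- Formal power series in q over K:  f n = coefficient of qⁿ.

Series : Set
Series = ℕ → K

infix 4 _≈_
_≈_ : Series → Series → Set
f ≈ g = ∀ n → f n ≡ g n

Σ≤ : ℕ → (ℕ → K) → K
Σ≤ zero    f = f 0
Σ≤ (suc n) f = Σ≤ n f +K f (suc n)

infixl 6 _⊕_ _⊖_
infixl 7 _⊗_

_⊕_ _⊖_ _⊗_ : Series → Series → Series
(f ⊕ g) n = f n +K g n
(f ⊖ g) n = f n -K g n
(f ⊗ g) n = Σ≤ n (λ k → f k *K g (n ∸ k))

const : K → Series
const a zero    = a
const a (suc _) = 0K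

_·_ : K → Series → Series
(a · f) n = a *K f n

𝟘 𝟙 : Series
𝟘 _ = 0K
𝟙 = const 1K

q^ : ℕ → Series
q^ e n with e ℕ.≟ n
... | yes _ = 1K
... | no  _ = 0K

-- q^e for an integer exponent e ≥ 0 (only ever used with e ≥ 0)
q^ℤ : ℤ → Series
q^ℤ (+ e)    = q^ e
q^ℤ -[1+ _ ] = 𝟘

_^_ : Series → ℕ → Series
f ^ zero  = 𝟙
f ^ suc k = f ⊗ (f ^ k)

-- multiplicative inverse of a series f with invertible constant term:
-- writing f = f₀(1 - h) with h(0) = 0, 1/f = f₀⁻¹ Σ_k h^k, and the
-- coefficient of qⁿ only involves k ≤ n.
inv : Series → Series
inv f n =
  let a = invK (f 0)
      h = 𝟙 ⊖ (a · f)
  in a *K Σ≤ n (λ k → (h ^ k) n)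

∏< : ℕ → (ℕ → Series) → Series
∏< zero    F = 𝟙
∏< (suc m) F = ∏< m F ⊗ F m

-- (q^e ; q^d)_∞ = ∏_{j≥0} (1 - q^{e+dj}), for d ≥ 1; the coefficient of
-- qⁿ is that of the finite product over j ≤ n.
poch : ℕ → ℕ → Series
poch e d n = ∏< (suc n) (λ j → 𝟙 ⊖ q^ (e ℕ.+ d ℕ.* j)) n

-- [q^a ; q^b]_∞ = (q^a;q^b)_∞ (q^{b-a};q^b)_∞   (0 < a < b)
θ : ℕ → ℕ → Series
θ a b = poch a b ⊗ poch (b ∸ a) b

dilate : (k : ℕ) → .{{_ : ℕ.NonZero k}} → Series → Series
dilate k f n with n % k ℕ.≟ 0
... | yes _ = f (n / k)
... | no  _ = 0K

-- bilateral sum Σ_{n∈ℤ} F n, where F n has q-adic order ≥ |n|: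
-- the coefficient of q^N is the finite sum over -(N+1) ≤ n ≤ N+1.
Σℤ : (ℤ → Series) → Series
Σℤ F N = Σ≤ (2 ℕ.* suc N) (λ i → F ((+ i) ℤ.- (+ suc N)) N)

-- the series expansion of  q^e / ((1 - ζ q^k)(1 - ζ⁻¹ q^k))  for e, k ∈ ℤ
-- (e ≥ 0).  For k ≥ 0 this is the usual inverse; for k = -m < 0 we use
-- (1 - ζ q^{-m})(1 - ζ⁻¹ q^{-m}) = q^{-2m} (q^m - ζ)(q^m - ζ⁻¹).
ζterm : ℤ → ℤ → Series
ζterm e (+ k) =
  q^ℤ e ⊗ inv ((𝟙 ⊖ (ζ · q^ k)) ⊗ (𝟙 ⊖ (ζ⁻¹ · q^ k)))
ζterm e -[1+ m ] =
  q^ℤ (e ℤ.+ + (2 ℕ.* suc m))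
    ⊗ inv ((q^ (suc m) ⊖ const ζ) ⊗ (q^ (suc m) ⊖ const ζ⁻¹))

A350 A351 A352 A353 : Series
A350 = (((+ 3) /5 +K (+ 1) /5 *K c) · (θ 2 5 ⊗ inv (θ 1 5 ^ 2)))
     ⊖ (q^ 1 ⊗ θ 2 15 ⊗ inv (θ 1 15 ⊗ θ 4 15 ⊗ θ 5 15 ⊗ θ 6 15))
A351 = ((ℤ.- (+ 2)) /5 +K (+ 1) /5 *K c) · inv (θ 1 5)
     ⊖ (c · (q^ 1 ⊗ inv (θ 3 15 ⊗ θ 5 15 ⊗ θ 7 15)))
A352 = ((+ 1) /5 +K (+ 2) /5 *K c) · inv (θ 2 5)
     ⊖ (c · inv (θ 1 15 ⊗ θ 5 15 ⊗ θ 6 15))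
A353 = (((ℤ.- (+ 1)) /5 +K (+ 3) /5 *K c) · (θ 1 5 ⊗ inv (θ 2 5 ^ 2)))
     ⊕ ((c -K 1K) · (q^ 1 ⊗ θ 1 15 ⊗ inv (θ 2 15 ⊗ θ 3 15 ⊗ θ 5 15 ⊗ θ 7 15)))

-- For x = ζ and x = ζ⁻¹, the Lambert series Ψ(x) = Σ_{k∈ℤ} (q²/x)^k / (1 - x q^(3k)) is an infinite product by Ramanujan's
-- 1ψ1 summation, which is the limit of a finite identity provable by induction. Cutting the lattice points of the double
-- series of Ψ along the diagonal (Clausen's transformation) turns it into a series with quadratic exponents, and partial
-- fractions in q^k identify (ζ - ζ⁻¹) times the difference of the two bilateral sums with ζ Ψ(ζ) - ζ⁻¹ Ψ(ζ⁻¹).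
-- Multiplied by (q⁵;q⁵) = ∏_i (ζ^i q;q), this becomes a product of two theta series, whose 5-dissections are elementary.
-- The quintuple product identities that turn the result into the A_{35j} come for free: (q;q), and (q;q)(q⁵;q⁵) as the norm
-- from ℚ(ζ) of a theta series, are both dissected, and the components are compared.

module Submission where

-- Only units are ever inverted. Bilateral series carry pairs of parameters whose product is the
-- base (`a * b`, `y * w`) and which stand in for negative powers; 1/(1 - ζ) is supplied from
-- outside, since 1 - ζ has order 0 and its inverse is no geometric series. The analysis takes place
-- in an abstract complete ring with an element q of positive order. The factor (q⁵;q⁵) cancels the
-- denominators (ζq;q)(ζ⁻¹q;q) of the products and leaves (q;q)(ζ²q;q)(ζ⁻²q;q), up to 1 - ζ² a theta
-- series with exponents 0 and 1 mod 5 only; the other theta factor has only 0, 1 and 2. This is why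
-- j stops at 3. On the side of the A_{35j}, the product (q;q)(q⁵;q⁵) equals `J₁ * J₂` and clears
-- every denominator. After two quintuple product relations, both sides are combinations of eight
-- products of theta series, and eight relations between constants of ℚ(ζ) remain, decided by
-- computation. The denominator 5 of these constants is (2 - c)(3 + c), where c² + c = 1 and 2 - c =
-- (1 - ζ)(1 - ζ⁻¹).

open import Level using (0ℓ)
open import Algebra.Bundles using (CommutativeRing)
open import Algebra.Structures using (IsCommutativeRing)
import Algebra.Solver.Ring as RingSolver
open import Algebra.Solver.Ring.AlmostCommutativeRing using (fromCommutativeRing; _-Raw-AlmostCommutative⟶_)
open import Data.Nat as ℕ using (ℕ; zero; suc; _≤_; _<_; z≤n; s≤s; _∸_)
import Data.Nat.Properties as ℕP
import Data.Nat.DivMod as ℕD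
import Data.Nat.Divisibility as ℕV
import Data.Nat.Solver
open import Data.Integer as ℤ using (ℤ; -[1+_])
import Data.Integer.Properties as ℤP
open import Data.Rational as ℚ using (ℚ; 0ℚ; 1ℚ)
import Data.Rational.Properties as ℚP
open import Data.Fin using (#_)
open import Data.Vec using (Vec; []; _∷_)
open import Data.Maybe using (Maybe; just; nothing)
open import Data.Product using (Σ; _,_; proj₁; proj₂; ∃; _×_)
open import Data.Sum using (inj₁; inj₂)
open import Relation.Nullary using (yes; no; contradiction)
open import Relation.Binary.PropositionalEquality as ≡ using (_≡_; _≢_; refl; cong; cong₂; sym; trans)
import Defs

-- Polynomial identities in commutative rings

-- Ring solver with ℤ coefficients, so that cancellation is decided without deciding equality in R.
module Solver (R : CommutativeRing 0ℓ 0ℓ) where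
  open CommutativeRing R hiding (refl)
  private module R = CommutativeRing R
  open import Algebra.Properties.Ring (CommutativeRing.ring R)
  open import Relation.Binary.Reasoning.Setoid R.setoid

  -- The clause for 1 makes the constant 1 of the solver denote `1#` itself and not `1# + 0#`.
  fromℕ : ℕ → Carrier
  fromℕ 0 = 0#
  fromℕ 1 = 1#
  fromℕ (suc (suc n)) = 1# + fromℕ (suc n)

  fromℕ-suc : ∀ n → fromℕ (suc n) ≈ 1# + fromℕ n
  fromℕ-suc zero = R.sym (+-identityʳ 1#)
  fromℕ-suc (suc n) = R.refl

  fromℤ : ℤ → Carrier
  fromℤ (ℤ.+ n) = fromℕ n
  fromℤ -[1+ n ] = - fromℕ (suc n)

  fromℕ-+ : ∀ m n → fromℕ (m ℕ.+ n) ≈ fromℕ m + fromℕ n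
  fromℕ-+ zero n = R.sym (+-identityˡ _)
  fromℕ-+ (suc m) n = begin
    fromℕ (suc (m ℕ.+ n))        ≈⟨ fromℕ-suc (m ℕ.+ n) ⟩
    1# + fromℕ (m ℕ.+ n)         ≈⟨ +-congˡ (fromℕ-+ m n) ⟩
    1# + (fromℕ m + fromℕ n)     ≈⟨ +-assoc _ _ _ ⟨
    (1# + fromℕ m) + fromℕ n     ≈⟨ +-congʳ (fromℕ-suc m) ⟨
    fromℕ (suc m) + fromℕ n ∎

  fromℕ-* : ∀ m n → fromℕ (m ℕ.* n) ≈ fromℕ m * fromℕ n
  fromℕ-* zero n = R.sym (zeroˡ _)
  fromℕ-* (suc m) n = begin
    fromℕ (n ℕ.+ m ℕ.* n)            ≈⟨ fromℕ-+ n (m ℕ.* n) ⟩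
    fromℕ n + fromℕ (m ℕ.* n)        ≈⟨ +-cong (R.sym (*-identityˡ _)) (fromℕ-* m n) ⟩
    1# * fromℕ n + fromℕ m * fromℕ n ≈⟨ distribʳ _ _ _ ⟨
    (1# + fromℕ m) * fromℕ n         ≈⟨ *-congʳ (fromℕ-suc m) ⟨
    fromℕ (suc m) * fromℕ n ∎

  cancel-1 : ∀ a b → (1# + a) + - (1# + b) ≈ a + - b
  cancel-1 a b = begin
    (1# + a) + - (1# + b)      ≈⟨ +-congˡ (⁻¹-∙-comm 1# b) ⟨
    (1# + a) + (- 1# + - b)    ≈⟨ +-congʳ (+-comm 1# a) ⟩
    (a + 1#) + (- 1# + - b)    ≈⟨ +-assoc a 1# _ ⟩
    a + (1# + (- 1# + - b))    ≈⟨ +-congˡ (+-assoc 1# (- 1#) _) ⟨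
    a + ((1# + - 1#) + - b)    ≈⟨ +-congˡ (+-congʳ (-‿inverseʳ 1#)) ⟩
    a + (0# + - b)             ≈⟨ +-congˡ (+-identityˡ _) ⟩
    a + - b ∎
    where open import Algebra.Properties.AbelianGroup +-abelianGroup using (⁻¹-∙-comm)

  fromℤ-⊖ : ∀ m n → fromℤ (m ℤ.⊖ n) ≈ fromℕ m + - fromℕ n
  fromℤ-⊖ m zero = R.sym (R.trans (+-congˡ -0#≈0#) (+-identityʳ _))
  fromℤ-⊖ zero (suc n) = R.sym (+-identityˡ _)
  fromℤ-⊖ (suc m) (suc n) = begin
    fromℤ (suc m ℤ.⊖ suc n)            ≡⟨ cong fromℤ (ℤP.[1+m]⊖[1+n]≡m⊖n m n) ⟩
    fromℤ (m ℤ.⊖ n)                    ≈⟨ fromℤ-⊖ m n ⟩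
    fromℕ m + - fromℕ n                ≈⟨ cancel-1 _ _ ⟨
    (1# + fromℕ m) + - (1# + fromℕ n)  ≈⟨ +-cong (fromℕ-suc m) (-‿cong (fromℕ-suc n)) ⟨
    fromℕ (suc m) + - fromℕ (suc n) ∎

  fromℤ-neg : ∀ i → fromℤ (ℤ.- i) ≈ - fromℤ i
  fromℤ-neg (ℤ.+ zero) = R.sym -0#≈0#
  fromℤ-neg (ℤ.+ suc n) = R.refl
  fromℤ-neg -[1+ n ] = R.sym (-‿involutive _)

  fromℤ-+ : ∀ i j → fromℤ (i ℤ.+ j) ≈ fromℤ i + fromℤ j
  fromℤ-+ (ℤ.+ m) (ℤ.+ n) = fromℕ-+ m n
  fromℤ-+ (ℤ.+ m) -[1+ n ] = fromℤ-⊖ m (suc n)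
  fromℤ-+ -[1+ m ] (ℤ.+ n) = R.trans (fromℤ-⊖ n (suc m)) (+-comm _ _)
  fromℤ-+ -[1+ m ] -[1+ n ] = begin
    - fromℕ (suc (suc (m ℕ.+ n)))     ≡⟨ cong (λ k → - fromℕ (suc k)) (≡.sym (ℕP.+-suc m n)) ⟩
    - fromℕ (suc m ℕ.+ suc n)         ≈⟨ -‿cong (fromℕ-+ (suc m) (suc n)) ⟩
    - (fromℕ (suc m) + fromℕ (suc n)) ≈⟨ ⁻¹-∙-comm _ _ ⟨
    - fromℕ (suc m) + - fromℕ (suc n) ∎
    where open import Algebra.Properties.AbelianGroup +-abelianGroup using (⁻¹-∙-comm)

  fromℤ-*⁺ : ∀ m j → fromℤ (ℤ.+ m ℤ.* j) ≈ fromℕ m * fromℤ j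
  fromℤ-*⁺ m (ℤ.+ n) = begin
    fromℤ (ℤ.+ m ℤ.* ℤ.+ n) ≡⟨ cong fromℤ (≡.sym (ℤP.pos-* m n)) ⟩
    fromℕ (m ℕ.* n)     ≈⟨ fromℕ-* m n ⟩
    fromℕ m * fromℕ n ∎
  fromℤ-*⁺ m -[1+ n ] = begin
    fromℤ (ℤ.+ m ℤ.* ℤ.- ℤ.+ suc n)     ≡⟨ cong fromℤ (≡.sym (ℤP.neg-distribʳ-* (ℤ.+ m) (ℤ.+ suc n))) ⟩
    fromℤ (ℤ.- (ℤ.+ m ℤ.* ℤ.+ suc n))   ≈⟨ fromℤ-neg (ℤ.+ m ℤ.* ℤ.+ suc n) ⟩
    - fromℤ (ℤ.+ m ℤ.* ℤ.+ suc n)       ≈⟨ -‿cong (fromℤ-*⁺ m (ℤ.+ suc n)) ⟩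
    - (fromℕ m * fromℕ (suc n))     ≈⟨ -‿distribʳ-* _ _ ⟩
    fromℕ m * - fromℕ (suc n) ∎

  fromℤ-* : ∀ i j → fromℤ (i ℤ.* j) ≈ fromℤ i * fromℤ j
  fromℤ-* (ℤ.+ m) j = fromℤ-*⁺ m j
  fromℤ-* -[1+ m ] j = begin
    fromℤ (ℤ.- ℤ.+ suc m ℤ.* j)     ≡⟨ cong fromℤ (≡.sym (ℤP.neg-distribˡ-* (ℤ.+ suc m) j)) ⟩
    fromℤ (ℤ.- (ℤ.+ suc m ℤ.* j))   ≈⟨ fromℤ-neg (ℤ.+ suc m ℤ.* j) ⟩
    - fromℤ (ℤ.+ suc m ℤ.* j)       ≈⟨ -‿cong (fromℤ-*⁺ (suc m) j) ⟩
    - (fromℕ (suc m) * fromℤ j)   ≈⟨ -‿distribˡ-* _ _ ⟩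
    - fromℕ (suc m) * fromℤ j ∎

  fromℤ-homomorphism : ℤ.+-*-rawRing -Raw-AlmostCommutative⟶ fromCommutativeRing R
  fromℤ-homomorphism = record
    { ⟦_⟧ = fromℤ ; +-homo = fromℤ-+ ; *-homo = fromℤ-* ; -‿homo = fromℤ-neg
    ; 0-homo = R.refl ; 1-homo = R.refl }

  fromℤ-weaklyDecidable : ∀ i j → Maybe (fromℤ i ≈ fromℤ j)
  fromℤ-weaklyDecidable i j with i ℤ.≟ j
  ... | yes refl = just R.refl
  ... | no _ = nothing

  open RingSolver ℤ.+-*-rawRing (fromCommutativeRing R) fromℤ-homomorphism fromℤ-weaklyDecidable public
    using (solve; prove; _:=_; _:+_; _:*_; :-_; _:-_; con; var; Polynomial)

  :0 :1 :2 : ∀ {n} → Polynomial n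
  :0 = con (ℤ.+ 0)
  :1 = con (ℤ.+ 1)
  :2 = con (ℤ.+ 2)

-- Multiplication modulo 1 + ζ + ζ² + ζ³ + ζ⁴

-- The multiplication of Defs.K over an arbitrary ring of coefficients: over ℚ itself the operations
-- unfold on neutral terms, which makes the solver unusable there.
module QuadRing
  (A T : Set) (_+_ _-_ _*_ : A → A → A) (-_ : A → A) (0# 1# : A)
  (isCommutativeRing : IsCommutativeRing _≡_ _+_ _*_ -_ 0# 1#)
  (x-y≡x+-y : ∀ x y → x - y ≡ x + (- y))
  (⟨_,_,_,_⟩ : A → A → A → A → T)
  where
  private
    R : CommutativeRing 0ℓ 0ℓ
    R = record { isCommutativeRing = isCommutativeRing }
  open Solver R

  record Quad (B : Set) : Set where
    constructor quad
    field q₀ q₁ q₂ q₃ : B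
  open Quad

  -- Abstract in the operations because the same formula is needed on values and on polynomials,
  -- where it yields the syntax that the solver compares.
  module Mul {B : Set} (_⊞_ _⊟_ _⊠_ : B → B → B) where
    mul : Quad B → Quad B → Quad B
    mul (quad a₀ a₁ a₂ a₃) (quad b₀ b₁ b₂ b₃) =
      let p₄ = ((a₁ ⊠ b₃) ⊞ (a₂ ⊠ b₂)) ⊞ (a₃ ⊠ b₁)
      in quad (((a₀ ⊠ b₀) ⊞ ((a₂ ⊠ b₃) ⊞ (a₃ ⊠ b₂))) ⊟ p₄)
              ((((a₀ ⊠ b₁) ⊞ (a₁ ⊠ b₀)) ⊞ (a₃ ⊠ b₃)) ⊟ p₄)
              ((((a₀ ⊠ b₂) ⊞ (a₁ ⊠ b₁)) ⊞ (a₂ ⊠ b₀)) ⊟ p₄)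
              (((((a₀ ⊠ b₃) ⊞ (a₁ ⊠ b₂)) ⊞ (a₂ ⊠ b₁)) ⊞ (a₃ ⊠ b₀)) ⊟ p₄)
    add : Quad B → Quad B → Quad B
    add (quad a₀ a₁ a₂ a₃) (quad b₀ b₁ b₂ b₃) = quad (a₀ ⊞ b₀) (a₁ ⊞ b₁) (a₂ ⊞ b₂) (a₃ ⊞ b₃)

  open Mul _+_ _-_ _*_
  open Mul _+_ (λ x y → x + (- y)) _*_ using () renaming (mul to mul′)

  ⟪_⟫ : Quad A → T
  ⟪ quad a b c d ⟫ = ⟨ a , b , c , d ⟩

  private
    quad-cong : ∀ {a b c d a' b' c' d' : A} → a ≡ a' → b ≡ b' → c ≡ c' → d ≡ d' → quad a b c d ≡ quad a' b' c' d'
    quad-cong refl refl refl refl = refl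

    -- The solver evaluates a difference as `x + (- y)`. The version with the given `_-_` is kept
    -- because `⟪ mul x y ⟫` has to unfold to the product of ℚ(ζ) fixed by the statement.
    mul≡mul′ : ∀ x y → mul x y ≡ mul′ x y
    mul≡mul′ _ _ = quad-cong (x-y≡x+-y _ _) (x-y≡x+-y _ _) (x-y≡x+-y _ _) (x-y≡x+-y _ _)

    open Mul {Polynomial 12} _:+_ _:-_ _:*_ using () renaming (mul to mulP; add to addP)

    X Y Z 1P : Quad (Polynomial 12)
    X = quad (var (# 0)) (var (# 1)) (var (# 2)) (var (# 3))
    Y = quad (var (# 4)) (var (# 5)) (var (# 6)) (var (# 7))
    Z = quad (var (# 8)) (var (# 9)) (var (# 10)) (var (# 11))
    1P = quad :1 :0 :0 :0

    values : Quad A → Quad A → Quad A → Vec A 12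
    values x y z = q₀ x ∷ q₁ x ∷ q₂ x ∷ q₃ x ∷ q₀ y ∷ q₁ y ∷ q₂ y ∷ q₃ y ∷ q₀ z ∷ q₁ z ∷ q₂ z ∷ q₃ z ∷ []

    mul′-comm : ∀ x y → mul′ x y ≡ mul′ y x
    mul′-comm x y = quad-cong (prove ρ (q₀ l) (q₀ r) refl) (prove ρ (q₁ l) (q₁ r) refl) (prove ρ (q₂ l) (q₂ r) refl) (prove ρ (q₃ l) (q₃ r) refl)
      where
      ρ = values x y x
      l = mulP X Y
      r = mulP Y X

    mul′-distribˡ : ∀ x y z → mul′ x (add y z) ≡ add (mul′ x y) (mul′ x z)
    mul′-distribˡ x y z = quad-cong (prove ρ (q₀ l) (q₀ r) refl) (prove ρ (q₁ l) (q₁ r) refl) (prove ρ (q₂ l) (q₂ r) refl) (prove ρ (q₃ l) (q₃ r) refl)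
      where
      ρ = values x y z
      l = mulP X (addP Y Z)
      r = addP (mulP X Y) (mulP X Z)

    mul′-assoc : ∀ x y z → mul′ (mul′ x y) z ≡ mul′ x (mul′ y z)
    mul′-assoc x y z = quad-cong (prove ρ (q₀ l) (q₀ r) refl) (prove ρ (q₁ l) (q₁ r) refl) (prove ρ (q₂ l) (q₂ r) refl) (prove ρ (q₃ l) (q₃ r) refl)
      where
      ρ = values x y z
      l = mulP (mulP X Y) Z
      r = mulP X (mulP Y Z)

    mul′-identityˡ : ∀ x → mul′ (quad 1# 0# 0# 0#) x ≡ x
    mul′-identityˡ x = quad-cong (prove ρ (q₀ l) (q₀ r) refl) (prove ρ (q₁ l) (q₁ r) refl) (prove ρ (q₂ l) (q₂ r) refl) (prove ρ (q₃ l) (q₃ r) refl)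
      where
      ρ = values x x x
      l = mulP 1P X
      r = X

  mul-comm : ∀ x y → ⟪ mul x y ⟫ ≡ ⟪ mul y x ⟫
  mul-comm x y = cong ⟪_⟫ (trans (mul≡mul′ x y) (trans (mul′-comm x y) (sym (mul≡mul′ y x))))

  mul-assoc : ∀ x y z → ⟪ mul (mul x y) z ⟫ ≡ ⟪ mul x (mul y z) ⟫
  mul-assoc x y z = cong ⟪_⟫ (trans (mul-mulˡ) (trans (mul′-assoc x y z) (sym mul-mulʳ)))
    where
    mul-mulˡ : mul (mul x y) z ≡ mul′ (mul′ x y) z
    mul-mulˡ = trans (mul≡mul′ (mul x y) z) (cong (λ t → mul′ t z) (mul≡mul′ x y))
    mul-mulʳ : mul x (mul y z) ≡ mul′ x (mul′ y z)
    mul-mulʳ = trans (mul≡mul′ x (mul y z)) (cong (mul′ x) (mul≡mul′ y z))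

  mul-distribˡ : ∀ x y z → ⟪ mul x (add y z) ⟫ ≡ ⟪ add (mul x y) (mul x z) ⟫
  mul-distribˡ x y z = cong ⟪_⟫ (trans (mul≡mul′ x (add y z)) (trans (mul′-distribˡ x y z)
    (sym (cong₂ add (mul≡mul′ x y) (mul≡mul′ x z)))))

  mul-identityˡ : ∀ x → ⟪ mul (quad 1# 0# 0# 0#) x ⟫ ≡ ⟪ x ⟫
  mul-identityˡ x = cong ⟪_⟫ (trans (mul≡mul′ _ x) (mul′-identityˡ x))

-- The ring of formal power series

-- A record type determines its two series by unification, which the bare family of equations does
-- not.
record _≋_ {A : Set} (f g : ℕ → A) : Set where
  constructor pointwise
  field at : ∀ n → f n ≡ g n
open _≋_ public

-- The operations are parameters, specified by their defining equations, to keep them from unfolding.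
module SeriesRing
  (A : Set) (_+ᴬ_ _*ᴬ_ : A → A → A) (-ᴬ_ : A → A) (0ᴬ 1ᴬ : A)
  (isCommutativeRing : IsCommutativeRing _≡_ _+ᴬ_ _*ᴬ_ -ᴬ_ 0ᴬ 1ᴬ)
  (Σ≤ : ℕ → (ℕ → A) → A)
  (Σ≤-zero : ∀ f → Σ≤ 0 f ≡ f 0)
  (Σ≤-suc : ∀ n f → Σ≤ (suc n) f ≡ (Σ≤ n f +ᴬ f (suc n)))
  (_⊕_ _⊗_ : (ℕ → A) → (ℕ → A) → (ℕ → A))
  (⊝_ : (ℕ → A) → (ℕ → A))
  (const : A → (ℕ → A))
  (⊕-def : ∀ f g n → (f ⊕ g) n ≡ (f n +ᴬ g n))
  (⊗-def : ∀ f g n → (f ⊗ g) n ≡ Σ≤ n (λ k → f k *ᴬ g (n ∸ k)))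
  (⊝-def : ∀ f n → (⊝ f) n ≡ (-ᴬ f n))
  (const-zero : ∀ a → const a 0 ≡ a)
  (const-suc : ∀ a n → const a (suc n) ≡ 0ᴬ)
  where
  private
    Series = ℕ → A
    R : CommutativeRing 0ℓ 0ℓ
    R = record { isCommutativeRing = isCommutativeRing }
    module R = CommutativeRing R
    open R using (_+_; _*_; -_; 0#; 1#)
    infix 4 _≈_
    _≈_ : Series → Series → Set
    f ≈ g = ∀ n → f n ≡ g n
  open Solver R using (solve; _:=_; _:+_; _:*_)
  open ≡.≡-Reasoning

  tail : Series → Series
  tail f n = f (suc n)

  Σ≤-cong : ∀ n {f g : Series} → (∀ k → k ≤ n → f k ≡ g k) → Σ≤ n f ≡ Σ≤ n g
  Σ≤-cong zero {f} {g} e = trans (Σ≤-zero f) (trans (e 0 z≤n) (sym (Σ≤-zero g)))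
  Σ≤-cong (suc n) {f} {g} e = trans (Σ≤-suc n f) (trans
    (cong₂ _+_ (Σ≤-cong n (λ k k≤n → e k (ℕP.m≤n⇒m≤1+n k≤n))) (e (suc n) ℕP.≤-refl)) (sym (Σ≤-suc n g)))

  Σ≤-head : ∀ n f → Σ≤ (suc n) f ≡ (f 0 + Σ≤ n (tail f))
  Σ≤-head zero f = trans (Σ≤-suc 0 f) (cong₂ _+_ (Σ≤-zero f) (sym (Σ≤-zero (tail f))))
  Σ≤-head (suc n) f = begin
    Σ≤ (suc (suc n)) f                        ≡⟨ Σ≤-suc (suc n) f ⟩
    Σ≤ (suc n) f + f (suc (suc n))            ≡⟨ cong (_+ _) (Σ≤-head n f) ⟩
    (f 0 + Σ≤ n (tail f)) + f (suc (suc n))   ≡⟨ R.+-assoc _ _ _ ⟩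
    f 0 + (Σ≤ n (tail f) + f (suc (suc n)))   ≡⟨ cong (f 0 +_) (Σ≤-suc n (tail f)) ⟨
    f 0 + Σ≤ (suc n) (tail f) ∎

  ⊗-zero : ∀ f g → (f ⊗ g) 0 ≡ f 0 * g 0
  ⊗-zero f g = trans (⊗-def f g 0) (Σ≤-zero _)

  -- From f = f 0 + q · `tail f`. This recursion replaces all rearrangements of double sums: the
  -- ring laws follow by induction on the coefficient, for all series at once.
  ⊗-tailˡ : ∀ f g n → (f ⊗ g) (suc n) ≡ f 0 * g (suc n) + (tail f ⊗ g) n
  ⊗-tailˡ f g n = trans (⊗-def f g (suc n)) (trans (Σ≤-head n _) (cong (_ +_) (sym (⊗-def (tail f) g n))))

  ⊗-tailʳ : ∀ f g n → (f ⊗ g) (suc n) ≡ (f ⊗ tail g) n + f (suc n) * g 0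
  ⊗-tailʳ f g n = begin
    (f ⊗ g) (suc n)                                              ≡⟨ trans (⊗-def f g (suc n)) (Σ≤-suc n _) ⟩
    Σ≤ n (λ k → f k * g (suc n ∸ k)) + f (suc n) * g (n ∸ n)     ≡⟨ cong₂ _+_
                                                                      (Σ≤-cong n (λ k k≤n → cong (λ m → f k * g m) (ℕP.+-∸-assoc 1 k≤n)))
                                                                      (cong (λ m → f (suc n) * g m) (ℕP.n∸n≡0 n)) ⟩
    Σ≤ n (λ k → f k * tail g (n ∸ k)) + f (suc n) * g 0          ≡⟨ cong (_+ _) (⊗-def f (tail g) n) ⟨
    (f ⊗ tail g) n + f (suc n) * g 0 ∎

  ⊗-cong-≤ : ∀ n {f f' g g'} → (∀ k → k ≤ n → f k ≡ f' k) → (∀ k → k ≤ n → g k ≡ g' k) → (f ⊗ g) n ≡ (f' ⊗ g') n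
  ⊗-cong-≤ n {f} {f'} {g} {g'} p r = trans (⊗-def f g n)
    (trans (Σ≤-cong n (λ k k≤n → cong₂ _*_ (p k k≤n) (r (n ∸ k) (ℕP.m∸n≤m n k)))) (sym (⊗-def f' g' n)))

  ⊗-cong : ∀ {f f' g g'} → f ≈ f' → g ≈ g' → (f ⊗ g) ≈ (f' ⊗ g')
  ⊗-cong p r n = ⊗-cong-≤ n (λ k _ → p k) (λ k _ → r k)

  -- Peeling off the head of f on the left of one product and on the right of the other gives the
  -- same two pieces.
  ⊗-comm : ∀ f g → (f ⊗ g) ≈ (g ⊗ f)
  ⊗-comm f g zero = trans (⊗-zero f g) (trans (R.*-comm _ _) (sym (⊗-zero g f)))
  ⊗-comm f g (suc n) = begin
    (f ⊗ g) (suc n)                     ≡⟨ ⊗-tailˡ f g n ⟩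
    f 0 * g (suc n) + (tail f ⊗ g) n    ≡⟨ cong₂ _+_ (R.*-comm _ _) (⊗-comm (tail f) g n) ⟩
    g (suc n) * f 0 + (g ⊗ tail f) n    ≡⟨ R.+-comm _ _ ⟩
    (g ⊗ tail f) n + g (suc n) * f 0    ≡⟨ ⊗-tailʳ g f n ⟨
    (g ⊗ f) (suc n) ∎

  scale : A → Series → Series
  scale a f n = a * f n

  Σ≤-distribˡ : ∀ n a f → Σ≤ n (λ k → a * f k) ≡ a * Σ≤ n f
  Σ≤-distribˡ zero a f = trans (Σ≤-zero _) (cong (a *_) (sym (Σ≤-zero f)))
  Σ≤-distribˡ (suc n) a f = begin
    Σ≤ (suc n) (λ k → a * f k)              ≡⟨ Σ≤-suc n _ ⟩
    Σ≤ n (λ k → a * f k) + a * f (suc n)    ≡⟨ cong (_+ _) (Σ≤-distribˡ n a f) ⟩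
    a * Σ≤ n f + a * f (suc n)              ≡⟨ R.distribˡ a _ _ ⟨
    a * (Σ≤ n f + f (suc n))                ≡⟨ cong (a *_) (Σ≤-suc n f) ⟨
    a * Σ≤ (suc n) f ∎

  Σ≤-+ : ∀ n f g → Σ≤ n (λ k → f k + g k) ≡ Σ≤ n f + Σ≤ n g
  Σ≤-+ zero f g = trans (Σ≤-zero _) (cong₂ _+_ (sym (Σ≤-zero f)) (sym (Σ≤-zero g)))
  Σ≤-+ (suc n) f g = begin
    Σ≤ (suc n) (λ k → f k + g k)                            ≡⟨ trans (Σ≤-suc n _) (cong (_+ _) (Σ≤-+ n f g)) ⟩
    (Σ≤ n f + Σ≤ n g) + (f (suc n) + g (suc n))             ≡⟨ solve 4 (λ a b c d → (a :+ b) :+ (c :+ d)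
        := (a :+ c) :+ (b :+ d)) refl _ _ _ _ ⟩
    (Σ≤ n f + f (suc n)) + (Σ≤ n g + g (suc n))             ≡⟨ cong₂ _+_ (Σ≤-suc n f) (Σ≤-suc n g) ⟨
    Σ≤ (suc n) f + Σ≤ (suc n) g ∎

  scale-⊗ : ∀ a f g → (scale a f ⊗ g) ≈ scale a (f ⊗ g)
  scale-⊗ a f g n = trans (⊗-def (scale a f) g n)
    (trans (Σ≤-cong n (λ k _ → R.*-assoc a (f k) _)) (trans (Σ≤-distribˡ n a _) (cong (a *_) (sym (⊗-def f g n)))))

  ⊗-distribʳ : ∀ f g h → ((g ⊕ h) ⊗ f) ≈ ((g ⊗ f) ⊕ (h ⊗ f))
  ⊗-distribʳ f g h n = begin
    ((g ⊕ h) ⊗ f) n                                                        ≡⟨ ⊗-def (g ⊕ h) f n ⟩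
    Σ≤ n (λ k → (g ⊕ h) k * f (n ∸ k))                                     ≡⟨ Σ≤-cong n (λ k _ → trans (cong (_* _) (⊕-def g h k)) (R.distribʳ _ _ _)) ⟩
    Σ≤ n (λ k → g k * f (n ∸ k) + h k * f (n ∸ k))                         ≡⟨ Σ≤-+ n _ _ ⟩
    Σ≤ n (λ k → g k * f (n ∸ k)) + Σ≤ n (λ k → h k * f (n ∸ k))            ≡⟨ cong₂ _+_ (⊗-def g f n) (⊗-def h f n) ⟨
    (g ⊗ f) n + (h ⊗ f) n                                                  ≡⟨ ⊕-def _ _ n ⟨
    ((g ⊗ f) ⊕ (h ⊗ f)) n ∎

  tail-⊗ : ∀ f g → tail (f ⊗ g) ≈ (scale (f 0) (tail g) ⊕ (tail f ⊗ g))
  tail-⊗ f g n = trans (⊗-tailˡ f g n) (sym (⊕-def _ _ n))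

  ⊗-assoc : ∀ f g h → ((f ⊗ g) ⊗ h) ≈ (f ⊗ (g ⊗ h))
  ⊗-assoc f g h zero = begin
    ((f ⊗ g) ⊗ h) 0        ≡⟨ trans (⊗-zero _ h) (cong (_* _) (⊗-zero f g)) ⟩
    (f 0 * g 0) * h 0      ≡⟨ R.*-assoc _ _ _ ⟩
    f 0 * (g 0 * h 0)      ≡⟨ trans (⊗-zero f _) (cong (_ *_) (⊗-zero g h)) ⟨
    (f ⊗ (g ⊗ h)) 0 ∎
  ⊗-assoc f g h (suc n) = begin
    ((f ⊗ g) ⊗ h) (suc n)                                                        ≡⟨ ⊗-tailˡ _ h n ⟩
    (f ⊗ g) 0 * h (suc n) + (tail (f ⊗ g) ⊗ h) n                                 ≡⟨ cong₂ _+_ (cong (_* _) (⊗-zero f g)) tails ⟩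
    (f 0 * g 0) * h (suc n) + (f 0 * (tail g ⊗ h) n + (tail f ⊗ (g ⊗ h)) n)      ≡⟨ solve 5 (λ a b c d e → (a :* b) :* c :+ (a :* d :+ e)
        := a :* (b :* c :+ d) :+ e) refl _ _ _ _ _ ⟩
    f 0 * (g 0 * h (suc n) + (tail g ⊗ h) n) + (tail f ⊗ (g ⊗ h)) n              ≡⟨ cong (λ t → f 0 * t + (tail f ⊗ (g ⊗ h)) n) (⊗-tailˡ g h n) ⟨
    f 0 * (g ⊗ h) (suc n) + (tail f ⊗ (g ⊗ h)) n                                 ≡⟨ ⊗-tailˡ f _ n ⟨
    (f ⊗ (g ⊗ h)) (suc n) ∎
    where
    tails : (tail (f ⊗ g) ⊗ h) n ≡ f 0 * (tail g ⊗ h) n + (tail f ⊗ (g ⊗ h)) n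
    tails = begin
      (tail (f ⊗ g) ⊗ h) n                                     ≡⟨ ⊗-cong (tail-⊗ f g) (λ _ → refl) n ⟩
      ((scale (f 0) (tail g) ⊕ (tail f ⊗ g)) ⊗ h) n            ≡⟨ ⊗-distribʳ h _ _ n ⟩
      ((scale (f 0) (tail g) ⊗ h) ⊕ ((tail f ⊗ g) ⊗ h)) n      ≡⟨ ⊕-def _ _ n ⟩
      (scale (f 0) (tail g) ⊗ h) n + ((tail f ⊗ g) ⊗ h) n      ≡⟨ cong₂ _+_ (scale-⊗ (f 0) (tail g) h n) (⊗-assoc (tail f) g h n) ⟩
      f 0 * (tail g ⊗ h) n + (tail f ⊗ (g ⊗ h)) n ∎

  0-⊗ : ∀ f g → (∀ n → f n ≡ 0#) → ∀ n → (f ⊗ g) n ≡ 0#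
  0-⊗ f g f≡0 zero = trans (⊗-zero f g) (trans (cong (_* _) (f≡0 0)) (R.zeroˡ _))
  0-⊗ f g f≡0 (suc n) = trans (⊗-tailˡ f g n) (trans
    (cong₂ _+_ (trans (cong (_* _) (f≡0 0)) (R.zeroˡ _)) (0-⊗ (tail f) g (λ k → f≡0 (suc k)) n)) (R.+-identityˡ _))

  const-⊗ : ∀ a f n → (const a ⊗ f) n ≡ a * f n
  const-⊗ a f zero = trans (⊗-zero _ f) (cong (_* _) (const-zero a))
  const-⊗ a f (suc n) = trans (⊗-tailˡ _ f n) (trans
    (cong₂ _+_ (cong (_* _) (const-zero a)) (0-⊗ _ f (const-suc a) n)) (R.+-identityʳ _))

  isCommutativeRing-Series : IsCommutativeRing _≋_ _⊕_ _⊗_ ⊝_ (const 0#) (const 1#)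
  isCommutativeRing-Series = record
    { isRing = record
      { +-isAbelianGroup = record
        { isGroup = record
          { isMonoid = record
            { isSemigroup = record
              { isMagma = record
                { isEquivalence = record
                  { refl = pointwise λ _ → refl
                  ; sym = λ p → pointwise λ n → sym (at p n)
                  ; trans = λ p r → pointwise λ n → trans (at p n) (at r n) }
                ; ∙-cong = λ p r → pointwise λ n → trans (⊕-def _ _ n) (trans (cong₂ _+_ (at p n) (at r n)) (sym (⊕-def _ _ n))) }
              ; assoc = λ f g h → pointwise λ n → trans (trans (⊕-def _ h n) (cong (_+ _) (⊕-def f g n)))
                  (trans (R.+-assoc _ _ _) (sym (trans (⊕-def f _ n) (cong (_ +_) (⊕-def g h n))))) }
            ; identity = (λ f → pointwise (⊕-identityˡ f)) , λ f → pointwise λ n → trans (⊕-comm f (const 0#) n) (⊕-identityˡ f n) }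
          ; inverse = (λ f → pointwise (⊝-inverseˡ f)) , λ f → pointwise λ n → trans (⊕-comm f (⊝ f) n) (⊝-inverseˡ f n)
          ; ⁻¹-cong = λ p → pointwise λ n → trans (⊝-def _ n) (trans (cong -_ (at p n)) (sym (⊝-def _ n))) }
        ; comm = λ f g → pointwise (⊕-comm f g) }
      ; *-cong = λ p r → pointwise (⊗-cong (at p) (at r))
      ; *-assoc = λ f g h → pointwise (⊗-assoc f g h)
      ; *-identity = (λ f → pointwise (⊗-identityˡ f)) , λ f → pointwise λ n → trans (⊗-comm f (const 1#) n) (⊗-identityˡ f n)
      ; distrib = (λ f g h → pointwise λ n → trans (⊗-comm f (g ⊕ h) n) (trans (⊗-distribʳ f g h n)
                    (trans (⊕-def _ _ n) (trans (cong₂ _+_ (⊗-comm g f n) (⊗-comm h f n)) (sym (⊕-def _ _ n))))))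
                , λ f g h → pointwise (⊗-distribʳ f g h) }
    ; *-comm = λ f g → pointwise (⊗-comm f g) }
    where
    const-0 : ∀ n → const 0# n ≡ 0#
    const-0 zero = const-zero 0#
    const-0 (suc n) = const-suc 0# n
    ⊕-comm : ∀ f g → (f ⊕ g) ≈ (g ⊕ f)
    ⊕-comm f g n = trans (⊕-def f g n) (trans (R.+-comm _ _) (sym (⊕-def g f n)))
    ⊕-identityˡ : ∀ f → (const 0# ⊕ f) ≈ f
    ⊕-identityˡ f n = trans (⊕-def _ f n) (trans (cong (_+ _) (const-0 n)) (R.+-identityˡ _))
    ⊝-inverseˡ : ∀ f → ((⊝ f) ⊕ f) ≈ const 0#
    ⊝-inverseˡ f n = trans (⊕-def _ f n) (trans (cong (_+ _) (⊝-def f n)) (trans (R.-‿inverseˡ _) (sym (const-0 n))))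
    ⊗-identityˡ : ∀ f → (const 1# ⊗ f) ≈ f
    ⊗-identityˡ f n = trans (const-⊗ 1# f n) (R.*-identityˡ _)

  -- Divisibility by q^n: the filtration by powers of the ideal (q).
  O : ℕ → Series → Set
  O n f = ∀ i → i < n → f i ≡ 0#

  O-⊗ : ∀ {m n f g} → O m f → O n g → O (m ℕ.+ n) (f ⊗ g)
  O-⊗ {zero} {n} {f} {g} p r i i<n = trans (⊗-def f g i) (trans
    (Σ≤-cong i (λ k _ → trans (cong (_ *_) (r (i ∸ k) (ℕP.≤-<-trans (ℕP.m∸n≤m i k) i<n))) (R.zeroʳ _)))
    (Σ≤-0 i))
    where
    Σ≤-0 : ∀ i → Σ≤ i (λ _ → 0#) ≡ 0#
    Σ≤-0 zero = Σ≤-zero _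
    Σ≤-0 (suc i) = trans (Σ≤-suc i _) (trans (cong (_+ 0#) (Σ≤-0 i)) (R.+-identityˡ _))
  O-⊗ {suc m} {n} {f} {g} p r zero i<n = trans (⊗-zero f g) (trans (cong (_* _) (p 0 (s≤s z≤n))) (R.zeroˡ _))
  O-⊗ {suc m} {n} {f} {g} p r (suc i) (s≤s i<n) = trans (⊗-tailˡ f g i) (trans
    (cong₂ _+_ (trans (cong (_* _) (p 0 (s≤s z≤n))) (R.zeroˡ _))
      (O-⊗ {m} {n} {tail f} {g} (λ k k<m → p (suc k) (s≤s k<m)) r i i<n)) (R.+-identityˡ _))

-- Limits, sums and products in a complete ring

-- A commutative ring, complete and separated for the topology of a decreasing filtration O by ideals.
record CompleteRing : Set₁ where
  field
    ring : CommutativeRing 0ℓ 0ℓ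
  open CommutativeRing ring
  field
    O       : ℕ → Carrier → Set
    O-≈     : ∀ {n f g} → f ≈ g → O n f → O n g
    O-zero  : ∀ f → O 0 f
    O-0#    : ∀ n → O n 0#
    O-+     : ∀ {n f g} → O n f → O n g → O n (f + g)
    O-neg   : ∀ {n f} → O n f → O n (- f)
    O-*     : ∀ {m n f g} → O m f → O n g → O (m ℕ.+ n) (f * g)
    O-≤     : ∀ {m n f} → m ≤ n → O n f → O m f
    O-sep   : ∀ {f} → (∀ n → O n f) → f ≈ 0#
    -- Convergence at a fixed rate: step m changes nothing below order m. This lets the limit be a
    -- total function, specified only on sequences of that rate.
    lim     : (ℕ → Carrier) → Carrier
    lim-O   : ∀ F → (∀ m → O m (F (suc m) - F m)) → ∀ m → O m (F m - lim F)

module Limits (C : CompleteRing) where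
  open CompleteRing C public hiding (ring)
  open CommutativeRing (CompleteRing.ring C) public
    renaming (refl to ≈-refl; sym to ≈-sym; trans to ≈-trans; reflexive to ≈-reflexive)
    hiding (ring)
  open Solver (CompleteRing.ring C) public using (solve; _:=_; _:+_; _:*_; :-_; _:-_; :0; :1; :2; Polynomial)
  open import Relation.Binary.Reasoning.Setoid setoid public
  open import Algebra.Properties.Ring (CommutativeRing.ring (CompleteRing.ring C)) public using (-0#≈0#)

  infix 4 _⟶_
  _⟶_ : (ℕ → Carrier) → Carrier → Set
  F ⟶ s = ∀ n → ∃ λ M → ∀ m → M ≤ m → O n (F m - s)

  O-*ʳ : ∀ {n f g} → O n g → O n (f * g)
  O-*ʳ p = O-* (O-zero _) p

  O-*ˡ : ∀ {n f g} → O n f → O n (f * g)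
  O-*ˡ p = O-≈ (*-comm _ _) (O-*ʳ p)

  ≈⇒O- : ∀ {n f g} → f ≈ g → O n (f - g)
  ≈⇒O- {n} {f} {g} p = O-≈ (≈-trans (≈-sym (-‿inverseʳ g)) (+-congʳ (≈-sym p))) (O-0# n)

  O-trans : ∀ {n f g h} → O n (f - g) → O n (g - h) → O n (f - h)
  O-trans {n} {f} {g} {h} p r =
    O-≈ (solve 3 (λ f g h → (f :- g) :+ (g :- h) := f :- h) ≈-refl f g h) (O-+ p r)

  O-sym : ∀ {n f g} → O n (f - g) → O n (g - f)
  O-sym {n} {f} {g} p = O-≈ (solve 2 (λ f g → :- (f :- g) := g :- f) ≈-refl f g) (O-neg p)

  O-+-cong : ∀ {n f g f' g'} → O n (f - f') → O n (g - g') → O n ((f + g) - (f' + g'))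
  O-+-cong {n} {f} {g} {f'} {g'} p r =
    O-≈ (solve 4 (λ f g f' g' → (f :- f') :+ (g :- g') := (f :+ g) :- (f' :+ g')) ≈-refl f g f' g') (O-+ p r)

  O-*-cong : ∀ {n f g f' g'} → O n (f - f') → O n (g - g') → O n (f * g - f' * g')
  O-*-cong {n} {f} {g} {f'} {g'} p r =
    O-≈ (solve 4 (λ f g f' g' → (f :- f') :* g :+ f' :* (g :- g') := f :* g :- f' :* g') ≈-refl f g f' g')
      (O-+ (O-*ˡ p) (O-*ʳ r))

  O--cong : ∀ {n f f'} → O n (f - f') → O n (- f - - f')
  O--cong {n} {f} {f'} p = O-≈ (solve 2 (λ f f' → :- (f :- f') := (:- f) :- (:- f')) ≈-refl f f') (O-neg p)

  O-sep-≈ : ∀ {f g} → (∀ n → O n (f - g)) → f ≈ g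
  O-sep-≈ {f} {g} p = ≈-trans (solve 2 (λ f g → f := (f :- g) :+ g) ≈-refl f g)
    (≈-trans (+-congʳ (O-sep p)) (+-identityˡ g))

  ⟶-unique : ∀ {F s t} → F ⟶ s → F ⟶ t → s ≈ t
  ⟶-unique p r = O-sep-≈ λ n →
    let M , P = p n ; N , R = r n
    in O-trans (O-sym (P (M ℕ.+ N) (ℕP.m≤m+n M N))) (R (M ℕ.+ N) (ℕP.m≤n+m N M))

  ⟶-const : ∀ s → (λ _ → s) ⟶ s
  ⟶-const s n = 0 , λ _ _ → ≈⇒O- ≈-refl

  ⟶-cong : ∀ {F G s} → (∀ m → F m ≈ G m) → F ⟶ s → G ⟶ s
  ⟶-cong e p n = let M , P = p n in M , λ m M≤m → O-≈ (+-congʳ (e m)) (P m M≤m)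

  ⟶-resp : ∀ {F s t} → s ≈ t → F ⟶ s → F ⟶ t
  ⟶-resp e p n = let M , P = p n in M , λ m M≤m → O-≈ (+-congˡ (-‿cong e)) (P m M≤m)

  private
    zip : ∀ {F G s t} {_∙_ : Carrier → Carrier → Carrier} →
      (∀ {n f g f' g'} → O n (f - f') → O n (g - g') → O n ((f ∙ g) - (f' ∙ g'))) →
      F ⟶ s → G ⟶ t → (λ m → F m ∙ G m) ⟶ (s ∙ t)
    zip c p r n = let M , P = p n ; N , R = r n in M ℕ.+ N , λ m M+N≤m →
      c (P m (ℕP.≤-trans (ℕP.m≤m+n M N) M+N≤m)) (R m (ℕP.≤-trans (ℕP.m≤n+m N M) M+N≤m))

  ⟶-+ : ∀ {F G s t} → F ⟶ s → G ⟶ t → (λ m → F m + G m) ⟶ (s + t)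
  ⟶-+ = zip {_∙_ = _+_} O-+-cong

  ⟶-* : ∀ {F G s t} → F ⟶ s → G ⟶ t → (λ m → F m * G m) ⟶ (s * t)
  ⟶-* = zip {_∙_ = _*_} O-*-cong

  ⟶-neg : ∀ {F s} → F ⟶ s → (λ m → - F m) ⟶ (- s)
  ⟶-neg p n = let M , P = p n in M , λ m M≤m → O--cong (P m M≤m)

  ⟶-sub : ∀ {F s} (φ : ℕ → ℕ) → (∀ m → m ≤ φ m) → F ⟶ s → (λ m → F (φ m)) ⟶ s
  ⟶-sub φ le p n = let M , P = p n in M , λ m M≤m → P (φ m) (ℕP.≤-trans M≤m (le m))

  -- The rate `m ∸ 1` is the one that `anti-limit` attains: one order is lost to the lag allowed by
  -- `Decays`.
  ⟶-close : ∀ {F G s} → (∀ m → O (m ∸ 1) (F m - G m)) → F ⟶ s → G ⟶ s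
  ⟶-close {F} {G} e p n = let M , P = p n in suc n ℕ.+ M , λ m le →
    O-trans (O-sym {n} {F m} {G m} (O-≤ (ℕP.∸-monoˡ-≤ 1 (ℕP.≤-trans (ℕP.m≤m+n (suc n) M) le)) (e m))) (P m (ℕP.≤-trans (ℕP.m≤n+m M (suc n)) le))

  lim-⟶ : ∀ F → (∀ m → O m (F (suc m) - F m)) → F ⟶ lim F
  lim-⟶ F c n = n , λ m n≤m → O-≤ n≤m (lim-O F c m)

  infixr 8 _^_
  _^_ : Carrier → ℕ → Carrier
  a ^ zero = 1#
  a ^ suc n = a * a ^ n

  ^-cong : ∀ {a b} n → a ≈ b → a ^ n ≈ b ^ n
  ^-cong zero e = ≈-refl
  ^-cong (suc n) e = *-cong e (^-cong n e)

  ^-+ : ∀ a m n → a ^ (m ℕ.+ n) ≈ a ^ m * a ^ n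
  ^-+ a zero n = ≈-sym (*-identityˡ _)
  ^-+ a (suc m) n = ≈-trans (*-congˡ (^-+ a m n)) (≈-sym (*-assoc _ _ _))

  *-^ : ∀ a b n → (a * b) ^ n ≈ a ^ n * b ^ n
  *-^ a b zero = ≈-sym (*-identityˡ _)
  *-^ a b (suc n) = ≈-trans (*-congˡ (*-^ a b n))
    (solve 4 (λ a b x y → (a :* b) :* (x :* y) := (a :* x) :* (b :* y)) ≈-refl a b _ _)

  ^-* : ∀ a m n → a ^ (m ℕ.* n) ≈ (a ^ n) ^ m
  ^-* a zero n = ≈-refl
  ^-* a (suc m) n = ≈-trans (^-+ a n (m ℕ.* n)) (*-congˡ (^-* a m n))

  1^ : ∀ n → 1# ^ n ≈ 1#
  1^ zero = ≈-refl
  1^ (suc n) = ≈-trans (*-identityˡ _) (1^ n)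

  O-^ : ∀ {m a} n → O m a → O (n ℕ.* m) (a ^ n)
  O-^ zero p = O-zero _
  O-^ (suc n) p = O-* p (O-^ n p)

  O1-^ : ∀ {a} n → O 1 a → O n (a ^ n)
  O1-^ {a} n p = ≡.subst (λ k → O k (a ^ n)) (ℕP.*-identityʳ n) (O-^ n p)

  Σ< : ℕ → (ℕ → Carrier) → Carrier
  Σ< zero F = 0#
  Σ< (suc m) F = Σ< m F + F m

  Σ<-cong : ∀ m {F G} → (∀ k → k < m → F k ≈ G k) → Σ< m F ≈ Σ< m G
  Σ<-cong zero e = ≈-refl
  Σ<-cong (suc m) e = +-cong (Σ<-cong m (λ k k<m → e k (ℕP.m≤n⇒m≤1+n k<m))) (e m ℕP.≤-refl)

  Σ<-head : ∀ m F → Σ< (suc m) F ≈ F 0 + Σ< m (λ k → F (suc k))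
  Σ<-head zero F = +-comm _ _
  Σ<-head (suc m) F = ≈-trans (+-congʳ (Σ<-head m F)) (+-assoc _ _ _)

  Σ<-distribˡ : ∀ m a F → a * Σ< m F ≈ Σ< m (λ k → a * F k)
  Σ<-distribˡ zero a F = zeroʳ a
  Σ<-distribˡ (suc m) a F = ≈-trans (distribˡ _ _ _) (+-congʳ (Σ<-distribˡ m a F))

  Σ<-+ : ∀ m F G → Σ< m (λ k → F k + G k) ≈ Σ< m F + Σ< m G
  Σ<-+ zero F G = ≈-sym (+-identityʳ _)
  Σ<-+ (suc m) F G = ≈-trans (+-congʳ (Σ<-+ m F G))
    (solve 4 (λ a b c d → (a :+ b) :+ (c :+ d) := (a :+ c) :+ (b :+ d)) ≈-refl _ _ _ _)

  O-Σ< : ∀ {n} m {F} → (∀ k → k < m → O n (F k)) → O n (Σ< m F)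
  O-Σ< zero e = O-0# _
  O-Σ< (suc m) e = O-+ (O-Σ< m (λ k k<m → e k (ℕP.m≤n⇒m≤1+n k<m))) (e m ℕP.≤-refl)

  Σ∞ : (ℕ → Carrier) → Carrier
  Σ∞ F = lim (λ m → Σ< m F)

  Σ∞-⟶ : ∀ {F} → (∀ k → O k (F k)) → (λ m → Σ< m F) ⟶ Σ∞ F
  Σ∞-⟶ {F} p = lim-⟶ _ λ m → O-≈ (solve 2 (λ s t → t := (s :+ t) :- s) ≈-refl _ _) (p m)

  Σ∞-cong : ∀ {F G} → (∀ k → O k (F k)) → (∀ k → F k ≈ G k) → Σ∞ F ≈ Σ∞ G
  Σ∞-cong {F} {G} p e = ⟶-unique (⟶-cong (λ m → Σ<-cong m (λ k _ → e k)) (Σ∞-⟶ p)) (Σ∞-⟶ (λ k → O-≈ (e k) (p k)))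

  Σ∞-head : ∀ {F} → (∀ k → O k (F k)) → Σ∞ F ≈ F 0 + Σ∞ (λ k → F (suc k))
  Σ∞-head {F} p = ⟶-unique (⟶-sub suc (λ m → ℕP.n≤1+n m) (Σ∞-⟶ p))
    (⟶-cong (λ m → ≈-sym (Σ<-head m F)) (⟶-+ (⟶-const (F 0)) (Σ∞-⟶ (λ k → O-≤ (ℕP.n≤1+n k) (p (suc k))))))

  Σ∞-distribˡ : ∀ a {F} → (∀ k → O k (F k)) → a * Σ∞ F ≈ Σ∞ (λ k → a * F k)
  Σ∞-distribˡ a {F} p = ⟶-unique (⟶-* (⟶-const a) (Σ∞-⟶ p))
    (⟶-cong (λ m → ≈-sym (Σ<-distribˡ m a F)) (Σ∞-⟶ (λ k → O-*ʳ (p k))))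

  Σ∞-+ : ∀ {F G} → (∀ k → O k (F k)) → (∀ k → O k (G k)) → Σ∞ (λ k → F k + G k) ≈ Σ∞ F + Σ∞ G
  Σ∞-+ {F} {G} p r = ⟶-unique (Σ∞-⟶ (λ k → O-+ (p k) (r k)))
    (⟶-cong (λ m → ≈-sym (Σ<-+ m F G)) (⟶-+ (Σ∞-⟶ p) (Σ∞-⟶ r)))

  geom : Carrier → Carrier
  geom h = Σ∞ (h ^_)

  Σ<-geom : ∀ h m → (1# - h) * Σ< m (h ^_) ≈ 1# - h ^ m
  Σ<-geom h zero = solve 1 (λ h → (:1 :- h) :* :0 := :1 :- :1) ≈-refl h
  Σ<-geom h (suc m) = ≈-trans (distribˡ _ _ _) (≈-trans (+-congʳ (Σ<-geom h m))
    (solve 2 (λ h x → (:1 :- x) :+ (:1 :- h) :* x := :1 :- h :* x) ≈-refl h _))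

  ^-⟶0 : ∀ {h} → O 1 h → (h ^_) ⟶ 0#
  ^-⟶0 {h} p n = n , λ m n≤m → O-≈ (solve 1 (λ x → x := x :- :0) ≈-refl _) (O-≤ n≤m (O1-^ m p))

  geom-inverse : ∀ {h} → O 1 h → (1# - h) * geom h ≈ 1#
  geom-inverse {h} p = ⟶-unique (⟶-* (⟶-const (1# - h)) (Σ∞-⟶ (λ k → O1-^ k p)))
    (⟶-cong (λ m → ≈-sym (Σ<-geom h m)) (⟶-resp (solve 0 (:1 :- :0 := :1) ≈-refl)
      (⟶-+ (⟶-const 1#) (⟶-neg (^-⟶0 p)))))

  -- The abstract ring may have zero divisors, so every cancellation goes through an explicit
  -- reciprocal.
  record Unit (f : Carrier) : Set where
    constructor unit
    field
      recip : Carrier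
      inverse : f * recip ≈ 1#
  open Unit public

  *-cancelˡ-unit : ∀ {f g h} → Unit f → f * g ≈ f * h → g ≈ h
  *-cancelˡ-unit {f} {g} {h} (unit r e) p = begin
    g           ≈⟨ lemma g ⟩
    r * (f * g) ≈⟨ *-congˡ p ⟩
    r * (f * h) ≈⟨ lemma h ⟨
    h ∎
    where
    lemma : ∀ g → g ≈ r * (f * g)
    lemma g = ≈-trans (≈-sym (≈-trans (*-congʳ e) (*-identityˡ g)))
      (solve 3 (λ f r g → (f :* r) :* g := r :* (f :* g)) ≈-refl f r g)

  *-unit : ∀ {f g} → Unit f → Unit g → Unit (f * g)
  *-unit {f} {g} (unit r e) (unit s d) = unit (r * s)
    (≈-trans (solve 4 (λ f g r s → (f :* g) :* (r :* s) := (f :* r) :* (g :* s)) ≈-refl f g r s)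
      (≈-trans (*-cong e d) (*-identityˡ 1#)))

  1-h-unit : ∀ {h} → O 1 h → Unit (1# - h)
  1-h-unit {h} p = unit (geom h) (geom-inverse p)

  ⟶-unit : ∀ {F G s t} → F ⟶ s → G ⟶ t → (∀ m → F m * G m ≈ 1#) → s * t ≈ 1#
  ⟶-unit p r e = ⟶-unique (⟶-* p r) (⟶-cong (λ m → ≈-sym (e m)) (⟶-const 1#))

  -- (a ; p)_m and (a ; p)_∞
  qp : Carrier → Carrier → ℕ → Carrier
  qp a p zero = 1#
  qp a p (suc m) = qp a p m * (1# - a * p ^ m)

  qp∞ : Carrier → Carrier → Carrier
  qp∞ a p = lim (qp a p)

  qp-O : ∀ {p} a → O 1 p → ∀ m → O m (qp a p (suc m) - qp a p m)
  qp-O {p} a op m = O-≈ (solve 3 (λ s a x → :- (s :* a :* x) := s :* (:1 :- a :* x) :- s) ≈-refl (qp a p m) a (p ^ m))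
    (O-neg (O-*ʳ (O1-^ m op)))

  qp∞-⟶ : ∀ {p} a → O 1 p → qp a p ⟶ qp∞ a p
  qp∞-⟶ a op = lim-⟶ _ (qp-O a op)

  qp-cong : ∀ {a b p r} m → a ≈ b → p ≈ r → qp a p m ≈ qp b r m
  qp-cong zero _ _ = ≈-refl
  qp-cong (suc m) d e = *-cong (qp-cong m d e) (+-congˡ (-‿cong (*-cong d (^-cong m e))))

  qp∞-cong : ∀ {a b p r} → O 1 p → a ≈ b → p ≈ r → qp∞ a p ≈ qp∞ b r
  qp∞-cong {a} {b} op d e = ⟶-unique (⟶-cong (λ m → qp-cong m d e) (qp∞-⟶ a op)) (qp∞-⟶ b (O-≈ e op))

  qp-head : ∀ a p m → qp a p (suc m) ≈ (1# - a) * qp (a * p) p m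
  qp-head a p zero = solve 1 (λ a → :1 :* (:1 :- a :* :1) := (:1 :- a) :* :1) ≈-refl a
  qp-head a p (suc m) = ≈-trans (*-congʳ (qp-head a p m))
    (solve 4 (λ a p s x → (:1 :- a) :* s :* (:1 :- a :* (p :* x)) := (:1 :- a) :* (s :* (:1 :- (a :* p) :* x))) ≈-refl a p _ (p ^ m))

  qp∞-head : ∀ {p} a → O 1 p → qp∞ a p ≈ (1# - a) * qp∞ (a * p) p
  qp∞-head {p} a op = ⟶-unique (⟶-sub suc ℕP.n≤1+n (qp∞-⟶ a op))
    (⟶-cong (λ m → ≈-sym (qp-head a p m)) (⟶-* (⟶-const _) (qp∞-⟶ (a * p) op)))

  rqp : Carrier → Carrier → ℕ → Carrier
  rqp a p zero = 1#
  rqp a p (suc m) = rqp a p m * geom (a * p ^ m)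

  rqp-inverse : ∀ {a} p → O 1 a → ∀ m → qp a p m * rqp a p m ≈ 1#
  rqp-inverse p oa zero = *-identityˡ _
  rqp-inverse {a} p oa (suc m) = ≈-trans (solve 4 (λ s t x y → (s :* x) :* (t :* y) := (s :* t) :* (x :* y)) ≈-refl _ _ _ _)
    (≈-trans (*-cong (rqp-inverse p oa m) (geom-inverse (O-*ˡ oa))) (*-identityˡ _))

  geom-1 : ∀ {h} → O 1 h → geom h - 1# ≈ h * geom h
  geom-1 {h} oh = ≈-trans (+-congˡ (-‿cong (≈-sym (geom-inverse oh))))
    (solve 2 (λ h g → g :- (:1 :- h) :* g := h :* g) ≈-refl h (geom h))

  rqp-O : ∀ {a p} → O 1 a → O 1 p → ∀ m → O m (rqp a p (suc m) - rqp a p m)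
  rqp-O {a} {p} oa op m = O-≈ (≈-trans (*-congˡ (≈-sym (geom-1 (O-*ˡ oa))))
      (solve 2 (λ r g → r :* (g :- :1) := r :* g :- r) ≈-refl (rqp a p m) _))
    (O-*ʳ (O-*ˡ (O-*ʳ (O1-^ m op))))

  rqp∞ : Carrier → Carrier → Carrier
  rqp∞ a p = lim (rqp a p)

  rqp∞-inverse : ∀ {a p} → O 1 a → O 1 p → qp∞ a p * rqp∞ a p ≈ 1#
  rqp∞-inverse {a} {p} oa op = ⟶-unit (qp∞-⟶ a op) (lim-⟶ _ (rqp-O oa op)) (rqp-inverse p oa)

  qp∞-unit : ∀ {a p} → O 1 a → O 1 p → Unit (qp∞ a p)
  qp∞-unit oa op = unit _ (rqp∞-inverse oa op)

-- Bilateral sums and the Jacobi triple product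

module Theta (C : CompleteRing) where
  open Limits C public

  -- Σ_{i+j=m} F i j
  anti : ℕ → (ℕ → ℕ → Carrier) → Carrier
  anti zero F = F 0 0
  anti (suc m) F = F 0 (suc m) + anti m (λ i j → F (suc i) j)

  anti-cong : ∀ m {F G : ℕ → ℕ → Carrier} → (∀ i j → i ℕ.+ j ≡ m → F i j ≈ G i j) → anti m F ≈ anti m G
  anti-cong zero e = e 0 0 refl
  anti-cong (suc m) e = +-cong (e 0 (suc m) refl) (anti-cong m (λ i j p → e (suc i) j (cong suc p)))

  anti-last : ∀ m F → anti (suc m) F ≈ anti m (λ i j → F i (suc j)) + F (suc m) 0
  anti-last zero F = ≈-refl
  anti-last (suc m) F = ≈-trans (+-congˡ (anti-last m (λ i j → F (suc i) j))) (≈-sym (+-assoc _ _ _))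

  anti-flip : ∀ m F → anti m F ≈ anti m (λ i j → F j i)
  anti-flip zero F = ≈-refl
  anti-flip (suc m) F = ≈-trans (anti-last m F) (≈-trans (+-congʳ (anti-flip m (λ i j → F i (suc j)))) (+-comm _ _))

  anti-distribˡ : ∀ m a F → a * anti m F ≈ anti m (λ i j → a * F i j)
  anti-distribˡ zero a F = ≈-refl
  anti-distribˡ (suc m) a F = ≈-trans (distribˡ _ _ _) (+-congˡ (anti-distribˡ m a (λ i j → F (suc i) j)))

  anti-+ : ∀ m F G → anti m (λ i j → F i j + G i j) ≈ anti m F + anti m G
  anti-+ zero F G = ≈-refl
  anti-+ (suc m) F G = ≈-trans (+-congˡ (anti-+ m (λ i j → F (suc i) j) (λ i j → G (suc i) j)))
    (solve 4 (λ a b c d → (a :+ b) :+ (c :+ d) := (a :+ c) :+ (b :+ d)) ≈-refl _ _ _ _)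

  O-anti : ∀ {n} m {F : ℕ → ℕ → Carrier} → (∀ i j → i ℕ.+ j ≡ m → O n (F i j)) → O n (anti m F)
  O-anti zero e = e 0 0 refl
  O-anti (suc m) e = O-+ (e 0 (suc m) refl) (O-anti m (λ i j p → e (suc i) j (cong suc p)))

  -- Summation by an antidifference `G` along the antidiagonal. The condition at (0, m) plays the
  -- part of a vanishing value of `G` before the start.
  anti-telescope : ∀ m {F G : ℕ → ℕ → Carrier} → F 0 m ≈ G 0 m →
    (∀ i j → suc i ℕ.+ j ≡ m → F (suc i) j ≈ G (suc i) j - G i (suc j)) → anti m F ≈ G m 0
  anti-telescope zero e₀ e = e₀
  anti-telescope (suc m) {F} {G} e₀ e = begin
    anti (suc m) F                                       ≈⟨ anti-last m F ⟩
    anti m (λ i j → F i (suc j)) + F (suc m) 0           ≈⟨ +-cong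
      (anti-telescope m {G = λ i j → G i (suc j)} e₀ (λ i j p → e i (suc j) (≡.trans (cong suc (ℕP.+-suc i j)) (cong suc p))))
      (e m 0 (ℕP.+-identityʳ (suc m))) ⟩
    G m 1 + (G (suc m) 0 - G m 1)                        ≈⟨ solve 2 (λ a b → a :+ (b :- a) := b) ≈-refl _ _ ⟩
    G (suc m) 0 ∎

  -- shift e N i = e (i - N)
  shift : (ℤ → Carrier) → ℕ → ℕ → Carrier
  shift e zero i = e (ℤ.+ i)
  shift e (suc N) zero = e -[1+ N ]
  shift e (suc N) (suc i) = shift e N i

  shift-neg : ∀ e i n → shift e (suc (i ℕ.+ n)) i ≡ e -[1+ n ]
  shift-neg e zero n = refl
  shift-neg e (suc i) n = shift-neg e i n

  shift-pos : ∀ e N k → shift e N (N ℕ.+ k) ≡ e (ℤ.+ k)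
  shift-pos e zero k = refl
  shift-pos e (suc N) k = shift-pos e N k

  zsum : (ℤ → Carrier) → ℕ → Carrier
  zsum e m = Σ< m (λ l → e -[1+ l ]) + Σ< (suc m) (λ k → e (ℤ.+ k))

  anti-Σ< : ∀ m F → anti m (λ i _ → F i) ≈ Σ< (suc m) F
  anti-Σ< zero F = ≈-sym (+-identityˡ _)
  anti-Σ< (suc m) F = ≈-trans (+-congˡ (anti-Σ< m (λ k → F (suc k)))) (≈-sym (Σ<-head (suc m) F))

  anti-shift : ∀ e N M → anti (N ℕ.+ M) (λ i _ → shift e N i) ≈ Σ< N (λ l → e -[1+ l ]) + Σ< (suc M) (λ k → e (ℤ.+ k))
  anti-shift e zero M = ≈-trans (anti-Σ< M _) (≈-sym (+-identityˡ _))
  anti-shift e (suc N) M = ≈-trans (+-congˡ (anti-shift e N M))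
    (solve 3 (λ a b c → a :+ (b :+ c) := (b :+ a) :+ c) ≈-refl _ _ _)

  zsum∞ : (ℤ → Carrier) → Carrier
  zsum∞ e = Σ∞ (λ l → e -[1+ l ]) + (e (ℤ.+ 0) + Σ∞ (λ k → e (ℤ.+ suc k)))

  -- The orders lag one behind the index. This leaves room for a parameter of order 0: with a = ζ,
  -- the term of index k + 1 of the theta series has a factor a that contributes nothing.
  record Decays (e : ℤ → Carrier) : Set where
    constructor decays
    field
      neg : ∀ l → O l (e -[1+ l ])
      pos : ∀ k → O k (e (ℤ.+ suc k))

  zsum-⟶ : ∀ {e} → Decays e → zsum e ⟶ zsum∞ e
  zsum-⟶ {e} (decays on op) = ⟶-+ (Σ∞-⟶ on) (⟶-cong (λ m → ≈-sym (Σ<-head m _)) (⟶-+ (⟶-const _) (Σ∞-⟶ op)))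

  -- |i - m| + i and |i - m| + j are both at least m when i + j = 2 m, so u i and v j may be replaced by their limits.
  anti-limit : ∀ {e} {u v : ℕ → Carrier} {U V} → Decays e → (∀ i → O i (u i - U)) → (∀ j → O j (v j - V)) →
    (λ m → anti (m ℕ.+ m) (λ i j → shift e m i * (u i * v j))) ⟶ (U * V) * zsum∞ e
  anti-limit {e} {u} {v} {U} {V} de@(decays on op) ou ov =
    ⟶-close (λ m → O-sym (O-≈ (difference m) (O-anti (m ℕ.+ m) (term m)))) (⟶-* (⟶-const (U * V)) (zsum-⟶ de))
    where
    difference : ∀ m → anti (m ℕ.+ m) (λ i j → shift e m i * (u i * v j - U * V)) ≈
      anti (m ℕ.+ m) (λ i j → shift e m i * (u i * v j)) - (U * V) * zsum e m
    difference m = begin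
      anti (m ℕ.+ m) (λ i j → shift e m i * (u i * v j - U * V))                   ≈⟨ anti-cong (m ℕ.+ m) (λ i j _ →
        solve 3 (λ s t z → s :* (t :- z) := s :* t :+ (:- z) :* s) ≈-refl _ _ (U * V)) ⟩
      anti (m ℕ.+ m) (λ i j → shift e m i * (u i * v j) + - (U * V) * shift e m i) ≈⟨ anti-+ (m ℕ.+ m) _ _ ⟩
      anti (m ℕ.+ m) (λ i j → shift e m i * (u i * v j)) + anti (m ℕ.+ m) (λ i j → - (U * V) * shift e m i)
        ≈⟨ +-congˡ (≈-trans (≈-sym (anti-distribˡ (m ℕ.+ m) _ _)) (*-congˡ (anti-shift e m m))) ⟩
      anti (m ℕ.+ m) (λ i j → shift e m i * (u i * v j)) + - (U * V) * zsum e m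
        ≈⟨ +-congˡ (solve 2 (λ a b → (:- a) :* b := :- (a :* b)) ≈-refl (U * V) _) ⟩
      anti (m ℕ.+ m) (λ i j → shift e m i * (u i * v j)) - (U * V) * zsum e m ∎
    split : ∀ {n s} i j → O n (s * (u i - U)) → O n (s * (v j - V)) → O n (s * (u i * v j - U * V))
    split {n} {s} i j a b = O-≈ (solve 5 (λ s u v U V → s :* (u :- U) :* v :+ s :* (v :- V) :* U
        := s :* (u :* v :- U :* V)) ≈-refl s _ _ U V)
      (O-+ (O-*ˡ a) (O-*ˡ b))
    term : ∀ m i j → i ℕ.+ j ≡ m ℕ.+ m → O (m ∸ 1) (shift e m i * (u i * v j - U * V))
    term m i j p with ℕ.compare i m
    ... | ℕ.less i k rewrite shift-neg e i k = split i j
      (O-≤ (ℕP.≤-reflexive (ℕP.+-comm i k)) (O-* (on k) (ou i)))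
      (O-*ʳ (O-≤ (ℕP.≤-trans (ℕP.m≤n+m (i ℕ.+ k) (suc (suc k))) (ℕP.≤-reflexive (≡.sym eq))) (ov j)))
      where
      eq : j ≡ suc (suc k) ℕ.+ (i ℕ.+ k)
      eq = ℕP.+-cancelˡ-≡ i j _ (≡.trans p (≡.trans (cong (λ t → suc t ℕ.+ suc (i ℕ.+ k)) refl)
        (≡.trans (ℕP.+-suc (suc (i ℕ.+ k)) (i ℕ.+ k)) (≡.trans (cong (λ t → suc (suc t)) (ℕP.+-assoc i k (i ℕ.+ k)))
          (≡.trans (cong suc (≡.sym (ℕP.+-suc i _))) (≡.sym (ℕP.+-suc i _)))))))
    ... | ℕ.equal m = split i j
      (O-*ʳ (O-≤ (ℕP.m∸n≤m m 1) (ou m)))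
      (O-*ʳ (O-≤ (ℕP.≤-trans (ℕP.m∸n≤m m 1) (ℕP.≤-reflexive (≡.sym (ℕP.+-cancelˡ-≡ m j m p)))) (ov j)))
    ... | ℕ.greater m k = split i j
      (O-*ʳ (O-≤ (ℕP.≤-trans (ℕP.m∸n≤m m 1) (ℕP.m≤n⇒m≤1+n (ℕP.m≤m+n m k))) (ou _)))
      (≡.subst (λ s → O (m ∸ 1) (s * (v j - V))) (≡.sym shifted)
        (O-≤ (ℕP.∸-monoˡ-≤ 1 (ℕP.≤-reflexive (≡.sym eq))) (O-* (op k) (ov j))))
      where
      shifted : shift e m (suc (m ℕ.+ k)) ≡ e (ℤ.+ suc k)
      shifted = ≡.trans (cong (shift e m) (≡.sym (ℕP.+-suc m k))) (shift-pos e m (suc k))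
      eq : suc k ℕ.+ j ≡ m
      eq = ℕP.+-cancelˡ-≡ m _ m (≡.trans (≡.trans (ℕP.+-suc m (k ℕ.+ j)) (cong suc (≡.sym (ℕP.+-assoc m k j)))) p)

  -- The term (-a)ⁿ p^(n(n-1)/2) of a theta series.
  gauss : Carrier → Carrier → ℕ → Carrier
  gauss a p zero = 1#
  gauss a p (suc n) = gauss a p n * - (a * p ^ n)

  gauss-cong : ∀ {a b p r} n → a ≈ b → p ≈ r → gauss a p n ≈ gauss b r n
  gauss-cong zero _ _ = ≈-refl
  gauss-cong (suc n) d e = *-cong (gauss-cong n d e) (-‿cong (*-cong d (^-cong n e)))

  gauss-suc : ∀ a p n → gauss a p (suc n) ≈ - a * gauss (a * p) p n
  gauss-suc a p zero = solve 1 (λ a → :1 :* :- (a :* :1) := :- a :* :1) ≈-refl a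
  gauss-suc a p (suc n) = ≈-trans (*-congʳ (gauss-suc a p n))
    (solve 4 (λ a p g x → (:- a) :* g :* :- (a :* (p :* x)) := :- a :* (g :* :- ((a :* p) :* x))) ≈-refl a p _ _)

  O-gauss : ∀ {a} p n → O 1 a → O n (gauss a p n)
  O-gauss p zero oa = O-zero _
  O-gauss p (suc n) oa = O-≤ (ℕP.≤-reflexive (ℕP.+-comm 1 n)) (O-* (O-gauss p n oa) (O-neg (O-*ˡ oa)))

  -- Here b stands for p/a. The term of index -n is (-a)^(-n) p^(n(n+1)/2) = (-b)^n p^(n(n-1)/2), so
  -- no negative power has to be formed.
  jacobi : Carrier → Carrier → Carrier → ℤ → Carrier
  jacobi a b p (ℤ.+ n) = gauss a p n
  jacobi a b p -[1+ l ] = gauss b p (suc l)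

  -- 1/(p;p)_m. Thus `ι p i * ι p j` is a Gaussian binomial coefficient divided by (p;p)_(i+j).
  ι : Carrier → ℕ → Carrier
  ι p = rqp p p

  ι-suc : ∀ {p} → O 1 p → ∀ i → ι p (suc i) * (1# - p ^ suc i) ≈ ι p i
  ι-suc {p} op i = ≈-trans (solve 3 (λ r g y → r :* g :* y := r :* (y :* g)) ≈-refl _ _ _)
    (≈-trans (*-congˡ (geom-inverse (O-*ˡ op))) (*-identityʳ _))

  module JacobiFinite (a b p : Carrier) (p≈ab : p ≈ a * b) (op : O 1 p) where
    c : ℕ → ℕ → Carrier
    c = shift (jacobi a b p)

    -- Consecutive terms of a theta series have the ratio -a p^(i-N); multiplied by p^j with i + j =
    -- N + M, it no longer depends on i. The relation p = ab enters where the index is negative.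
    c-suc : ∀ M N i j → i ℕ.+ j ≡ N ℕ.+ M → c N (suc i) * p ^ j ≈ - (a * p ^ M) * c N i
    c-suc M zero i j refl = ≈-trans
      (solve 4 (λ g a x y → (g :* :- (a :* x)) :* y := :- (a :* (x :* y)) :* g) ≈-refl (gauss a p i) a _ _)
      (*-congʳ (-‿cong (*-congˡ (≈-sym (^-+ p i j)))))
    c-suc M (suc N) (suc i) j e = c-suc M N i j (ℕP.suc-injective e)
    c-suc M (suc N) zero j refl = begin
      c N 0 * (p * p ^ (N ℕ.+ M))                   ≈⟨ *-cong (≈-reflexive (c0 N)) (*-cong p≈ab (^-+ p N M)) ⟩
      gauss b p N * ((a * b) * (p ^ N * p ^ M))     ≈⟨ solve 5 (λ g a b x y → g :* ((a :* b) :* (x :* y))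
          := :- (a :* y) :* (g :* :- (b :* x))) ≈-refl _ a b _ _ ⟩
      - (a * p ^ M) * gauss b p (suc N) ∎
      where
      c0 : ∀ N → c N 0 ≡ gauss b p N
      c0 zero = refl
      c0 (suc N) = refl

    c-flip : ∀ i j → c (i ℕ.+ j) i ≡ gauss b p j
    c-flip zero zero = refl
    c-flip zero (suc j) = refl
    c-flip (suc i) j = c-flip i j

    S : ℕ → ℕ → Carrier
    S M N = anti (N ℕ.+ M) (λ i j → c N i * (ι p i * ι p j))

    -- Multiplied by (p;p)_(N+M), this is the q-binomial theorem with its terms recentred at index
    -- N: the finite form of the triple product.
    Identity : ℕ → ℕ → Set
    Identity M N = S M N ≈ ι p (N ℕ.+ M) * (qp a p M * qp b p N)

    -- The q-Pascal rule in the form 1 - p^(i+j) = (1 - p^j) + p^j (1 - p^i). The first part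
    -- shortens the antidiagonal at j, the second at i, and by `c-suc` the second is -a p^M times
    -- the first.
    step : ∀ M N → Identity M N → Identity (suc M) N
    step M N ih rewrite ℕP.+-suc N M = *-cancelˡ-unit (1-h-unit (O-*ˡ op)) (begin
      (1# - p ^ suc K) * anti (suc K) (λ i j → c N i * (ι p i * ι p j))   ≈⟨ anti-distribˡ (suc K) _ (λ i j → c N i * (ι p i * ι p j)) ⟩
      anti (suc K) (λ i j → (1# - p ^ suc K) * (c N i * (ι p i * ι p j))) ≈⟨ anti-cong (suc K) split ⟩
      anti (suc K) (λ i j → A i j + B i j)                                ≈⟨ anti-+ (suc K) A B ⟩
      anti (suc K) A + anti (suc K) B                                     ≈⟨ +-cong antiA antiB ⟩
      S M N + - (a * p ^ M) * S M N                                       ≈⟨ solve 2 (λ s x → s :+ (:- x) :* s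
          := s :* (:1 :- x)) ≈-refl _ _ ⟩
      S M N * (1# - a * p ^ M)                                            ≈⟨ *-congʳ ih ⟩
      ι p K * (qp a p M * qp b p N) * (1# - a * p ^ M)                    ≈⟨ *-congʳ (*-congʳ (≈-sym (ι-suc op K))) ⟩
      ι p (suc K) * (1# - p ^ suc K) * (qp a p M * qp b p N) * (1# - a * p ^ M)
        ≈⟨ solve 5 (λ t e x y z → t :* e :* (x :* y) :* z := e :* (t :* ((x :* z) :* y))) ≈-refl _ _ _ _ _ ⟩
      (1# - p ^ suc K) * (ι p (suc K) * (qp a p (suc M) * qp b p N)) ∎)
      where
      K = N ℕ.+ M
      A B : ℕ → ℕ → Carrier
      A i j = c N i * (ι p i * (ι p j * (1# - p ^ j)))
      B i j = (c N i * p ^ j) * ((ι p i * (1# - p ^ i)) * ι p j)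
      split : ∀ i j → i ℕ.+ j ≡ suc K → (1# - p ^ suc K) * (c N i * (ι p i * ι p j)) ≈ A i j + B i j
      split i j e = ≈-trans (*-congʳ (+-congˡ (-‿cong (≈-trans (≈-reflexive (cong (p ^_) (≡.sym e))) (^-+ p i j)))))
        (solve 5 (λ c s t x y → (:1 :- x :* y) :* (c :* (s :* t)) :=
          c :* (s :* (t :* (:1 :- y))) :+ (c :* y) :* ((s :* (:1 :- x)) :* t)) ≈-refl _ _ _ _ _)
      antiA : anti (suc K) A ≈ S M N
      antiA = begin
        anti (suc K) A                             ≈⟨ anti-last K A ⟩
        anti K (λ i j → A i (suc j)) + A (suc K) 0 ≈⟨ +-cong (anti-cong K (λ i j _ → *-congˡ (*-congˡ (ι-suc op j))))
          (solve 3 (λ x y z → x :* (y :* (z :* (:1 :- :1))) := :0) ≈-refl _ _ _) ⟩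
        S M N + 0#                                 ≈⟨ +-identityʳ _ ⟩
        S M N ∎
      antiB : anti (suc K) B ≈ - (a * p ^ M) * S M N
      antiB = begin
        B 0 (suc K) + anti K (λ i j → B (suc i) j) ≈⟨ +-cong
          (solve 3 (λ x y z → x :* ((y :* (:1 :- :1)) :* z) := :0) ≈-refl _ _ _)
          (anti-cong K (λ i j e → ≈-trans (*-cong (c-suc M N i j e) (*-congʳ (ι-suc op i))) (*-assoc _ _ _))) ⟩
        0# + anti K (λ i j → - (a * p ^ M) * (c N i * (ι p i * ι p j))) ≈⟨ +-identityˡ _ ⟩
        anti K (λ i j → - (a * p ^ M) * (c N i * (ι p i * ι p j)))      ≈⟨ anti-distribˡ K _ _ ⟨
        - (a * p ^ M) * S M N ∎

    iterate : ∀ N → Identity 0 N → ∀ M → Identity M N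
    iterate N base zero = base
    iterate N base (suc M) = step M N (iterate N base M)

    one-sided : ∀ M → Identity M 0
    one-sided = iterate 0 (solve 0 (:1 :* (:1 :* :1) := :1 :* (:1 :* :1)) ≈-refl)

  -- Reversing the antidiagonal exchanges a and b, so M = 0 is the one-sided case of the exchanged
  -- identity. Induction on M starts from there.
  jacobi-finite : ∀ a b p (p≈ab : p ≈ a * b) (op : O 1 p) → ∀ M N → JacobiFinite.Identity a b p p≈ab op M N
  jacobi-finite a b p p≈ab op M N = iterate N base M
    where
    open JacobiFinite a b p p≈ab op
    base : Identity 0 N
    base rewrite ℕP.+-identityʳ N = begin
      anti N (λ i j → c N i * (ι p i * ι p j))            ≈⟨ anti-flip N _ ⟩
      anti N (λ i j → c N j * (ι p j * ι p i))            ≈⟨ anti-cong N (λ i j e → *-cong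
        (≈-reflexive (≡.trans (cong (λ n → c n j) (≡.trans (≡.sym e) (ℕP.+-comm i j))) (c-flip j i))) (*-comm _ _)) ⟩
      anti N (λ i j → gauss b p i * (ι p i * ι p j))      ≈⟨ JacobiFinite.one-sided b a p (≈-trans p≈ab (*-comm a b)) op N ⟩
      ι p N * (qp b p N * 1#)                             ≈⟨ *-congˡ (*-comm _ _) ⟩
      ι p N * (1# * qp b p N) ∎

module Products (C : CompleteRing) where
  open Theta C public

  O-qp : ∀ {p} a → O 1 p → ∀ m → O m (qp a p m - qp∞ a p)
  O-qp {p} a op = lim-O _ (qp-O a op)

  O-ι : ∀ {p} → O 1 p → ∀ m → O m (ι p m - rqp∞ p p)
  O-ι op = lim-O _ (rqp-O op op)

  double : ∀ m → m ≤ m ℕ.+ m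
  double m = ℕP.m≤m+n m m

  partial-theta : Carrier → Carrier → Carrier
  partial-theta a p = Σ∞ (gauss a p)

  -- (p;p)(a;p)(b;p) = Σ_{n∈ℤ} (-a)ⁿ p^(n(n-1)/2) for ab = p; only b need have positive order.
  jacobi-triple : ∀ a b p → p ≈ a * b → O 1 b → O 1 p →
    qp∞ p p * (qp∞ a p * qp∞ b p) ≈ partial-theta b p - a * partial-theta (a * p) p
  jacobi-triple a b p p≈ab ob op = *-cancelˡ-unit (unit {rqp∞ p p} (qp∞ p p) (≈-trans (*-comm _ _) (rqp∞-inverse op op))) (begin
    I * (qp∞ p p * AB)            ≈⟨ solve 3 (λ i q x → i :* (q :* x) := q :* i :* x) ≈-refl I (qp∞ p p) AB ⟩
    qp∞ p p * I * AB              ≈⟨ *-congʳ (rqp∞-inverse op op) ⟩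
    1# * AB                       ≈⟨ *-congʳ (rqp∞-inverse op op) ⟨
    qp∞ p p * I * AB              ≈⟨ *-assoc _ _ _ ⟩
    qp∞ p p * (I * AB)            ≈⟨ *-congˡ limit ⟨
    qp∞ p p * (I * I * zsum∞ e)   ≈⟨ solve 3 (λ q i z → q :* (i :* i :* z) := (q :* i) :* (i :* z)) ≈-refl _ _ _ ⟩
    qp∞ p p * I * (I * zsum∞ e)   ≈⟨ *-congʳ (rqp∞-inverse op op) ⟩
    1# * (I * zsum∞ e)            ≈⟨ *-identityˡ _ ⟩
    I * zsum∞ e                   ≈⟨ *-congˡ bilateral ⟩
    I * (partial-theta b p - a * partial-theta (a * p) p) ∎)
    where
    I = rqp∞ p p
    AB = qp∞ a p * qp∞ b p
    e = jacobi a b p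
    oap : O 1 (a * p)
    oap = O-*ʳ op
    de : Decays e
    de = decays (λ l → O-≤ (ℕP.n≤1+n l) (O-gauss p (suc l) ob))
                (λ k → O-≈ (≈-sym (gauss-suc a p k)) (O-*ʳ (O-gauss p k oap)))
    -- The finite identity at M = N = m. Two factors 1/(p;p) arise from the weights of the sum, one
    -- from `ι p (m + m)` on the other side.
    limit : I * I * zsum∞ e ≈ I * AB
    limit = ⟶-unique (anti-limit de (O-ι op) (O-ι op)) (⟶-cong (λ m → ≈-sym (jacobi-finite a b p p≈ab op m m))
      (⟶-* (⟶-sub (λ m → m ℕ.+ m) double (λ n → n , λ m n≤m → O-≤ n≤m (O-ι op m))) (⟶-* (qp∞-⟶ a op) (qp∞-⟶ b op))))
    bilateral : zsum∞ e ≈ partial-theta b p - a * partial-theta (a * p) p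
    bilateral = begin
      Σ∞ (λ l → gauss b p (suc l)) + (1# + Σ∞ (λ k → gauss a p (suc k)))
        ≈⟨ +-congˡ (+-congˡ (≈-trans (Σ∞-cong (λ k → Decays.pos de k) (gauss-suc a p)) (≈-sym (Σ∞-distribˡ (- a) (λ k → O-gauss p k oap))))) ⟩
      Σ∞ (λ l → gauss b p (suc l)) + (1# + - a * partial-theta (a * p) p)
        ≈⟨ solve 4 (λ s o a h → s :+ (o :+ :- a :* h) := (o :+ s) :- a :* h) ≈-refl _ _ _ _ ⟩
      (1# + Σ∞ (λ l → gauss b p (suc l))) - a * partial-theta (a * p) p
        ≈⟨ +-congʳ (≈-sym (Σ∞-head (λ k → O-gauss p k ob))) ⟩
      partial-theta b p - a * partial-theta (a * p) p ∎

  -- Ramanujan's summation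

  module LambertFinite (x x′ y w p : Carrier) (p≈yw : p ≈ y * w) (xx′≈1 : x * x′ ≈ 1#) (op : O 1 p)
    (r s : ℕ → Carrier) (r-inverse : ∀ k → r k * (1# - x * p ^ k) ≈ 1#) (s-inverse : ∀ k → s k * (1# - x′ * p ^ k) ≈ 1#) where

    -- y^k / (1 - x p^k), with negative powers of y and p rewritten by p = y w and x x′ = 1
    lambert : ℤ → Carrier
    lambert (ℤ.+ k) = y ^ k * r k
    lambert -[1+ l ] = - (x′ * (w ^ suc l * s (suc l)))

    e : ℕ → ℕ → Carrier
    e = shift lambert

    u v : ℕ → Carrier
    u i = qp w p i * ι p i
    v j = qp y p j * ι p j

    κ : ℕ → Carrier
    κ j = geom (p ^ suc j)

    κ-inverse : ∀ j → (1# - p ^ suc j) * κ j ≈ 1#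
    κ-inverse j = geom-inverse (O-*ˡ op)

    u-suc : ∀ i → u (suc i) * (1# - p ^ suc i) ≈ (1# - w * p ^ i) * u i
    u-suc i = ≈-trans (*-assoc _ _ _) (≈-trans (*-congˡ (ι-suc op i))
      (solve 3 (λ q x t → (q :* x) :* t := x :* (q :* t)) ≈-refl _ _ _))

    v-suc : ∀ j → v (suc j) ≈ v j * (1# - y * p ^ j) * κ j
    v-suc j = solve 4 (λ q x t k → (q :* x) :* (t :* k) := (q :* t) :* x :* k) ≈-refl _ _ _ _

    -- y^k p^(M-k) where k = i - N and j = M - k
    D : ℕ → ℕ → ℕ → ℕ → Carrier
    D M zero i j = y ^ i * p ^ j
    D M (suc N) (suc i) j = D M N i j
    D M (suc N) zero j = w ^ suc N * p ^ M

    D-suc : ∀ M N i j → i ℕ.+ suc j ≡ N ℕ.+ M → D M N i (suc j) * y ≈ p * D M N (suc i) j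
    D-suc M zero i j _ = solve 4 (λ y p a b → (a :* (p :* b)) :* y := p :* ((y :* a) :* b)) ≈-refl y p _ _
    D-suc M (suc N) (suc i) j q = D-suc M N i j (ℕP.suc-injective q)
    D-suc M (suc zero) zero j refl = ≈-trans
      (solve 3 (λ y w a → (w :* :1) :* a :* y := (y :* w) :* (:1 :* a)) ≈-refl y w _) (*-congʳ (≈-sym p≈yw))
    D-suc M (suc (suc N)) zero j q = ≈-trans
      (solve 4 (λ y w a b → (w :* a) :* b :* y := (y :* w) :* (a :* b)) ≈-refl y w _ _) (*-congʳ (≈-sym p≈yw))

    D-last : ∀ M N → D M N (N ℕ.+ M) 0 ≈ y ^ M
    D-last M zero = *-identityʳ _
    D-last M (suc N) = D-last M N

    e-last : ∀ M N → e N (N ℕ.+ M) ≡ y ^ M * r M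
    e-last M N = shift-pos lambert N M

    -- With k = i - N and j = M - k, the bracket vanishes at x = p^(-k). It therefore contains the
    -- denominator 1 - x p^k of `e N i`, and what remains is free of x.
    e-D : ∀ M N i j → i ℕ.+ j ≡ N ℕ.+ M →
      e N i * ((1# - y * p ^ j) * (1# - x * p ^ suc M) - (1# - x * y * p ^ M) * (1# - p ^ suc j)) ≈ (p - y) * D M N i j
    e-D M zero i j refl = begin
      y ^ i * r i * ((1# - y * p ^ j) * (1# - x * (p * p ^ (i ℕ.+ j))) - (1# - x * y * p ^ (i ℕ.+ j)) * (1# - p ^ suc j))
        ≈⟨ *-congˡ (+-cong (*-congˡ (+-congˡ (-‿cong (*-congˡ (*-congˡ (^-+ p i j))))))
             (-‿cong (*-congʳ (+-congˡ (-‿cong (*-congˡ (^-+ p i j))))))) ⟩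
      y ^ i * r i * ((1# - y * p ^ j) * (1# - x * (p * (p ^ i * p ^ j))) - (1# - x * y * (p ^ i * p ^ j)) * (1# - p * p ^ j))
        ≈⟨ solve 7 (λ x y p a b yi r →
             yi :* r :* ((:1 :- y :* b) :* (:1 :- x :* (p :* (a :* b))) :- (:1 :- x :* y :* (a :* b)) :* (:1 :- p :* b))
             := (p :- y) :* (yi :* b) :* (r :* (:1 :- x :* a))) ≈-refl x y p _ _ _ _ ⟩
      (p - y) * (y ^ i * p ^ j) * (r i * (1# - x * p ^ i)) ≈⟨ *-congˡ (r-inverse i) ⟩
      (p - y) * (y ^ i * p ^ j) * 1#                       ≈⟨ *-identityʳ _ ⟩
      (p - y) * (y ^ i * p ^ j) ∎
    e-D M (suc N) (suc i) j q = e-D M N i j (ℕP.suc-injective q)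
    e-D M (suc N) zero j refl = begin
      - (x′ * (w ^ suc N * s (suc N))) * ((1# - y * p ^ suc (N ℕ.+ M)) * (1# - x * (p * p ^ M)) - (1# - x * y * p ^ M) * (1# - p * p ^ suc (N ℕ.+ M)))
        ≈⟨ *-congˡ (+-cong (*-congʳ (+-congˡ (-‿cong (*-congˡ (^-+ p (suc N) M)))))
             (-‿cong (*-congˡ (+-congˡ (-‿cong (*-congˡ (^-+ p (suc N) M))))))) ⟩
      - (x′ * (w ^ suc N * s (suc N))) * ((1# - y * (p ^ suc N * p ^ M)) * (1# - x * (p * p ^ M)) - (1# - x * y * p ^ M) * (1# - p * (p ^ suc N * p ^ M)))
        ≈⟨ solve 8 (λ x x' y p a b wn s →
             :- (x' :* (wn :* s)) :* ((:1 :- y :* (a :* b)) :* (:1 :- x :* (p :* b)) :- (:1 :- x :* y :* b) :* (:1 :- p :* (a :* b)))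
             := (p :- y) :* (wn :* b) :* (s :* (x :* x' :- x' :* a))) ≈-refl x x′ y p _ _ _ _ ⟩
      (p - y) * (w ^ suc N * p ^ M) * (s (suc N) * (x * x′ - x′ * p ^ suc N))
        ≈⟨ *-congˡ (≈-trans (*-congˡ (+-congʳ xx′≈1)) (s-inverse (suc N))) ⟩
      (p - y) * (w ^ suc N * p ^ M) * 1#                                     ≈⟨ *-identityʳ _ ⟩
      (p - y) * (w ^ suc N * p ^ M) ∎

    y-ywP : ∀ P → y * (1# - w * P) ≈ y - p * P
    y-ywP P = ≈-trans (solve 3 (λ y w P → y :* (:1 :- w :* P) := y :- (y :* w) :* P) ≈-refl y w P)
      (+-congˡ (-‿cong (*-congʳ (≈-sym p≈yw))))

    S : ℕ → ℕ → Carrier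
    S M N = anti (N ℕ.+ M) (λ i j → e N i * (u i * v j))

    -- The antidifference `G` has the factor y - p^(i+1) = y(1 - w p^i), which is the one by which u
    -- grows from i to i + 1. This makes the value at i + 1 and the value at i comparable.
    telescope : ∀ M N → (1# - p ^ suc (N ℕ.+ M)) * anti (N ℕ.+ M) (λ i j → (y - p) * D M N i j * (u i * v j * κ j))
      ≈ y ^ suc M * (u (suc (N ℕ.+ M)) * (1# - p ^ suc (N ℕ.+ M)))
    telescope M N = begin
      (1# - p ^ suc K) * anti K (λ i j → (y - p) * D M N i j * (u i * v j * κ j))   ≈⟨ anti-distribˡ K _ _ ⟩
      anti K (λ i j → (1# - p ^ suc K) * ((y - p) * D M N i j * (u i * v j * κ j))) ≈⟨ anti-telescope K {G = G} first next ⟩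
      G K 0                                                                         ≈⟨ last ⟩
      y ^ suc M * (u (suc K) * (1# - p ^ suc K)) ∎
      where
      K = N ℕ.+ M
      G : ℕ → ℕ → Carrier
      G i j = D M N i j * ((y - p * p ^ i) * (u i * v j))
      first : (1# - p ^ suc K) * ((y - p) * D M N 0 K * (u 0 * v K * κ K)) ≈ G 0 K
      first = ≈-trans (solve 6 (λ y p f d t k → f :* ((y :- p) :* d :* (t :* k))
          := d :* ((y :- p :* :1) :* t) :* (f :* k)) ≈-refl y p _ _ _ _)
        (≈-trans (*-congˡ (κ-inverse K)) (*-identityʳ _))
      last : G K 0 ≈ y ^ suc M * (u (suc K) * (1# - p ^ suc K))
      last = ≈-trans (*-cong (D-last M N) (*-congʳ (≈-sym (y-ywP (p ^ K)))))
        (≈-trans (solve 4 (λ a y t u → a :* (y :* t :* (u :* (:1 :* :1))) := y :* a :* (t :* u)) ≈-refl _ _ _ _)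
          (*-congˡ (≈-sym (u-suc K))))
      next : ∀ i j → suc i ℕ.+ j ≡ K →
        (1# - p ^ suc K) * ((y - p) * D M N (suc i) j * (u (suc i) * v j * κ j)) ≈ G (suc i) j - G i (suc j)
      next i j q = ≈-sym (begin
        G (suc i) j - D M N i (suc j) * ((y - p * p ^ i) * (u i * v (suc j)))
          ≈⟨ +-congˡ (-‿cong (begin
            D M N i (suc j) * ((y - p * p ^ i) * (u i * v (suc j)))
              ≈⟨ *-congˡ (*-congʳ (y-ywP (p ^ i))) ⟨
            D M N i (suc j) * (y * (1# - w * p ^ i) * (u i * v (suc j)))
              ≈⟨ solve 5 (λ d y t u v → d :* (y :* t :* (u :* v)) := (d :* y) :* (t :* u) :* v) ≈-refl _ _ _ _ _ ⟩
            (D M N i (suc j) * y) * ((1# - w * p ^ i) * u i) * v (suc j)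
              ≈⟨ *-cong (*-cong (D-suc M N i j (≡.trans (ℕP.+-suc i j) q)) (≈-sym (u-suc i))) (v-suc j) ⟩
            (p * D M N (suc i) j) * (u (suc i) * (1# - p ^ suc i)) * (v j * (1# - y * p ^ j) * κ j) ∎)) ⟩
        D M N (suc i) j * ((y - p * p ^ suc i) * (u (suc i) * v j)) - (p * D M N (suc i) j) * (u (suc i) * (1# - p ^ suc i)) * (v j * (1# - y * p ^ j) * κ j)
          ≈⟨ +-congʳ (*-congˡ (*-congˡ (≈-trans (≈-sym (*-identityʳ _)) (*-congˡ (≈-sym (κ-inverse j)))))) ⟩
        D M N (suc i) j * ((y - p * p ^ suc i) * (u (suc i) * v j * ((1# - p * p ^ j) * κ j))) - (p * D M N (suc i) j) * (u (suc i) * (1# - p ^ suc i)) * (v j * (1# - y * p ^ j) * κ j)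
          ≈⟨ solve 8 (λ y p a b d u v k →
               d :* ((y :- p :* (p :* a)) :* (u :* v :* ((:1 :- p :* b) :* k))) :- (p :* d) :* (u :* (:1 :- p :* a)) :* (v :* (:1 :- y :* b) :* k)
               := (:1 :- p :* (p :* (a :* b))) :* ((y :- p) :* d :* (u :* v :* k))) ≈-refl y p (p ^ i) (p ^ j) _ _ _ _ ⟩
        (1# - p * (p * (p ^ i * p ^ j))) * ((y - p) * D M N (suc i) j * (u (suc i) * v j * κ j))
          ≈⟨ *-congʳ (+-congˡ (-‿cong (*-congˡ (≈-trans (*-congˡ (≈-sym (^-+ p i j))) (≈-reflexive (cong (p ^_) q)))))) ⟩
        (1# - p ^ suc K) * ((y - p) * D M N (suc i) j * (u (suc i) * v j * κ j)) ∎)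

    -- Termwise, the two sides differ by a quantity without denominators in x (`e-D`), and its sum
    -- telescopes to the negative of the one new term at the end of the antidiagonal.
    step : ∀ M N → S (suc M) N * (1# - x * p ^ suc M) ≈ S M N * (1# - x * y * p ^ M)
    step M N rewrite ℕP.+-suc N M = begin
      anti (suc K) F * X                                                  ≈⟨ *-congʳ (anti-last K F) ⟩
      (anti K (λ i j → F i (suc j)) + F (suc K) 0) * X                    ≈⟨ distribʳ _ _ _ ⟩
      anti K (λ i j → F i (suc j)) * X + F (suc K) 0 * X                  ≈⟨ +-cong sums last ⟩
      (S M N * Y + - T) + T                                               ≈⟨ solve 2 (λ a t → (a :+ :- t) :+ t := a) ≈-refl _ _ ⟩
      S M N * Y ∎
      where
      K = N ℕ.+ M
      X = 1# - x * p ^ suc M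
      Y = 1# - x * y * p ^ M
      F : ℕ → ℕ → Carrier
      F i j = e N i * (u i * v j)
      T = y ^ suc M * u (suc K)
      last : F (suc K) 0 * X ≈ T
      last = ≈-trans (*-congʳ (*-congʳ (≈-reflexive (≡.trans (cong (e N) (≡.sym (ℕP.+-suc N M))) (e-last (suc M) N)))))
        (≈-trans (solve 4 (λ a r u x → (a :* r) :* (u :* (:1 :* :1)) :* x := (a :* u) :* (r :* x)) ≈-refl _ _ _ _)
          (≈-trans (*-congˡ (r-inverse (suc M))) (*-identityʳ _)))
      term : ∀ i j → i ℕ.+ j ≡ K → X * F i (suc j) ≈ Y * F i j + - ((y - p) * D M N i j * (u i * v j * κ j))
      term i j q = begin
        X * (e N i * (u i * v (suc j)))
          ≈⟨ solve 2 (λ a b → a := b :+ (a :- b)) ≈-refl _ (Y * F i j) ⟩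
        Y * F i j + (X * (e N i * (u i * v (suc j))) - Y * (e N i * (u i * v j)))
          ≈⟨ +-congˡ (+-cong (*-congˡ (*-congˡ (*-congˡ (v-suc j))))
               (-‿cong (≈-trans (≈-sym (*-identityʳ _)) (*-congˡ (≈-sym (κ-inverse j)))))) ⟩
        Y * F i j + (X * (e N i * (u i * (v j * (1# - y * p ^ j) * κ j))) - Y * (e N i * (u i * v j)) * ((1# - p ^ suc j) * κ j))
          ≈⟨ +-congˡ (solve 8 (λ X Y e u v k b c → X :* (e :* (u :* (v :* b :* k))) :- Y :* (e :* (u :* v)) :* (c :* k)
               := e :* (b :* X :- Y :* c) :* (u :* v :* k)) ≈-refl X Y _ _ _ _ (1# - y * p ^ j) (1# - p ^ suc j)) ⟩
        Y * F i j + e N i * ((1# - y * p ^ j) * X - Y * (1# - p ^ suc j)) * (u i * v j * κ j)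
          ≈⟨ +-congˡ (*-congʳ (e-D M N i j q)) ⟩
        Y * F i j + (p - y) * D M N i j * (u i * v j * κ j)
          ≈⟨ +-congˡ (solve 4 (λ p y d t → (p :- y) :* d :* t := :- ((y :- p) :* d :* t)) ≈-refl p y _ _) ⟩
        Y * F i j + - ((y - p) * D M N i j * (u i * v j * κ j)) ∎
      telescoped : anti K (λ i j → (y - p) * D M N i j * (u i * v j * κ j)) ≈ T
      telescoped = *-cancelˡ-unit (1-h-unit (O-*ˡ op)) (≈-trans (telescope M N)
        (solve 3 (λ a u f → a :* (u :* f) := f :* (a :* u)) ≈-refl _ _ _))
      sums : anti K (λ i j → F i (suc j)) * X ≈ S M N * Y + - T
      sums = begin
        anti K (λ i j → F i (suc j)) * X             ≈⟨ ≈-trans (*-comm _ _) (anti-distribˡ K _ _) ⟩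
        anti K (λ i j → X * F i (suc j))             ≈⟨ anti-cong K term ⟩
        anti K (λ i j → Y * F i j + - ((y - p) * D M N i j * (u i * v j * κ j))) ≈⟨ anti-+ K _ _ ⟩
        anti K (λ i j → Y * F i j) + anti K (λ i j → - ((y - p) * D M N i j * (u i * v j * κ j)))
          ≈⟨ +-cong (≈-trans (≈-sym (anti-distribˡ K Y F)) (*-comm _ _))
               (≈-trans (anti-cong K (λ i j _ → solve 1 (λ t → :- t := (:- :1) :* t) ≈-refl _)) (≈-sym (anti-distribˡ K (- 1#) _))) ⟩
        S M N * Y + - 1# * anti K (λ i j → (y - p) * D M N i j * (u i * v j * κ j))
          ≈⟨ +-congˡ (≈-trans (*-congˡ telescoped) (solve 1 (λ t → (:- :1) :* t := :- t) ≈-refl _)) ⟩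
        S M N * Y + - T ∎

    Identity : ℕ → ℕ → Set
    Identity M N = S M N * (qp x p (suc M) * qp (x′ * p) p N) ≈ qp (x * y) p M * qp (x′ * w) p N

    iterate : ∀ N → Identity 0 N → ∀ M → Identity M N
    iterate N base zero = base
    iterate N base (suc M) = begin
      S (suc M) N * (qp x p (suc M) * (1# - x * p ^ suc M) * qp (x′ * p) p N)
        ≈⟨ solve 4 (λ s a b c → s :* (a :* b :* c) := (s :* b) :* (a :* c)) ≈-refl _ _ _ _ ⟩
      (S (suc M) N * (1# - x * p ^ suc M)) * (qp x p (suc M) * qp (x′ * p) p N)
        ≈⟨ *-congʳ (step M N) ⟩
      (S M N * (1# - x * y * p ^ M)) * (qp x p (suc M) * qp (x′ * p) p N)
        ≈⟨ solve 4 (λ s b a c → (s :* b) :* (a :* c) := s :* (a :* c) :* b) ≈-refl _ _ _ _ ⟩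
      S M N * (qp x p (suc M) * qp (x′ * p) p N) * (1# - x * y * p ^ M)
        ≈⟨ *-congʳ (iterate N base M) ⟩
      qp (x * y) p M * qp (x′ * w) p N * (1# - x * y * p ^ M)
        ≈⟨ solve 3 (λ a b c → a :* b :* c := a :* c :* b) ≈-refl _ _ _ ⟩
      qp (x * y) p (suc M) * qp (x′ * w) p N ∎

    one-sided : ∀ M → Identity M 0
    one-sided = iterate 0 (≈-trans
      (solve 2 (λ r x → (:1 :* r) :* ((:1 :* :1) :* (:1 :* :1)) :* ((:1 :* (:1 :- x)) :* :1)
        := r :* (:1 :- x)) ≈-refl (r 0) (x * 1#))
      (≈-trans (r-inverse 0) (≈-sym (*-identityˡ 1#))))

    -- Exchanging x with 1/x and y with w reverses the index up to the factor -x′. At index 0 this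
    -- is 1/(1 - x) = -x′/(1 - x′).
    e-flip : ∀ i j → e (i ℕ.+ j) i ≈ - x′ * (w ^ j * s j)
    e-flip zero zero = begin
      1# * r 0
        ≈⟨ ≈-trans (*-identityˡ _) (≈-trans (≈-sym (*-identityʳ _)) (*-congˡ (≈-sym (s-inverse 0)))) ⟩
      r 0 * (s 0 * (1# - x′ * 1#))                      ≈⟨ *-congˡ (*-congˡ (+-congʳ (≈-sym xx′≈1))) ⟩
      r 0 * (s 0 * (x * x′ - x′ * 1#))
        ≈⟨ solve 4 (λ r s x x' → r :* (s :* (x :* x' :- x' :* :1)) := (:- x') :* (:1 :* s) :* (r :* (:1 :- x :* :1))) ≈-refl _ _ x x′ ⟩
      - x′ * (1# * s 0) * (r 0 * (1# - x * 1#))         ≈⟨ ≈-trans (*-congˡ (r-inverse 0)) (*-identityʳ _) ⟩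
      - x′ * (1# * s 0) ∎
    e-flip zero (suc j) = solve 2 (λ x t → :- (x :* t) := (:- x) :* t) ≈-refl x′ _
    e-flip (suc i) j = e-flip i j

  -- Again the case M = 0 comes from the one-sided case by reversing the antidiagonal; the factor
  -- -x′(1 - x) = 1 - x′ completes (x′p;p)_N to (x′;p)_(N+1).
  lambert-finite : ∀ x x′ y w p p≈yw xx′≈1 op r s r-inverse s-inverse → ∀ M N →
    LambertFinite.Identity x x′ y w p p≈yw xx′≈1 op r s r-inverse s-inverse M N
  lambert-finite x x′ y w p p≈yw xx′≈1 op r s r-inverse s-inverse M N = iterate N base M
    where
    open LambertFinite x x′ y w p p≈yw xx′≈1 op r s r-inverse s-inverse
    module Swap = LambertFinite x′ x w y p (≈-trans p≈yw (*-comm y w)) (≈-trans (*-comm x′ x) xx′≈1) op s r s-inverse r-inverse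
    flipped : S 0 N ≈ - x′ * Swap.S N 0
    flipped rewrite ℕP.+-identityʳ N = begin
      anti N (λ i j → e N i * (u i * v j))                     ≈⟨ anti-flip N _ ⟩
      anti N (λ i j → e N j * (u j * v i))                     ≈⟨ anti-cong N (λ i j q → *-cong
        (≈-trans (≈-reflexive (cong (λ n → e n j) (≡.trans (≡.sym q) (ℕP.+-comm i j)))) (e-flip j i)) (*-comm _ _)) ⟩
      anti N (λ i j → - x′ * (w ^ i * s i) * (v i * u j))      ≈⟨ anti-cong N (λ i j _ → *-assoc _ _ _) ⟩
      anti N (λ i j → - x′ * (w ^ i * s i * (v i * u j)))      ≈⟨ anti-distribˡ N _ _ ⟨
      - x′ * Swap.S N 0 ∎
    base : Identity 0 N
    base = begin
      S 0 N * (1# * (1# - x * 1#) * qp (x′ * p) p N)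
        ≈⟨ *-congʳ flipped ⟩
      - x′ * Swap.S N 0 * (1# * (1# - x * 1#) * qp (x′ * p) p N)
        ≈⟨ solve 4 (λ x x' s q → (:- x') :* s :* (:1 :* (:1 :- x :* :1) :* q) := s :* ((x :* x' :- x') :* q)) ≈-refl x x′ _ _ ⟩
      Swap.S N 0 * ((x * x′ - x′) * qp (x′ * p) p N)
        ≈⟨ *-congˡ (*-congʳ (+-congʳ xx′≈1)) ⟩
      Swap.S N 0 * ((1# - x′) * qp (x′ * p) p N)
        ≈⟨ *-congˡ (≈-trans (≈-sym (qp-head x′ p N)) (≈-sym (*-identityʳ _))) ⟩
      Swap.S N 0 * (qp x′ p (suc N) * 1#)
        ≈⟨ Swap.one-sided N ⟩
      qp (x′ * w) p N * 1#
        ≈⟨ *-comm _ _ ⟩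
      1# * qp (x′ * w) p N ∎

  -- Ramanujan's 1ψ1 summation with b = aq:  Σ_{k∈ℤ} y^k / (1 - x p^k) = (p)² (xy) (p/xy) / ((x) (p/x) (y) (p/y)).
  lambert-sum : ∀ x x′ y w p → p ≈ y * w → x * x′ ≈ 1# → O 1 y → O 1 w →
    ∀ (r s : ℕ → Carrier) → (∀ k → r k * (1# - x * p ^ k) ≈ 1#) → (∀ k → s k * (1# - x′ * p ^ k) ≈ 1#) →
    (r 0 + Σ∞ (λ k → y ^ suc k * r (suc k)) - x′ * Σ∞ (λ l → w ^ suc l * s (suc l)))
      * (qp∞ x p * qp∞ (x′ * p) p) * (qp∞ w p * qp∞ y p)
    ≈ qp∞ p p * qp∞ p p * (qp∞ (x * y) p * qp∞ (x′ * w) p)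
  lambert-sum x x′ y w p p≈yw xx′≈1 oy ow r s r-inverse s-inverse = begin
    B * XX * WY                                        ≈⟨ *-congʳ (*-congʳ (≈-sym bilateral)) ⟩
    zsum∞ lambert * XX * WY
      ≈⟨ ≈-trans (≈-sym (*-identityʳ _)) (*-congˡ (≈-trans (≈-sym (*-identityˡ _)) (*-cong (≈-sym pI) (≈-sym pI)))) ⟩
    zsum∞ lambert * XX * (qp∞ w p * qp∞ y p) * ((qp∞ p p * I) * (qp∞ p p * I))
      ≈⟨ solve 6 (λ z x w y q i → z :* x :* (w :* y) :* ((q :* i) :* (q :* i))
          := (q :* q) :* (((w :* i) :* (y :* i)) :* z :* x)) ≈-refl _ _ _ _ _ _ ⟩
    qp∞ p p * qp∞ p p * ((qp∞ w p * I) * (qp∞ y p * I) * zsum∞ lambert * XX)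
      ≈⟨ *-congˡ limit ⟩
    qp∞ p p * qp∞ p p * (qp∞ (x * y) p * qp∞ (x′ * w) p) ∎
    where
    op : O 1 p
    op = O-≈ (≈-sym p≈yw) (O-*ˡ oy)
    open LambertFinite x x′ y w p p≈yw xx′≈1 op r s r-inverse s-inverse
    I = rqp∞ p p
    pI : qp∞ p p * I ≈ 1#
    pI = rqp∞-inverse op op
    XX = qp∞ x p * qp∞ (x′ * p) p
    WY = qp∞ w p * qp∞ y p
    B = r 0 + Σ∞ (λ k → y ^ suc k * r (suc k)) - x′ * Σ∞ (λ l → w ^ suc l * s (suc l))
    O-w : ∀ l → O l (w ^ suc l * s (suc l))
    O-w l = O-*ˡ (O-≤ (ℕP.n≤1+n l) (O1-^ (suc l) ow))
    d : Decays lambert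
    d = decays (λ l → O-neg (O-*ʳ (O-w l))) (λ k → O-*ˡ (O-≤ (ℕP.n≤1+n k) (O1-^ (suc k) oy)))
    bilateral : zsum∞ lambert ≈ B
    bilateral = ≈-trans (+-cong (≈-trans (Σ∞-cong (Decays.neg d) (λ l → solve 2 (λ x t → :- (x :* t) := (:- x) :* t) ≈-refl x′ _))
        (≈-sym (Σ∞-distribˡ (- x′) O-w))) (+-congʳ (*-identityˡ _)))
      (solve 4 (λ x a b c → (:- x) :* a :+ (b :+ c) := b :+ c :- x :* a) ≈-refl x′ _ _ _)
    partial : ℕ → Carrier
    partial m = anti (m ℕ.+ m) (λ i j → e m i * (u i * v j))
    -- At M = N = m the weights u and v tend to (w;p)/(p;p) and (y;p)/(p;p), which accounts for the
    -- two factors (p;p) of the result.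
    converges : partial ⟶ ((qp∞ w p * I) * (qp∞ y p * I)) * zsum∞ lambert
    converges = anti-limit d (λ i → O-*-cong (O-qp w op i) (O-ι op i)) (λ j → O-*-cong (O-qp y op j) (O-ι op j))
    limit : (qp∞ w p * I) * (qp∞ y p * I) * zsum∞ lambert * XX ≈ qp∞ (x * y) p * qp∞ (x′ * w) p
    limit = ⟶-unique
      (⟶-cong (λ m → lambert-finite x x′ y w p p≈yw xx′≈1 op r s r-inverse s-inverse m m)
        (⟶-* converges (⟶-* (⟶-sub suc ℕP.n≤1+n (qp∞-⟶ x op)) (qp∞-⟶ (x′ * p) op))))
      (⟶-* (qp∞-⟶ (x * y) op) (qp∞-⟶ (x′ * w) op))

-- Clausen's transformation

module Sections (C : CompleteRing) where
  open Products C public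

  geom-cong : ∀ {h k} → O 1 h → h ≈ k → geom h ≈ geom k
  geom-cong oh e = Σ∞-cong (λ k → O1-^ k oh) (λ k → ^-cong k e)

  geom-truncate : ∀ {h} → O 1 h → ∀ m → geom h ≈ Σ< m (h ^_) + h ^ m * geom h
  geom-truncate {h} oh m = *-cancelˡ-unit (1-h-unit oh) (begin
    (1# - h) * geom h                                       ≈⟨ geom-inverse oh ⟩
    1#                                                      ≈⟨ solve 1 (λ t → :1 := (:1 :- t) :+ t :* :1) ≈-refl (h ^ m) ⟩
    (1# - h ^ m) + h ^ m * 1#                               ≈⟨ +-cong (Σ<-geom h m) (*-congˡ (geom-inverse oh)) ⟨
    (1# - h) * Σ< m (h ^_) + h ^ m * ((1# - h) * geom h)    ≈⟨ solve 4 (λ f s t g → f :* s :+ t :* (f :* g)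
        := f :* (s :+ t :* g)) ≈-refl _ _ _ _ ⟩
    (1# - h) * (Σ< m (h ^_) + h ^ m * geom h) ∎)

  -- Clausen's transformation: the lattice sum Σ x^i y^k p^(ik) over 0 ≤ i, 1 ≤ k is cut along the diagonal.
  module Clausen (x y p : Carrier) (oy : O 1 y) (op : O 1 p) where
    square : ℕ → Carrier
    square i = (x * y) ^ i * p ^ (i ℕ.* i)

    h : ℕ → Carrier
    h k = y * p ^ k

    oh : ∀ k → O 1 (h k)
    oh k = O-*ˡ oy

    oxp : ∀ k → O 1 (x * p ^ suc k)
    oxp k = O-*ʳ (O-*ˡ op)

    diagonal : ∀ J → square J ≈ y ^ J * (x * p ^ J) ^ J
    diagonal J = begin
      (x * y) ^ J * p ^ (J ℕ.* J)      ≈⟨ *-cong (*-^ x y J) (^-* p J J) ⟩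
      x ^ J * y ^ J * (p ^ J) ^ J      ≈⟨ solve 3 (λ x y t → x :* y :* t := y :* (x :* t)) ≈-refl _ _ _ ⟩
      y ^ J * (x ^ J * (p ^ J) ^ J)    ≈⟨ *-congˡ (*-^ x (p ^ J) J) ⟨
      y ^ J * (x * p ^ J) ^ J ∎

    -- The sum of x^i y^k p^(ik) over 0 ≤ i < k ≤ J. For fixed i it is a finite geometric series in
    -- k with ratio y p^i, hence a difference of two terms over 1 - y p^i.
    below : ℕ → Carrier
    below J = Σ< J (λ i → (square i - y ^ J * (x * p ^ J) ^ i) * (h i * geom (h i)))

    row : ∀ J i → y ^ J * (x * p ^ J) ^ i - y ^ suc J * (x * p ^ suc J) ^ i ≈ y ^ J * (x * p ^ J) ^ i * (1# - h i)
    row J i = begin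
      y ^ J * (x * p ^ J) ^ i - y ^ suc J * (x * p ^ suc J) ^ i
        ≈⟨ +-congˡ (-‿cong (*-congˡ (≈-trans (^-cong i (solve 3 (λ x p t → x :* (p :* t) := p :* (x :* t)) ≈-refl x p _)) (*-^ p _ i)))) ⟩
      y ^ J * (x * p ^ J) ^ i - y * y ^ J * (p ^ i * (x * p ^ J) ^ i)
        ≈⟨ solve 4 (λ y a b t → a :* b :- y :* a :* (t :* b) := a :* b :* (:1 :- y :* t)) ≈-refl y _ _ _ ⟩
      y ^ J * (x * p ^ J) ^ i * (1# - h i) ∎

    below-suc : ∀ J → below (suc J) ≈ below J + y ^ suc J * Σ< (suc J) ((x * p ^ suc J) ^_)
    below-suc J = begin
      Σ< (suc J) (λ i → (square i - y ^ suc J * (x * p ^ suc J) ^ i) * (h i * geom (h i)))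
        ≈⟨ Σ<-cong (suc J) (λ i _ → term i) ⟩
      Σ< (suc J) (λ i → F i + y ^ suc J * (x * p ^ suc J) ^ i)
        ≈⟨ Σ<-+ (suc J) F (λ i → y ^ suc J * (x * p ^ suc J) ^ i) ⟩
      (below J + F J) + Σ< (suc J) (λ i → y ^ suc J * (x * p ^ suc J) ^ i)
        ≈⟨ +-cong (+-congˡ vanishes) (≈-sym (Σ<-distribˡ (suc J) _ _)) ⟩
      (below J + 0#) + y ^ suc J * Σ< (suc J) ((x * p ^ suc J) ^_)
        ≈⟨ +-congʳ (+-identityʳ _) ⟩
      below J + y ^ suc J * Σ< (suc J) ((x * p ^ suc J) ^_) ∎
      where
      F : ℕ → Carrier
      F i = (square i - y ^ J * (x * p ^ J) ^ i) * (h i * geom (h i))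
      vanishes : F J ≈ 0#
      vanishes = ≈-trans (*-congʳ (≈-trans (+-congʳ (diagonal J)) (-‿inverseʳ _))) (zeroˡ _)
      term : ∀ i → (square i - y ^ suc J * (x * p ^ suc J) ^ i) * (h i * geom (h i)) ≈ F i + y ^ suc J * (x * p ^ suc J) ^ i
      term i = begin
        (square i - y ^ suc J * (x * p ^ suc J) ^ i) * (h i * geom (h i))
          ≈⟨ solve 4 (λ s a b g → (s :- b) :* g := (s :- a) :* g :+ (a :- b) :* g) ≈-refl (square i) (y ^ J * (x * p ^ J) ^ i) _ _ ⟩
        F i + (y ^ J * (x * p ^ J) ^ i - y ^ suc J * (x * p ^ suc J) ^ i) * (h i * geom (h i))
          ≈⟨ +-congˡ (*-congʳ (row J i)) ⟩
        F i + y ^ J * (x * p ^ J) ^ i * (1# - h i) * (h i * geom (h i))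
          ≈⟨ +-congˡ (≈-trans (solve 4 (λ a f h g → a :* f :* (h :* g) := (a :* h) :* (f :* g)) ≈-refl _ _ _ _)
               (≈-trans (*-congˡ (geom-inverse (oh i))) (*-identityʳ _))) ⟩
        F i + y ^ J * (x * p ^ J) ^ i * (y * p ^ i)
          ≈⟨ +-congˡ (solve 4 (λ y a b t → a :* b :* (y :* t) := y :* a :* (t :* b)) ≈-refl y _ _ _) ⟩
        F i + y ^ suc J * (p ^ i * (x * p ^ J) ^ i)
          ≈⟨ +-congˡ (*-congˡ (≈-trans (≈-sym (*-^ p _ i)) (^-cong i (solve 3 (λ x p t → p :* (x :* t) := x :* (p :* t)) ≈-refl x p _)))) ⟩
        F i + y ^ suc J * (x * p ^ suc J) ^ i ∎

    -- The geometric series of row k is cut after its first k terms. The terms with i ≥ k sum to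
    -- `square k` times the whole series, and those with i < k are collected in `below`.
    finite : ∀ J → Σ< J (λ k → y ^ suc k * geom (x * p ^ suc k)) ≈ Σ< J (λ k → square (suc k) * geom (x * p ^ suc k)) + below J
    finite zero = ≈-sym (+-identityʳ _)
    finite (suc J) = begin
      Σ< J (λ k → y ^ suc k * geom (x * p ^ suc k)) + y ^ suc J * geom (x * p ^ suc J)
        ≈⟨ +-cong (finite J) (≈-trans (*-congˡ (geom-truncate (oxp J) (suc J)))
             (solve 4 (λ y s t g → y :* (s :+ t :* g) := y :* s :+ (y :* t) :* g) ≈-refl _ _ _ _)) ⟩
      (Σ< J (λ k → square (suc k) * geom (x * p ^ suc k)) + below J)
        + (y ^ suc J * Σ< (suc J) ((x * p ^ suc J) ^_) + y ^ suc J * (x * p ^ suc J) ^ suc J * geom (x * p ^ suc J))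
        ≈⟨ solve 4 (λ a b c d → (a :+ b) :+ (c :+ d) := (a :+ d) :+ (b :+ c)) ≈-refl _ _ _ _ ⟩
      (Σ< J (λ k → square (suc k) * geom (x * p ^ suc k)) + y ^ suc J * (x * p ^ suc J) ^ suc J * geom (x * p ^ suc J))
        + (below J + y ^ suc J * Σ< (suc J) ((x * p ^ suc J) ^_))
        ≈⟨ +-cong (+-congˡ (*-congʳ (≈-sym (diagonal (suc J))))) (≈-sym (below-suc J)) ⟩
      Σ< (suc J) (λ k → square (suc k) * geom (x * p ^ suc k)) + below (suc J) ∎

    O-square : ∀ k → O k (square k)
    O-square k = O-*ˡ (O1-^ k (O-*ʳ oy))

    below-⟶ : below ⟶ Σ∞ (λ k → square k * (h k * geom (h k)))
    below-⟶ = ⟶-close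
      (λ J → O-≈ (≈-trans (Σ<-cong J (λ i _ → solve 3 (λ s t g → t :* g := s :* g :+ (:- :1) :* ((s :- t) :* g)) ≈-refl (square i) _ _))
          (≈-trans (Σ<-+ J _ _) (+-congˡ (≈-trans (≈-sym (Σ<-distribˡ J (- 1#) _)) (solve 1 (λ t → (:- :1) :* t := :- t) ≈-refl _)))))
        (O-Σ< J {λ i → y ^ J * (x * p ^ J) ^ i * (h i * geom (h i))} (λ i _ → O-*ˡ (O-*ˡ (O-≤ (ℕP.m∸n≤m J 1) (O1-^ J oy))))))
      (Σ∞-⟶ (λ k → O-*ˡ (O-square k)))

  clausen : ∀ x y p → O 1 y → O 1 p →
    Σ∞ (λ k → y ^ suc k * geom (x * p ^ suc k)) ≈
      Σ∞ (λ k → (x * y) ^ suc k * p ^ (suc k ℕ.* suc k) * geom (x * p ^ suc k))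
      + Σ∞ (λ k → (x * y) ^ k * p ^ (k ℕ.* k) * (y * p ^ k * geom (y * p ^ k)))
  clausen x y p oy op = ⟶-unique (Σ∞-⟶ (λ k → O-*ˡ (O-≤ (ℕP.n≤1+n k) (O1-^ (suc k) oy))))
    (⟶-cong (λ J → ≈-sym (finite J)) (⟶-+ (Σ∞-⟶ (λ k → O-*ˡ (O-≤ (ℕP.n≤1+n k) (O-square (suc k))))) below-⟶))
    where open Clausen x y p oy op

  -- Splitting products and sums by residue classes

  Π< : ℕ → (ℕ → Carrier) → Carrier
  Π< zero F = 1#
  Π< (suc d) F = Π< d F * F d

  Π<-cong : ∀ d {F G} → (∀ i → F i ≈ G i) → Π< d F ≈ Π< d G
  Π<-cong zero e = ≈-refl
  Π<-cong (suc d) e = *-cong (Π<-cong d e) (e d)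

  Π<-* : ∀ d F G → Π< d (λ i → F i * G i) ≈ Π< d F * Π< d G
  Π<-* zero F G = ≈-sym (*-identityˡ _)
  Π<-* (suc d) F G = ≈-trans (*-congʳ (Π<-* d F G))
    (solve 4 (λ a b c d → (a :* b) :* (c :* d) := (a :* c) :* (b :* d)) ≈-refl _ _ _ _)

  Π<-⟶ : ∀ d {F : ℕ → ℕ → Carrier} {f} → (∀ i → F i ⟶ f i) → (λ m → Π< d (λ i → F i m)) ⟶ Π< d f
  Π<-⟶ zero e = ⟶-const 1#
  Π<-⟶ (suc d) e = ⟶-* (Π<-⟶ d e) (e d)

  qp-section : ∀ d a p m → qp a p (m ℕ.* d) ≈ Π< d (λ i → qp (a * p ^ i) (p ^ d) m)
  qp-section d a p zero = ≈-sym (ones d)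
    where
    ones : ∀ d → Π< d (λ _ → 1#) ≈ 1#
    ones zero = ≈-refl
    ones (suc d) = ≈-trans (*-identityʳ _) (ones d)
  qp-section d a p (suc m) = begin
    qp a p (d ℕ.+ m ℕ.* d)                                                ≈⟨ block d ⟩
    qp a p (m ℕ.* d) * Π< d (λ i → 1# - a * p ^ (i ℕ.+ m ℕ.* d))          ≈⟨ *-cong (qp-section d a p m) (Π<-cong d (λ i → +-congˡ (-‿cong
      (≈-trans (*-congˡ (≈-trans (^-+ p i (m ℕ.* d)) (*-congˡ (^-* p m d)))) (≈-sym (*-assoc _ _ _)))))) ⟩
    Π< d (λ i → qp (a * p ^ i) (p ^ d) m) * Π< d (λ i → 1# - (a * p ^ i) * (p ^ d) ^ m) ≈⟨ Π<-* d _ _ ⟨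
    Π< d (λ i → qp (a * p ^ i) (p ^ d) (suc m)) ∎
    where
    block : ∀ e → qp a p (e ℕ.+ m ℕ.* d) ≈ qp a p (m ℕ.* d) * Π< e (λ i → 1# - a * p ^ (i ℕ.+ m ℕ.* d))
    block zero = ≈-sym (*-identityʳ _)
    block (suc e) = ≈-trans (*-congʳ (block e)) (*-assoc _ _ _)

  qp∞-section : ∀ d a {p} → O 1 p → qp∞ a p ≈ Π< (suc d) (λ i → qp∞ (a * p ^ i) (p ^ suc d))
  qp∞-section d a {p} op = ⟶-unique
    (⟶-sub (λ m → m ℕ.* suc d) (λ m → ℕP.m≤m*n m (suc d)) (qp∞-⟶ a op))
    (⟶-cong (λ m → ≈-sym (qp-section (suc d) a p m)) (Π<-⟶ (suc d) (λ i → qp∞-⟶ (a * p ^ i) (O-*ˡ op))))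

  Σ<-section : ∀ d F m → Σ< (m ℕ.* d) F ≈ Σ< d (λ s → Σ< m (λ r → F (s ℕ.+ r ℕ.* d)))
  Σ<-section d F zero = ≈-sym (zeros d)
    where
    zeros : ∀ d → Σ< d (λ _ → 0#) ≈ 0#
    zeros zero = ≈-refl
    zeros (suc d) = ≈-trans (+-identityʳ _) (zeros d)
  Σ<-section d F (suc m) = begin
    Σ< (d ℕ.+ m ℕ.* d) F                                                  ≈⟨ block d ⟩
    Σ< (m ℕ.* d) F + Σ< d (λ s → F (s ℕ.+ m ℕ.* d))                       ≈⟨ +-congʳ (Σ<-section d F m) ⟩
    Σ< d (λ s → Σ< m (λ r → F (s ℕ.+ r ℕ.* d))) + Σ< d (λ s → F (s ℕ.+ m ℕ.* d)) ≈⟨ Σ<-+ d _ _ ⟨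
    Σ< d (λ s → Σ< (suc m) (λ r → F (s ℕ.+ r ℕ.* d))) ∎
    where
    block : ∀ e → Σ< (e ℕ.+ m ℕ.* d) F ≈ Σ< (m ℕ.* d) F + Σ< e (λ s → F (s ℕ.+ m ℕ.* d))
    block zero = ≈-sym (+-identityʳ _)
    block (suc e) = ≈-trans (+-congʳ (block e)) (+-assoc _ _ _)

  Σ<-⟶ : ∀ d {F : ℕ → ℕ → Carrier} {f} → (∀ i → F i ⟶ f i) → (λ m → Σ< d (λ i → F i m)) ⟶ Σ< d f
  Σ<-⟶ zero e = ⟶-const 0#
  Σ<-⟶ (suc d) e = ⟶-+ (Σ<-⟶ d e) (e d)

  Σ∞-section : ∀ d {F} → (∀ k → O k (F k)) → Σ∞ F ≈ Σ< (suc d) (λ s → Σ∞ (λ r → F (s ℕ.+ r ℕ.* suc d)))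
  Σ∞-section d {F} oF = ⟶-unique
    (⟶-sub (λ m → m ℕ.* suc d) (λ m → ℕP.m≤m*n m (suc d)) (Σ∞-⟶ oF))
    (⟶-cong (λ m → ≈-sym (Σ<-section (suc d) F m)) (Σ<-⟶ (suc d) (λ s → Σ∞-⟶ (λ r →
      O-≤ (ℕP.≤-trans (ℕP.m≤m*n r (suc d)) (ℕP.m≤n+m _ s)) (oF _)))))

  gauss-+ : ∀ a p m n → gauss a p (m ℕ.+ n) ≈ gauss a p n * gauss (a * p ^ n) p m
  gauss-+ a p zero n = ≈-sym (*-identityʳ _)
  gauss-+ a p (suc m) n = begin
    gauss a p (m ℕ.+ n) * - (a * p ^ (m ℕ.+ n))                        ≈⟨ *-cong (gauss-+ a p m n) (-‿cong (*-congˡ (^-+ p m n))) ⟩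
    gauss a p n * gauss (a * p ^ n) p m * - (a * (p ^ m * p ^ n))      ≈⟨ solve 5 (λ g h a x y → g :* h :* :- (a :* (x :* y))
        := g :* (h :* :- ((a :* y) :* x))) ≈-refl _ _ a _ _ ⟩
    gauss a p n * gauss (a * p ^ n) p (suc m) ∎

  ^-*-comm : ∀ a m n → (a ^ m) ^ n ≈ (a ^ n) ^ m
  ^-*-comm a m n = ≈-trans (≈-sym (^-* a n m)) (≈-trans (≈-reflexive (cong (a ^_) (ℕP.*-comm n m))) (^-* a m n))

  -- 5r(5r - 1)/2 = 10r + 25 r(r - 1)/2, and the sign survives because 5 is odd.
  gauss-5 : ∀ a p r → gauss a p (r ℕ.* 5) ≈ gauss (a ^ 5 * p ^ 10) (p ^ 25) r
  gauss-5 a p zero = ≈-refl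
  gauss-5 a p (suc r) = begin
    gauss a p (5 ℕ.+ r ℕ.* 5)                                                      ≈⟨ gauss-+ a p 5 (r ℕ.* 5) ⟩
    gauss a p (r ℕ.* 5) * gauss (a * p ^ (r ℕ.* 5)) p 5                            ≈⟨ *-cong (gauss-5 a p r)
      (solve 3 (λ a p t → :1 :* :- ((a :* t) :* :1) :* :- ((a :* t) :* (p :* :1)) :* :- ((a :* t) :* (p :* (p :* :1)))
          :* :- ((a :* t) :* (p :* (p :* (p :* :1)))) :* :- ((a :* t) :* (p :* (p :* (p :* (p :* :1)))))
        := :- (pow 5 a :* pow 10 p :* pow 5 t)) ≈-refl a p (p ^ (r ℕ.* 5))) ⟩
    gauss (a ^ 5 * p ^ 10) (p ^ 25) r * - (a ^ 5 * p ^ 10 * (p ^ (r ℕ.* 5)) ^ 5)   ≈⟨ *-congˡ (-‿cong (*-congˡ power)) ⟩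
    gauss (a ^ 5 * p ^ 10) (p ^ 25) (suc r) ∎
    where
    pow : ∀ {n} → ℕ → Polynomial n → Polynomial n
    pow zero a = :1
    pow (suc n) a = a :* pow n a
    power : (p ^ (r ℕ.* 5)) ^ 5 ≈ (p ^ 25) ^ r
    power = ≈-trans (^-cong 5 (^-* p r 5)) (≈-trans (^-*-comm (p ^ 5) r 5) (^-cong r (≈-sym (^-* p 5 5))))

  partial-theta-cong : ∀ {a b p r} → O 1 a → a ≈ b → p ≈ r → partial-theta a p ≈ partial-theta b r
  partial-theta-cong {p = p} oa d e = Σ∞-cong (λ k → O-gauss p k oa) (λ k → gauss-cong k d e)

  partial-theta-section : ∀ a p → O 1 a → O 1 p →
    partial-theta a p ≈ Σ< 5 (λ s → gauss a p s * partial-theta ((a * p ^ s) ^ 5 * p ^ 10) (p ^ 25))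
  partial-theta-section a p oa op = ≈-trans (Σ∞-section 4 (λ k → O-gauss p k oa)) (Σ<-cong 5 λ s _ → begin
    Σ∞ (λ r → gauss a p (s ℕ.+ r ℕ.* 5))
      ≈⟨ Σ∞-cong (λ r → O-≤ (ℕP.≤-trans (ℕP.m≤m*n r 5) (ℕP.m≤n+m _ s)) (O-gauss p _ oa)) (term s) ⟩
    Σ∞ (λ r → gauss a p s * gauss ((a * p ^ s) ^ 5 * p ^ 10) (p ^ 25) r)
      ≈⟨ Σ∞-distribˡ _ (λ r → O-gauss (p ^ 25) r (O-*ˡ (O-*ˡ (O-*ˡ oa)))) ⟨
    gauss a p s * partial-theta ((a * p ^ s) ^ 5 * p ^ 10) (p ^ 25) ∎)
    where
    term : ∀ s r → gauss a p (s ℕ.+ r ℕ.* 5) ≈ gauss a p s * gauss ((a * p ^ s) ^ 5 * p ^ 10) (p ^ 25) r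
    term s r = ≈-trans (≈-reflexive (cong (gauss a p) (ℕP.+-comm s (r ℕ.* 5))))
      (≈-trans (gauss-+ a p (r ℕ.* 5) s) (*-congˡ (gauss-5 (a * p ^ s) p r)))

-- Dissections of theta series at fifth roots of unity

module QSeries (C : CompleteRing) (q : CommutativeRing.Carrier (CompleteRing.ring C)) (oq : CompleteRing.O C 1 q) where
  open Sections C public

  infixr 9 _↑_
  _↑_ : ∀ {n} → Polynomial n → ℕ → Polynomial n
  a ↑ zero = :1
  a ↑ suc n = a :* a ↑ n

  O-q^ : ∀ n → O 1 (q ^ suc n)
  O-q^ n = O-*ˡ oq

  qq : ℕ → ℕ → Carrier
  qq e d = qp∞ (q ^ e) (q ^ d)

  triple : Carrier → Carrier → Carrier → Carrier
  triple a b p = qp∞ p p * (qp∞ a p * qp∞ b p)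

  jq : ℕ → ℕ → Carrier
  jq a b = triple (q ^ a) (q ^ b) (q ^ (a ℕ.+ b))

  vq : ℕ → ℕ → Carrier
  vq e d = partial-theta (q ^ e) (q ^ d)

  jq-theta : ∀ a b → jq a (suc b) ≈ vq (suc b) (a ℕ.+ suc b) - q ^ a * vq (a ℕ.+ (a ℕ.+ suc b)) (a ℕ.+ suc b)
  jq-theta a b = ≈-trans (jacobi-triple _ _ _ (^-+ q a (suc b)) (O-q^ b) on)
    (+-congˡ (-‿cong (*-congˡ (partial-theta-cong (O-*ʳ on) (≈-sym (^-+ q a (a ℕ.+ suc b))) ≈-refl))))
    where
    on : O 1 (q ^ (a ℕ.+ suc b))
    on = O-≈ (≈-reflexive (cong (q ^_) (≡.sym (ℕP.+-suc a b)))) (O-q^ (a ℕ.+ b))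

  qq-section : ∀ d a e k → qp∞ (a * q ^ e) (q ^ suc k) ≈ Π< (suc d) (λ i → qp∞ (a * q ^ (e ℕ.+ i ℕ.* suc k)) (q ^ (suc d ℕ.* suc k)))
  qq-section d a e k = ≈-trans (qp∞-section d (a * q ^ e) (O-q^ k)) (Π<-cong (suc d) (λ i → qp∞-cong (O-*ˡ (O-q^ k))
    (≈-trans (*-assoc a _ _) (*-congˡ (≈-trans (*-congˡ (≈-sym (^-* q i (suc k)))) (≈-sym (^-+ q e _)))))
    (≈-sym (^-* q (suc d) (suc k)))))

  qq-section₁ : ∀ d e k → qq e (suc k) ≈ Π< (suc d) (λ i → qq (e ℕ.+ i ℕ.* suc k) (suc d ℕ.* suc k))
  qq-section₁ d e k = ≈-trans (qp∞-cong (O-q^ k) (≈-sym (*-identityˡ _)) ≈-refl) (≈-trans (qq-section d 1# e k)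
    (Π<-cong (suc d) (λ i → qp∞-cong (O-q^ (k ℕ.+ d ℕ.* suc k)) (*-identityˡ _) ≈-refl)))

  gauss-scale : ∀ c a p s → gauss (c * a) p s ≈ c ^ s * gauss a p s
  gauss-scale c a p zero = ≈-sym (*-identityˡ _)
  gauss-scale c a p (suc s) = ≈-trans (*-congʳ (gauss-scale c a p s))
    (solve 5 (λ c a g k t → (k :* g) :* :- ((c :* a) :* t) := (c :* k) :* (g :* :- (a :* t))) ≈-refl c a _ _ _)

  -- Each section is a theta series in the fifth power of its first argument, where c drops out; c
  -- remains only as the prefactor c^s.
  vq-section : ∀ c e d → c ^ 5 ≈ 1# → partial-theta (c * q ^ suc e) (q ^ suc d) ≈
    Σ< 5 (λ s → c ^ s * gauss (q ^ suc e) (q ^ suc d) s * vq (5 ℕ.* (suc e ℕ.+ s ℕ.* suc d) ℕ.+ 10 ℕ.* suc d) (25 ℕ.* suc d))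
  vq-section c e d c⁵ = ≈-trans (partial-theta-section _ _ (O-*ʳ (O-q^ e)) (O-q^ d)) (Σ<-cong 5 λ s _ → *-cong (gauss-scale c (q ^ suc e) (q ^ suc d) s)
    (partial-theta-cong (O-*ʳ (O-*ˡ (O-q^ d)))
      (begin
        (c * q ^ suc e * (q ^ suc d) ^ s) ^ 5 * (q ^ suc d) ^ 10
          ≈⟨ *-cong (^-cong 5 (≈-trans (*-assoc _ _ _) (*-congˡ (≈-trans (*-congˡ (≈-sym (^-* q s (suc d)))) (≈-sym (^-+ q (suc e) _))))))
               (≈-sym (^-* q 10 (suc d))) ⟩
        (c * q ^ (suc e ℕ.+ s ℕ.* suc d)) ^ 5 * q ^ (10 ℕ.* suc d)
          ≈⟨ *-congʳ (≈-trans (*-^ c _ 5) (≈-trans (*-cong c⁵ (≈-sym (^-* q 5 (suc e ℕ.+ s ℕ.* suc d)))) (*-identityˡ _))) ⟩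
        q ^ (5 ℕ.* (suc e ℕ.+ s ℕ.* suc d)) * q ^ (10 ℕ.* suc d)
          ≈⟨ ^-+ q (5 ℕ.* (suc e ℕ.+ s ℕ.* suc d)) (10 ℕ.* suc d) ⟨
        q ^ (5 ℕ.* (suc e ℕ.+ s ℕ.* suc d) ℕ.+ 10 ℕ.* suc d) ∎)
      (≈-sym (^-* q 25 (suc d)))))

  -- Applied to ζ, ζ² and ζ⁻¹, and with c = 1 to dissect (q;q) itself.
  module FifthRoot (c c′ : Carrier) (c⁵≈1 : c ^ 5 ≈ 1#) (c′≈c⁴ : c′ ≈ c ^ 4) where
    cc′≈1 : c * c′ ≈ 1#
    cc′≈1 = ≈-trans (*-congˡ c′≈c⁴) c⁵≈1

    private
      c^5+ : ∀ n → c ^ (5 ℕ.+ n) ≈ c ^ n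
      c^5+ n = ≈-trans (^-+ c 5 n) (≈-trans (*-congʳ c⁵≈1) (*-identityˡ _))

      c′^ : ∀ s → c′ ^ s ≈ c ^ (s ℕ.* 4)
      c′^ s = ≈-trans (^-cong s c′≈c⁴) (≈-sym (^-* c s 4))

    c′²≈c³ : c′ ^ 2 ≈ c ^ 3
    c′²≈c³ = ≈-trans (c′^ 2) (c^5+ 3)

    c′³≈c² : c′ ^ 3 ≈ c ^ 2
    c′³≈c² = ≈-trans (c′^ 3) (≈-trans (c^5+ 7) (c^5+ 2))

    c′⁴≈c : c′ ^ 4 ≈ c ^ 1
    c′⁴≈c = ≈-trans (c′^ 4) (≈-trans (c^5+ 11) (≈-trans (c^5+ 6) (c^5+ 1)))

    c′⁵≈1 : c′ ^ 5 ≈ 1#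
    c′⁵≈1 = ≈-trans (c′^ 5) (≈-trans (c^5+ 15) (≈-trans (c^5+ 10) (≈-trans (c^5+ 5) (c^5+ 0))))

    section′ : ∀ e d → let g = gauss (q ^ suc e) (q ^ suc d) ; H = λ s → vq (5 ℕ.* (suc e ℕ.+ s ℕ.* suc d) ℕ.+ 10 ℕ.* suc d) (25 ℕ.* suc d) in
      partial-theta (c′ * q ^ suc e) (q ^ suc d) ≈
        H 0 + c ^ 4 * g 1 * H 1 + c ^ 3 * g 2 * H 2 + c ^ 2 * g 3 * H 3 + c ^ 1 * g 4 * H 4
    section′ e d = ≈-trans (vq-section c′ e d c′⁵≈1)
      (+-cong (+-cong (+-cong (+-cong
        (solve 1 (λ h → :0 :+ :1 :* :1 :* h := h) ≈-refl _)
        (*-congʳ (*-congʳ (≈-trans (*-identityʳ c′) c′≈c⁴))))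
        (*-congʳ (*-congʳ c′²≈c³)))
        (*-congʳ (*-congʳ c′³≈c²)))
        (*-congʳ (*-congʳ c′⁴≈c)))

    -- The solver treats c as an indeterminate. Calculations modulo c⁵ = 1 are therefore written as
    -- polynomial identities with an explicit multiple of 1 - c⁵, which is discarded here.
    reduce : ∀ a t → a + (1# - c ^ 5) * t ≈ a
    reduce a t = ≈-trans (+-congˡ (≈-trans (*-congʳ (≈-trans (+-congˡ (-‿cong c⁵≈1)) (-‿inverseʳ _))) (zeroˡ t))) (+-identityʳ a)

    -- 5-dissections of (q)(c)(q/c) and of (q³;q³)(cq;q³)(q²/c;q³).
    dissect₁ : triple c (c′ * q ^ 1) (q ^ 1) ≈ (1# - c) * jq 10 15 + (c ^ 2 - c ^ 4) * q * jq 5 20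
    dissect₁ = begin
      triple c (c′ * q ^ 1) (q ^ 1)
        ≈⟨ jacobi-triple c (c′ * q ^ 1) (q ^ 1) (≈-trans (≈-sym (≈-trans (*-congʳ cc′≈1) (*-identityˡ _))) (*-assoc _ _ _)) (O-*ʳ (O-q^ 0)) (O-q^ 0) ⟩
      partial-theta (c′ * q ^ 1) (q ^ 1) - c * partial-theta (c * q ^ 1) (q ^ 1)
        ≈⟨ +-cong (section′ 0 0) (-‿cong (*-congˡ (vq-section c 0 0 c⁵≈1))) ⟩
      -- The middle section `h₂₅` cancels between the two halves; the other four combine in pairs to
      -- bilateral series. The relation c⁵ = 1 is called for only in the coefficient of `h₃₅`.
      _ ≈⟨ solve 7 (λ c q h₁₅ h₂₀ h₂₅ h₃₀ h₃₅ →
            (h₁₅ :+ c ↑ 4 :* G q 1 :* h₂₀ :+ c ↑ 3 :* G q 2 :* h₂₅ :+ c ↑ 2 :* G q 3 :* h₃₀ :+ c ↑ 1 :* G q 4 :* h₃₅)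
            :- c :* (:0 :+ c ↑ 0 :* G q 0 :* h₁₅ :+ c ↑ 1 :* G q 1 :* h₂₀ :+ c ↑ 2 :* G q 2 :* h₂₅ :+ c ↑ 3 :* G q 3 :* h₃₀ :+ c ↑ 4 :* G q 4 :* h₃₅)
            := ((:1 :- c) :* (h₁₅ :- q ↑ 10 :* h₃₅) :+ (c ↑ 2 :- c ↑ 4) :* q :* (h₂₀ :- q ↑ 5 :* h₃₀)) :+ (:1 :- c ↑ 5) :* (q ↑ 10 :* h₃₅))
          ≈-refl c q (vq 15 25) (vq 20 25) (vq 25 25) (vq 30 25) (vq 35 25) ⟩
      _ ≈⟨ reduce _ _ ⟩
      (1# - c) * (vq 15 25 - q ^ 10 * vq 35 25) + (c ^ 2 - c ^ 4) * q * (vq 20 25 - q ^ 5 * vq 30 25)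
        ≈⟨ +-cong (*-congˡ (jq-theta 10 14)) (*-congˡ (jq-theta 5 19)) ⟨
      (1# - c) * jq 10 15 + (c ^ 2 - c ^ 4) * q * jq 5 20 ∎
      where
      G : ∀ {n} → Polynomial n → ℕ → Polynomial n
      G q zero = :1
      G q (suc n) = G q n :* :- (q ↑ 1 :* (q ↑ 1) ↑ n)

    dissect₃ : triple (c * q ^ 1) (c′ * q ^ 2) (q ^ 3) ≈
      jq 35 40 - c * q * jq 25 50 - c ^ 4 * q ^ 2 * jq 20 55 + c ^ 2 * q ^ 5 * jq 10 65 + c ^ 3 * q ^ 7 * jq 5 70
    dissect₃ = begin
      triple (c * q ^ 1) (c′ * q ^ 2) (q ^ 3)
        ≈⟨ jacobi-triple (c * q ^ 1) (c′ * q ^ 2) (q ^ 3)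
             (≈-trans (≈-sym (≈-trans (*-congʳ cc′≈1) (*-identityˡ _))) (solve 3 (λ c d q → (c :* d) :* q ↑ 3
                 := (c :* q ↑ 1) :* (d :* q ↑ 2)) ≈-refl c c′ q))
             (O-*ʳ (O-q^ 1)) (O-q^ 2) ⟩
      partial-theta (c′ * q ^ 2) (q ^ 3) - c * q ^ 1 * partial-theta (c * q ^ 1 * q ^ 3) (q ^ 3)
        ≈⟨ +-cong (section′ 1 2) (-‿cong (*-congˡ (≈-trans
             (partial-theta-cong (O-*ʳ (O-q^ 2)) (solve 2 (λ c q → c :* q ↑ 1 :* q ↑ 3 := c :* q ↑ 4) ≈-refl c q) ≈-refl)
             (vq-section c 3 2 c⁵≈1)))) ⟩
      -- The ten one-sided sections pair off into five bilateral series; in each pair the indices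
      -- add up to 150, twice the base exponent.
      _ ≈⟨ solve 12 (λ c q v₄₀ v₅₅ v₇₀ v₈₅ v₁₀₀ v₅₀ v₆₅ v₈₀ v₉₅ v₁₁₀ →
            (v₄₀ :+ c ↑ 4 :* G q 2 1 :* v₅₅ :+ c ↑ 3 :* G q 2 2 :* v₇₀ :+ c ↑ 2 :* G q 2 3 :* v₈₅ :+ c ↑ 1 :* G q 2 4 :* v₁₀₀)
            :- c :* q ↑ 1 :* (:0 :+ c ↑ 0 :* G q 4 0 :* v₅₀ :+ c ↑ 1 :* G q 4 1 :* v₆₅ :+ c ↑ 2 :* G q 4 2 :* v₈₀ :+ c ↑ 3 :* G q 4 3 :* v₉₅ :+ c ↑ 4 :* G q 4 4 :* v₁₁₀)
            := ((v₄₀ :- q ↑ 35 :* v₁₁₀) :- c :* q :* (v₅₀ :- q ↑ 25 :* v₁₀₀) :- c ↑ 4 :* q ↑ 2 :* (v₅₅ :- q ↑ 20 :* v₉₅)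
                 :+ c ↑ 2 :* q ↑ 5 :* (v₆₅ :- q ↑ 10 :* v₈₅) :+ c ↑ 3 :* q ↑ 7 :* (v₇₀ :- q ↑ 5 :* v₈₀))
               :+ (:1 :- c ↑ 5) :* (q ↑ 35 :* v₁₁₀))
          ≈-refl c q (vq 40 75) (vq 55 75) (vq 70 75) (vq 85 75) (vq 100 75) (vq 50 75) (vq 65 75) (vq 80 75) (vq 95 75) (vq 110 75) ⟩
      _ ≈⟨ reduce _ _ ⟩
      _ ≈⟨ +-cong (+-cong (+-cong (+-cong (jq-theta 35 39) (-‿cong (*-congˡ (jq-theta 25 49)))) (-‿cong (*-congˡ (jq-theta 20 54))))
             (*-congˡ (jq-theta 10 64))) (*-congˡ (jq-theta 5 69)) ⟨
      jq 35 40 - c * q * jq 25 50 - c ^ 4 * q ^ 2 * jq 20 55 + c ^ 2 * q ^ 5 * jq 10 65 + c ^ 3 * q ^ 7 * jq 5 70 ∎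
      where
      G : ∀ {n} → Polynomial n → ℕ → ℕ → Polynomial n
      G q e zero = :1
      G q e (suc n) = G q e n :* :- (q ↑ e :* (q ↑ 3) ↑ n)

-- From bilateral sums to Lambert series and products

module Exponents where
  open import Data.Nat using (_+_; _*_)
  open Data.Nat.Solver.+-*-Solver

  -- The letters are those of the four half-sums in `rank-sum`; the right-hand sides are arranged in
  -- the way in which `E` and `P` build the powers.
  A-exponent : ∀ n → 3 * n * n + 2 * n ≡ n * 2 + n * n * 3
  A-exponent = solve 1 (λ n → con 3 :* n :* n :+ con 2 :* n := n :* con 2 :+ n :* n :* con 3) refl

  B-exponent : ∀ n → 3 * n * n + 4 * n ≡ (n * 1 + n * n * 3) + n * 3
  B-exponent = solve 1 (λ n → con 3 :* n :* n :+ con 4 :* n := (n :* con 1 :+ n :* n :* con 3) :+ n :* con 3) refl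

  C-exponent : ∀ n → 3 * n * n + 4 * n + 1 ≡ (n * 1 + n * n * 3) + (1 + n * 3)
  C-exponent = solve 1 (λ n → con 3 :* n :* n :+ con 4 :* n :+ con 1 := (n :* con 1 :+ n :* n :* con 3) :+ (con 1 :+ n :* con 3)) refl

  D-exponent : ∀ n → 3 * n * n + 8 * n + 4 ≡ (n * 2 + n * n * 3) + ((2 + n * 3) + (2 + n * 3))
  D-exponent = solve 1 (λ n → con 3 :* n :* n :+ con 8 :* n :+ con 4
    := (n :* con 2 :+ n :* n :* con 3) :+ ((con 2 :+ n :* con 3) :+ (con 2 :+ n :* con 3))) refl

  D-index : ∀ n → suc (3 * n + 1) ≡ 2 + n * 3
  D-index = solve 1 (λ n → con 1 :+ (con 3 :* n :+ con 1) := con 2 :+ n :* con 3) refl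

  B-total : ∀ n → 3 * n * n + 2 * (3 * n) ≡ 3 * n * n + 4 * n + 2 * n
  B-total = solve 1 (λ n → con 3 :* n :* n :+ con 2 :* (con 3 :* n) := con 3 :* n :* n :+ con 4 :* n :+ con 2 :* n) refl

  D-negative : ∀ k → 3 * suc k ≡ 2 + (3 * k + 1)
  D-negative = solve 1 (λ k → con 3 :* (con 1 :+ k) := con 2 :+ (con 3 :* k :+ con 1)) refl

  D-total : ∀ k → 3 * suc k * suc k + (1 + 2 * suc (3 * k + 1)) ≡ 3 * k * k + 8 * k + 4 + 4 * suc k
  D-total = solve 1 (λ k → con 3 :* (con 1 :+ k) :* (con 1 :+ k) :+ (con 1 :+ con 2 :* (con 1 :+ (con 3 :* k :+ con 1)))
    := con 3 :* k :* k :+ con 8 :* k :+ con 4 :+ con 4 :* (con 1 :+ k)) refl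

module Lambert (C : CompleteRing) (q : CommutativeRing.Carrier (CompleteRing.ring C)) (oq : CompleteRing.O C 1 q) where
  open QSeries C q oq public

  -- Both sides are t² - (x + x′)t + 1: the polynomial is palindromic because x x′ = 1.
  reverse-factors : ∀ x x′ t → x * x′ ≈ 1# → (t - x) * (t - x′) ≈ (1# - x * t) * (1# - x′ * t)
  reverse-factors x x′ t e = begin
    (t - x) * (t - x′)                    ≈⟨ solve 3 (λ x y t → (t :- x) :* (t :- y) := t :* t :- (x :+ y) :* t :+ x :* y) ≈-refl x x′ t ⟩
    t * t - (x + x′) * t + x * x′         ≈⟨ +-cong (+-congʳ (≈-trans (≈-sym (*-identityˡ _)) (*-congʳ (≈-sym e)))) e ⟩
    x * x′ * (t * t) - (x + x′) * t + 1#  ≈⟨ solve 3 (λ x y t → x :* y :* (t :* t) :- (x :+ y) :* t :+ :1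
        := (:1 :- x :* t) :* (:1 :- y :* t)) ≈-refl x x′ t ⟩
    (1# - x * t) * (1# - x′ * t) ∎

  P : ℕ → Carrier
  P n = (q ^ 3) ^ n

  E : ℕ → ℕ → Carrier
  E a n = (q ^ a) ^ n * (q ^ 3) ^ (n ℕ.* n)

  O-E : ∀ a n → O n (E (suc a) n)
  O-E a n = O-*ˡ (O1-^ n (O-q^ a))

  O-q³ : O 1 (q ^ 3)
  O-q³ = O-q^ 2

  O-qP : ∀ a k → O 1 (q ^ suc a * P k)
  O-qP a k = O-*ˡ (O-q^ a)

  -- 1 - x has order 0 when x is a root of unity, so at k = 0 its inverse is the supplied `r`; all
  -- other denominators are inverted by geometric series.
  reciprocals : Carrier → Carrier → ℕ → Carrier
  reciprocals r x zero = r
  reciprocals r x (suc k) = geom (x * P (suc k))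

  reciprocals-inverse : ∀ {r x} → r * (1# - x) ≈ 1# → ∀ k → reciprocals r x k * (1# - x * P k) ≈ 1#
  reciprocals-inverse e zero = ≈-trans (*-congˡ (+-congˡ (-‿cong (*-identityʳ _)))) e
  reciprocals-inverse e (suc k) = ≈-trans (*-comm _ _) (geom-inverse (O-*ʳ (O-*ˡ O-q³)))

  -- Σ_{k∈ℤ} (q²/x)^k / (1 - x q^(3k)) for x x′ = 1 and r = 1/(1 - x)
  psi : Carrier → Carrier → Carrier → Carrier
  psi x x′ r = r + Σ∞ (λ k → (x′ * q ^ 2) ^ suc k * geom (x * P (suc k))) - x′ * Σ∞ (λ l → (x * q ^ 1) ^ suc l * geom (x′ * P (suc l)))

  clausen-term : ℕ → Carrier → Carrier → ℕ → Carrier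
  clausen-term a x x′ k = E a (suc k) * geom (x * P (suc k)) + E a k * (x′ * (q ^ a * P k) * geom (x′ * (q ^ a * P k)))

  O-clausen : ∀ a x x′ k → O k (clausen-term (suc a) x x′ k)
  O-clausen a x x′ k = O-+ (O-*ˡ (O-≤ (ℕP.n≤1+n k) (O-E a (suc k)))) (O-*ˡ (O-E a k))

  -- With y = x′ q^(a+1) the product xy is a power of q. After Clausen's transformation x survives
  -- in the denominators and as a factor x′ only, which is what makes partial fractions possible.
  psi-part : ∀ a x x′ → x * x′ ≈ 1# → Σ∞ (λ k → (x′ * q ^ suc a) ^ suc k * geom (x * P (suc k))) ≈ Σ∞ (clausen-term (suc a) x x′)
  psi-part a x x′ xx′≈1 = ≈-trans (clausen x (x′ * q ^ suc a) (q ^ 3) (O-*ʳ (O-q^ a)) O-q³)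
    (≈-trans (≈-sym (Σ∞-+ (λ k → O-*ˡ (O-*ˡ (O-≤ (ℕP.n≤1+n k) (O1-^ (suc k) oy)))) (λ k → O-*ˡ (O-*ˡ (O1-^ k oy)))))
      (Σ∞-cong (λ k → O-+ (O-*ˡ (O-*ˡ (O-≤ (ℕP.n≤1+n k) (O1-^ (suc k) oy)))) (O-*ˡ (O-*ˡ (O1-^ k oy))))
        (λ k → +-cong (*-congʳ (*-congʳ (^-cong (suc k) xy))) (*-cong (*-congʳ (^-cong k xy))
          (*-cong (*-assoc _ _ _) (geom-cong (O-*ˡ (O-*ʳ (O-q^ a))) (*-assoc _ _ _)))))))
    where
    oy : O 1 (x * (x′ * q ^ suc a))
    oy = O-*ʳ (O-*ʳ (O-q^ a))
    xy : x * (x′ * q ^ suc a) ≈ q ^ suc a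
    xy = ≈-trans (≈-sym (*-assoc _ _ _)) (≈-trans (*-congʳ xx′≈1) (*-identityˡ _))

  psi-clausen : ∀ x x′ r → x * x′ ≈ 1# → psi x x′ r ≈ r + Σ∞ (clausen-term 2 x x′) - x′ * Σ∞ (clausen-term 1 x′ x)
  psi-clausen x x′ r e = +-cong (+-congˡ (psi-part 1 x x′ e)) (-‿cong (*-congˡ (psi-part 0 x′ x (≈-trans (*-comm _ _) e))))

  -- For y = q²/x and w = qx the numerator of the summation is free of x: (q³;q³)²(q;q³)(q²;q³) =
  -- (q³;q³)(q;q).
  psi-product : ∀ x x′ r s → x * x′ ≈ 1# → r * (1# - x) ≈ 1# → s * (1# - x′) ≈ 1# →
    psi x x′ r * (qp∞ x (q ^ 3) * qp∞ (x′ * q ^ 3) (q ^ 3)) * (qp∞ (x * q ^ 1) (q ^ 3) * qp∞ (x′ * q ^ 2) (q ^ 3)) ≈ qq 3 3 * qq 1 1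
  psi-product x x′ r s e re se = begin
    psi x x′ r * (qp∞ x (q ^ 3) * qp∞ (x′ * q ^ 3) (q ^ 3)) * (qp∞ (x * q ^ 1) (q ^ 3) * qp∞ (x′ * q ^ 2) (q ^ 3))
      ≈⟨ lambert-sum x x′ (x′ * q ^ 2) (x * q ^ 1) (q ^ 3)
           (≈-trans (≈-sym (≈-trans (*-congʳ e) (*-identityˡ _)))
             (solve 3 (λ x y q → (x :* y) :* q ↑ 3 := (y :* q ↑ 2) :* (x :* q ↑ 1)) ≈-refl x x′ q))
           e (O-*ʳ (O-q^ 1)) (O-*ʳ (O-q^ 0)) (reciprocals r x) (reciprocals s x′) (reciprocals-inverse re) (reciprocals-inverse se) ⟩
    qq 3 3 * qq 3 3 * (qp∞ (x * (x′ * q ^ 2)) (q ^ 3) * qp∞ (x′ * (x * q ^ 1)) (q ^ 3))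
      ≈⟨ *-congˡ (*-cong (qp∞-cong O-q³ (collapse e (q ^ 2)) ≈-refl) (qp∞-cong O-q³ (collapse (≈-trans (*-comm _ _) e) (q ^ 1)) ≈-refl)) ⟩
    qq 3 3 * qq 3 3 * (qq 2 3 * qq 1 3)
      ≈⟨ solve 3 (λ a b c → c :* c :* (b :* a) := c :* (:1 :* a :* b :* c)) ≈-refl _ _ _ ⟩
    qq 3 3 * (1# * qq 1 3 * qq 2 3 * qq 3 3)
      ≈⟨ *-congˡ (qq-section₁ 2 1 0) ⟨
    qq 3 3 * qq 1 1 ∎
    where
    collapse : ∀ {a b} → a * b ≈ 1# → ∀ t → a * (b * t) ≈ t
    collapse e t = ≈-trans (≈-sym (*-assoc _ _ _)) (≈-trans (*-congʳ e) (*-identityˡ _))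

  module RankSum (x x′ r s : Carrier) where

    G : Carrier → Carrier
    G Q = geom (x * Q) * geom (x′ * Q)

    termA termB termC termD : ℕ → Carrier
    termA k = E 2 (suc k) * G (P (suc k))
    termB k = E 1 (suc k) * (P (suc k) * G (P (suc k)))
    termC k = E 1 k * (q ^ 1 * P k * G (q ^ 1 * P k))
    termD k = E 2 k * (q ^ 2 * P k * (q ^ 2 * P k * G (q ^ 2 * P k)))

    oA : ∀ k → O k (termA k)
    oA k = O-*ˡ (O-≤ (ℕP.n≤1+n k) (O-E 1 (suc k)))
    oB : ∀ k → O k (termB k)
    oB k = O-*ˡ (O-≤ (ℕP.n≤1+n k) (O-E 0 (suc k)))
    oC : ∀ k → O k (termC k)
    oC k = O-*ˡ (O-E 0 k)
    oD : ∀ k → O k (termD k)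
    oD k = O-*ˡ (O-E 1 k)

    -- Σ_{k∈ℤ} χ(k) q^(k(k+2)/3) / ((1 - x q^k)(1 - x′ q^k)), where χ(k) = 1, -1, 0 for k ≡ 0, 1, 2 mod 3;
    -- A and B come from k = 3n with n > 0 and n < 0, C and D from k = 3n + 1 with n ≥ 0 and n < 0.
    rank-sum : Carrier
    rank-sum = (Σ∞ termB + (r * s + Σ∞ termA)) - (Σ∞ termD + Σ∞ termC)

    private
      G-cong : ∀ {Q Q′} → O 1 Q → Q ≈ Q′ → G Q ≈ G Q′
      G-cong oQ e = *-cong (geom-cong (O-*ʳ oQ) (*-congˡ e)) (geom-cong (O-*ʳ oQ) (*-congˡ e))

      power : ∀ {m f} n → m ≡ n → q ^ n ≈ f → q ^ m ≈ f
      power n refl e = e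

      ^-split : ∀ m n {f g} → q ^ m ≈ f → q ^ n ≈ g → q ^ (m ℕ.+ n) ≈ f * g
      ^-split m n p r = ≈-trans (^-+ q m n) (*-cong p r)

      E^ : ∀ a n → q ^ (n ℕ.* a ℕ.+ n ℕ.* n ℕ.* 3) ≈ E a n
      E^ a n = ^-split (n ℕ.* a) (n ℕ.* n ℕ.* 3) (^-* q n a) (^-* q (n ℕ.* n) 3)

      P^ : ∀ n → q ^ (n ℕ.* 3) ≈ P n
      P^ n = ^-* q n 3

      aP^ : ∀ a n → q ^ (a ℕ.+ n ℕ.* 3) ≈ q ^ a * P n
      aP^ a n = ^-split a (n ℕ.* 3) ≈-refl (P^ n)

    termA^ : ∀ k → let n = suc k in q ^ (3 ℕ.* n ℕ.* n ℕ.+ 2 ℕ.* n) * G (q ^ (3 ℕ.* n)) ≈ termA k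
    termA^ k = *-cong (power (n ℕ.* 2 ℕ.+ n ℕ.* n ℕ.* 3) (Exponents.A-exponent n) (E^ 2 n))
      (G-cong (O-q^ (k ℕ.+ 2 ℕ.* suc k)) (power (n ℕ.* 3) (ℕP.*-comm 3 n) (P^ n)))
      where n = suc k

    termB^ : ∀ k → let n = suc k in q ^ (3 ℕ.* n ℕ.* n ℕ.+ 4 ℕ.* n) * G (q ^ (3 ℕ.* n)) ≈ termB k
    termB^ k = ≈-trans (*-cong
      (power _ (Exponents.B-exponent n)
        (^-split (n ℕ.* 1 ℕ.+ n ℕ.* n ℕ.* 3) (n ℕ.* 3) (E^ 1 n) (P^ n)))
      (G-cong (O-q^ (k ℕ.+ 2 ℕ.* suc k)) (power (n ℕ.* 3) (ℕP.*-comm 3 n) (P^ n)))) (*-assoc _ _ _)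
      where n = suc k

    termC^ : ∀ k → q ^ (3 ℕ.* k ℕ.* k ℕ.+ 4 ℕ.* k ℕ.+ 1) * G (q ^ suc (3 ℕ.* k)) ≈ termC k
    termC^ k = ≈-trans (*-cong
      (power _ (Exponents.C-exponent k)
        (^-split (k ℕ.* 1 ℕ.+ k ℕ.* k ℕ.* 3) (1 ℕ.+ k ℕ.* 3) (E^ 1 k) (aP^ 1 k)))
      (G-cong (O-q^ (3 ℕ.* k)) (power (1 ℕ.+ k ℕ.* 3) (cong suc (ℕP.*-comm 3 k)) (aP^ 1 k)))) (*-assoc _ _ _)

    termD^ : ∀ k → q ^ (3 ℕ.* k ℕ.* k ℕ.+ 8 ℕ.* k ℕ.+ 4) * G (q ^ suc (3 ℕ.* k ℕ.+ 1)) ≈ termD k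
    termD^ k = ≈-trans (*-cong
      (power _ (Exponents.D-exponent k)
        (^-split (k ℕ.* 2 ℕ.+ k ℕ.* k ℕ.* 3) ((2 ℕ.+ k ℕ.* 3) ℕ.+ (2 ℕ.+ k ℕ.* 3)) (E^ 2 k) (^-split (2 ℕ.+ k ℕ.* 3) (2 ℕ.+ k ℕ.* 3) (aP^ 2 k) (aP^ 2 k))))
      (G-cong (O-q^ (3 ℕ.* k ℕ.+ 1)) (power (2 ℕ.+ k ℕ.* 3) (Exponents.D-index k) (aP^ 2 k))))
      (≈-trans (*-assoc _ _ _) (*-congˡ (*-assoc _ _ _)))

  module _ (x x′ r s : Carrier) (xx′≈1 : x * x′ ≈ 1#) (r-inverse : r * (1# - x) ≈ 1#) (s-inverse : s * (1# - x′) ≈ 1#) where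
    open RankSum x x′ r s

    private
      difference₁ : ∀ {Q} → O 1 Q → x * geom (x * Q) - x′ * geom (x′ * Q) ≈ (x - x′) * G Q
      difference₁ {Q} oQ = begin
        x * geom (x * Q) - x′ * geom (x′ * Q)
          ≈⟨ +-cong (≈-trans (≈-sym (*-identityʳ _)) (*-congˡ (≈-sym (geom-inverse (O-*ʳ oQ)))))
               (-‿cong (≈-trans (≈-sym (*-identityʳ _)) (*-congˡ (≈-sym (geom-inverse (O-*ʳ oQ)))))) ⟩
        x * geom (x * Q) * ((1# - x′ * Q) * geom (x′ * Q)) - x′ * geom (x′ * Q) * ((1# - x * Q) * geom (x * Q))
          ≈⟨ solve 5 (λ x y Q g h → x :* g :* ((:1 :- y :* Q) :* h) :- y :* h :* ((:1 :- x :* Q) :* g)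
              := (x :- y) :* (g :* h)) ≈-refl x x′ Q _ _ ⟩
        (x - x′) * G Q ∎

      difference₂ : ∀ {Q} → O 1 Q → geom (x * Q) - geom (x′ * Q) ≈ (x - x′) * (Q * G Q)
      difference₂ {Q} oQ = begin
        geom (x * Q) - geom (x′ * Q)
          ≈⟨ +-cong (≈-trans (≈-sym (*-identityʳ _)) (*-congˡ (≈-sym (geom-inverse (O-*ʳ oQ)))))
               (-‿cong (≈-trans (≈-sym (*-identityʳ _)) (*-congˡ (≈-sym (geom-inverse (O-*ʳ oQ)))))) ⟩
        geom (x * Q) * ((1# - x′ * Q) * geom (x′ * Q)) - geom (x′ * Q) * ((1# - x * Q) * geom (x * Q))
          ≈⟨ solve 5 (λ x y Q g h → g :* ((:1 :- y :* Q) :* h) :- h :* ((:1 :- x :* Q) :* g)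
              := (x :- y) :* (Q :* (g :* h))) ≈-refl x x′ Q _ _ ⟩
        (x - x′) * (Q * G Q) ∎

      -- Antisymmetrizing in x and x′ pairs equal powers of q with denominators 1 - xQ and 1 - x′Q.
      -- Each pair falls under `difference₁` or `difference₂`, and the four resulting terms are A,
      -- B, D and C.
      term : ∀ k → x * (clausen-term 2 x x′ k - x′ * clausen-term 1 x′ x k) - x′ * (clausen-term 2 x′ x k - x * clausen-term 1 x x′ k)
        ≈ (x - x′) * ((termB k + termA k) - (termD k + termC k))
      term k = begin
        x * (clausen-term 2 x x′ k - x′ * clausen-term 1 x′ x k) - x′ * (clausen-term 2 x′ x k - x * clausen-term 1 x x′ k)
          ≈⟨ solve 14 (λ x y e₂ e₂' e₁ e₁' Q₂ Q₁ g g' h h' k k' →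
               x :* ((e₂ :* g :+ e₂' :* (y :* Q₂ :* h')) :- y :* (e₁ :* g' :+ e₁' :* (x :* Q₁ :* k)))
               :- y :* ((e₂ :* g' :+ e₂' :* (x :* Q₂ :* h)) :- x :* (e₁ :* g :+ e₁' :* (y :* Q₁ :* k')))
               := e₂ :* (x :* g :- y :* g') :+ (x :* y) :* (e₁ :* (g :- g') :- e₂' :* Q₂ :* (h :- h') :- e₁' :* Q₁ :* (x :* k :- y :* k')))
             ≈-refl x x′ (E 2 (suc k)) (E 2 k) (E 1 (suc k)) (E 1 k) (q ^ 2 * P k) (q ^ 1 * P k) _ _ _ _ _ _ ⟩
        E 2 (suc k) * (x * geom (x * P (suc k)) - x′ * geom (x′ * P (suc k)))
          + (x * x′) * (E 1 (suc k) * (geom (x * P (suc k)) - geom (x′ * P (suc k)))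
              - E 2 k * (q ^ 2 * P k) * (geom (x * (q ^ 2 * P k)) - geom (x′ * (q ^ 2 * P k)))
              - E 1 k * (q ^ 1 * P k) * (x * geom (x * (q ^ 1 * P k)) - x′ * geom (x′ * (q ^ 1 * P k))))
          ≈⟨ +-cong (*-congˡ (difference₁ (O-*ˡ O-q³))) (*-cong xx′≈1 (+-cong (+-cong (*-congˡ (difference₂ (O-*ˡ O-q³)))
               (-‿cong (*-congˡ (difference₂ (O-qP 1 k))))) (-‿cong (*-congˡ (difference₁ (O-qP 0 k)))))) ⟩
        E 2 (suc k) * ((x - x′) * G (P (suc k)))
          + 1# * (E 1 (suc k) * ((x - x′) * (P (suc k) * G (P (suc k))))
              - E 2 k * (q ^ 2 * P k) * ((x - x′) * (q ^ 2 * P k * G (q ^ 2 * P k)))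
              - E 1 k * (q ^ 1 * P k) * ((x - x′) * G (q ^ 1 * P k)))
          ≈⟨ solve 11 (λ u e₂ e₂' e₁ e₁' p Q₂ Q₁ g h k →
               e₂ :* (u :* g) :+ :1 :* (e₁ :* (u :* (p :* g)) :- e₂' :* Q₂ :* (u :* (Q₂ :* h)) :- e₁' :* Q₁ :* (u :* k))
               := u :* ((e₁ :* (p :* g) :+ e₂ :* g) :- (e₂' :* (Q₂ :* (Q₂ :* h)) :+ e₁' :* (Q₁ :* k))))
             ≈-refl (x - x′) (E 2 (suc k)) (E 2 k) (E 1 (suc k)) (E 1 k) (P (suc k)) (q ^ 2 * P k) (q ^ 1 * P k) _ _ _ ⟩
        (x - x′) * ((termB k + termA k) - (termD k + termC k)) ∎

      Σ∞-neg : ∀ {F} → (∀ k → O k (F k)) → Σ∞ (λ k → - F k) ≈ - Σ∞ F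
      Σ∞-neg oF = ≈-trans (Σ∞-cong (λ k → O-neg (oF k)) (λ k → solve 1 (λ t → :- t := (:- :1) :* t) ≈-refl _))
        (≈-trans (≈-sym (Σ∞-distribˡ (- 1#) oF)) (solve 1 (λ t → (:- :1) :* t := :- t) ≈-refl _))

      combination : ∀ a b {F G} → (∀ k → O k (F k)) → (∀ k → O k (G k)) → Σ∞ (λ k → a * F k - b * G k) ≈ a * Σ∞ F - b * Σ∞ G
      combination a b oF oG = ≈-trans (Σ∞-+ (λ k → O-*ʳ (oF k)) (λ k → O-neg (O-*ʳ (oG k))))
        (+-cong (≈-sym (Σ∞-distribˡ a oF)) (≈-trans (Σ∞-neg (λ k → O-*ʳ (oG k))) (-‿cong (≈-sym (Σ∞-distribˡ b oG)))))

      oT : ∀ x x′ k → O k (clausen-term 2 x x′ k - x′ * clausen-term 1 x′ x k)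
      oT x x′ k = O-+ (O-clausen 1 x x′ k) (O-neg (O-*ʳ (O-clausen 0 x′ x k)))

      psi-sum : ∀ x x′ r → x * x′ ≈ 1# → psi x x′ r ≈ r + Σ∞ (λ k → clausen-term 2 x x′ k - x′ * clausen-term 1 x′ x k)
      psi-sum x x′ r e = ≈-trans (psi-clausen x x′ r e) (≈-trans (+-assoc _ _ _) (+-congˡ (≈-sym
        (≈-trans (Σ∞-+ (O-clausen 1 x x′) (λ k → O-neg (O-*ʳ (O-clausen 0 x′ x k))))
          (+-congˡ (≈-trans (Σ∞-neg (λ k → O-*ʳ (O-clausen 0 x′ x k))) (-‿cong (≈-sym (Σ∞-distribˡ x′ (O-clausen 0 x′ x))))))))))

      -- The summand n = 0 of the first bilateral sum, 1/((1 - x)(1 - x′)).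
      constant : x * r - x′ * s ≈ (x - x′) * (r * s)
      constant = begin
        x * r - x′ * s
          ≈⟨ +-cong (≈-trans (≈-sym (*-identityʳ _)) (*-congˡ (≈-sym s-inverse))) (-‿cong (≈-trans (≈-sym (*-identityʳ _)) (*-congˡ (≈-sym r-inverse)))) ⟩
        x * r * (s * (1# - x′)) - x′ * s * (r * (1# - x))
          ≈⟨ solve 4 (λ x y r s → x :* r :* (s :* (:1 :- y)) :- y :* s :* (r :* (:1 :- x)) := (x :- y) :* (r :* s)) ≈-refl x x′ r s ⟩
        (x - x′) * (r * s) ∎

    rank-sum-psi : (x - x′) * rank-sum ≈ x * psi x x′ r - x′ * psi x′ x s
    rank-sum-psi = ≈-sym (begin
      x * psi x x′ r - x′ * psi x′ x s
        ≈⟨ +-cong (*-congˡ (psi-sum x x′ r xx′≈1)) (-‿cong (*-congˡ (psi-sum x′ x s (≈-trans (*-comm _ _) xx′≈1)))) ⟩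
      x * (r + _) - x′ * (s + _)
        ≈⟨ solve 6 (λ x y r s a b → x :* (r :+ a) :- y :* (s :+ b) := (x :* r :- y :* s) :+ (x :* a :- y :* b)) ≈-refl _ _ _ _ _ _ ⟩
      (x * r - x′ * s) + (x * Σ∞ (λ k → clausen-term 2 x x′ k - x′ * clausen-term 1 x′ x k) - x′ * Σ∞ (λ k → clausen-term 2 x′ x k - x * clausen-term 1 x x′ k))
        ≈⟨ +-cong constant (≈-sym (combination x x′ (oT x x′) (oT x′ x))) ⟩
      (x - x′) * (r * s) + Σ∞ (λ k → x * (clausen-term 2 x x′ k - x′ * clausen-term 1 x′ x k) - x′ * (clausen-term 2 x′ x k - x * clausen-term 1 x x′ k))
        ≈⟨ +-congˡ (Σ∞-cong (λ k → O-+ (O-*ʳ (oT x x′ k)) (O-neg (O-*ʳ (oT x′ x k)))) term) ⟩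
      (x - x′) * (r * s) + Σ∞ (λ k → (x - x′) * ((termB k + termA k) - (termD k + termC k)))
        ≈⟨ +-congˡ (≈-trans (≈-sym (Σ∞-distribˡ (x - x′) (λ k → O-+ (O-+ (oB k) (oA k)) (O-neg (O-+ (oD k) (oC k))))))
             (*-congˡ (≈-trans (Σ∞-+ (λ k → O-+ (oB k) (oA k)) (λ k → O-neg (O-+ (oD k) (oC k))))
               (+-cong (Σ∞-+ oB oA) (≈-trans (Σ∞-neg (λ k → O-+ (oD k) (oC k))) (-‿cong (Σ∞-+ oD oC))))))) ⟩
      (x - x′) * (r * s) + (x - x′) * ((Σ∞ termB + Σ∞ termA) - (Σ∞ termD + Σ∞ termC))
        ≈⟨ solve 5 (λ u c b a d → u :* c :+ u :* ((b :+ a) :- d) := u :* ((b :+ (c :+ a)) :- d)) ≈-refl _ _ _ _ _ ⟩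
      (x - x′) * rank-sum ∎)

    -- Split mod 3, (xq;q)(x′q;q) has six factors. The denominator of each psi takes four of them
    -- together with 1 - x or 1 - x′; the two that are left form a theta series with (q³;q³).
    rank-sum-product : (x - x′) * (1# - x) * rank-sum * (qp∞ (x * q ^ 1) (q ^ 1) * qp∞ (x′ * q ^ 1) (q ^ 1)) ≈
      qq 1 1 * (x * triple (x′ * q ^ 1) (x * q ^ 2) (q ^ 3) + triple (x * q ^ 1) (x′ * q ^ 2) (q ^ 3))
    rank-sum-product = begin
      (x - x′) * (1# - x) * rank-sum * (qp∞ (x * q ^ 1) (q ^ 1) * qp∞ (x′ * q ^ 1) (q ^ 1))
        ≈⟨ *-cong (≈-trans (solve 3 (λ u f r → u :* f :* r := (u :* r) :* f) ≈-refl _ _ _) (*-congʳ rank-sum-psi))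
             (*-cong (qq-section 2 x 1 0) (qq-section 2 x′ 1 0)) ⟩
      (x * ψ - x′ * ψ′) * (1# - x) * ((1# * X₁ * X₂ * X₃) * (1# * X₁′ * X₂′ * X₃′))
        -- The sign is absorbed by -x′(1 - x) = x x′ - x′, which is the missing factor 1 - x′ for
        -- the second psi.
        ≈⟨ solve 10 (λ x y ψ ψ' a b c a' b' c' → (x :* ψ :- y :* ψ') :* (:1 :- x) :* ((:1 :* a :* b :* c) :* (:1 :* a' :* b' :* c'))
             := x :* (ψ :* ((:1 :- x) :* c :* c') :* (a :* b')) :* (a' :* b) :+ (ψ' :* ((x :* y :- y) :* c' :* c) :* (a' :* b)) :* (a :* b'))
             ≈-refl x x′ ψ ψ′ X₁ X₂ X₃ X₁′ X₂′ X₃′ ⟩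
      x * (ψ * ((1# - x) * X₃ * X₃′) * (X₁ * X₂′)) * (X₁′ * X₂) + (ψ′ * ((x * x′ - x′) * X₃′ * X₃) * (X₁′ * X₂)) * (X₁ * X₂′)
        ≈⟨ +-cong (*-congʳ (*-congˡ product)) (*-congʳ product′) ⟩
      x * (qq 3 3 * qq 1 1) * (X₁′ * X₂) + (qq 3 3 * qq 1 1) * (X₁ * X₂′)
        ≈⟨ solve 5 (λ x p q a b → x :* (p :* q) :* a :+ (p :* q) :* b := q :* (x :* (p :* a) :+ p :* b)) ≈-refl _ _ _ _ _ ⟩
      qq 1 1 * (x * triple (x′ * q ^ 1) (x * q ^ 2) (q ^ 3) + triple (x * q ^ 1) (x′ * q ^ 2) (q ^ 3)) ∎
      where
      ψ = psi x x′ r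
      ψ′ = psi x′ x s
      X₁ = qp∞ (x * q ^ 1) (q ^ 3)
      X₂ = qp∞ (x * q ^ 2) (q ^ 3)
      X₃ = qp∞ (x * q ^ 3) (q ^ 3)
      X₁′ = qp∞ (x′ * q ^ 1) (q ^ 3)
      X₂′ = qp∞ (x′ * q ^ 2) (q ^ 3)
      X₃′ = qp∞ (x′ * q ^ 3) (q ^ 3)
      product : ψ * ((1# - x) * X₃ * X₃′) * (X₁ * X₂′) ≈ qq 3 3 * qq 1 1
      product = ≈-trans (*-congʳ (*-congˡ (*-congʳ (≈-sym (qp∞-head x O-q³))))) (psi-product x x′ r s xx′≈1 r-inverse s-inverse)
      product′ : ψ′ * ((x * x′ - x′) * X₃′ * X₃) * (X₁′ * X₂) ≈ qq 3 3 * qq 1 1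
      product′ = ≈-trans (*-congʳ (*-congˡ (*-congʳ (≈-trans (*-congʳ (+-congʳ xx′≈1)) (≈-sym (qp∞-head x′ O-q³))))))
        (psi-product x′ x s r (≈-trans (*-comm _ _) xx′≈1) s-inverse r-inverse)

-- Multiplication by (q⁵;q⁵)

module Dissection (C : CompleteRing) (q : CommutativeRing.Carrier (CompleteRing.ring C)) (oq : CompleteRing.O C 1 q) where
  open Lambert C q oq public

  module Cyclotomic (x x′ : Carrier) (x⁵≈1 : x ^ 5 ≈ 1#) (x′≈x⁴ : x′ ≈ x ^ 4)
    (sum≈0 : 1# + x + x ^ 2 + x ^ 3 + x ^ 4 ≈ 0#) (r s : Carrier) (r-inverse : r * (1# - x) ≈ 1#) (s-inverse : s * (1# - x′) ≈ 1#) where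

    open FifthRoot x x′ x⁵≈1 x′≈x⁴ using (reduce; dissect₁; dissect₃)
      renaming (cc′≈1 to xx′≈1; c′²≈c³ to x′²≈x³; c′³≈c² to x′³≈x²; c′⁴≈c to x′⁴≈x; c′⁵≈1 to x′⁵≈1)

    private
      x²⁵≈1 : (x ^ 2) ^ 5 ≈ 1#
      x²⁵≈1 = ≈-trans (^-*-comm x 2 5) (≈-trans (^-cong 2 x⁵≈1) (1^ 2))

      x′²≈x²⁴ : x′ ^ 2 ≈ (x ^ 2) ^ 4
      x′²≈x²⁴ = ≈-trans (^-cong 2 x′≈x⁴) (^-*-comm x 4 2)

      x≈x′⁴ : x ≈ x′ ^ 4
      x≈x′⁴ = ≈-trans (≈-sym (*-identityʳ x)) (≈-sym x′⁴≈x)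

    module Square = FifthRoot (x ^ 2) (x′ ^ 2) x²⁵≈1 x′²≈x²⁴
    module Conjugate = FifthRoot x′ x x′⁵≈1 x≈x′⁴

    -- The factorization of 1 - t⁵ over the fifth roots of unity. Conjugate factors are multiplied
    -- first, so that only x + x⁴ and x² + x³ enter; the relation 1 + x + x² + x³ + x⁴ = 0 is
    -- discarded as an explicit multiple, like 1 - x⁵.
    five-factors : ∀ t → (1# - x * t) * (1# - x′ * t) * ((1# - x ^ 2 * t) * (1# - x′ ^ 2 * t)) * (1# - t) ≈ 1# - t ^ 5
    five-factors t = begin
      (1# - x * t) * (1# - x′ * t) * ((1# - x ^ 2 * t) * (1# - x′ ^ 2 * t)) * (1# - t)
        ≈⟨ solve 3 (λ x y t → (:1 :- x :* t) :* (:1 :- y :* t) :* ((:1 :- x ↑ 2 :* t) :* (:1 :- y ↑ 2 :* t)) :* (:1 :- t)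
             := (:1 :- (x :+ y) :* t :+ (x :* y) :* t ↑ 2) :* (:1 :- (x ↑ 2 :+ y ↑ 2) :* t :+ (x :* y) ↑ 2 :* t ↑ 2) :* (:1 :- t)) ≈-refl x x′ t ⟩
      (1# - (x + x′) * t + (x * x′) * t ^ 2) * (1# - (x ^ 2 + x′ ^ 2) * t + (x * x′) ^ 2 * t ^ 2) * (1# - t)
        ≈⟨ *-congʳ (*-cong (+-cong (+-congˡ (-‿cong (*-congʳ (+-congˡ x′≈x⁴)))) (*-congʳ xx′≈1))
             (+-cong (+-congˡ (-‿cong (*-congʳ (+-congˡ x′²≈x³)))) (*-congʳ (≈-trans (^-cong 2 xx′≈1) (1^ 2))))) ⟩
      (1# - (x + x ^ 4) * t + 1# * t ^ 2) * (1# - (x ^ 2 + x ^ 3) * t + 1# * t ^ 2) * (1# - t)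
        ≈⟨ solve 2 (λ x t → (:1 :- (x :+ x ↑ 4) :* t :+ :1 :* t ↑ 2) :* (:1 :- (x ↑ 2 :+ x ↑ 3) :* t :+ :1 :* t ↑ 2) :* (:1 :- t)
             := (:1 :- t ↑ 5 :+ (:1 :- x ↑ 5) :* (:- (x :+ x ↑ 2) :* t ↑ 2 :* (:1 :- t)))
               :+ (:1 :+ x :+ x ↑ 2 :+ x ↑ 3 :+ x ↑ 4) :* ((:- t :+ t ↑ 2 :- t ↑ 3) :* (:1 :- t))) ≈-refl x t ⟩
      (1# - t ^ 5 + (1# - x ^ 5) * _) + (1# + x + x ^ 2 + x ^ 3 + x ^ 4) * _
        ≈⟨ +-cong (reduce _ _) (≈-trans (*-congʳ sum≈0) (zeroˡ _)) ⟩
      1# - t ^ 5 + 0#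
        ≈⟨ +-identityʳ _ ⟩
      1# - t ^ 5 ∎

    five-roots-finite : ∀ a p m → qp (x * a) p m * qp (x′ * a) p m * (qp (x ^ 2 * a) p m * qp (x′ ^ 2 * a) p m) * qp a p m ≈ qp (a ^ 5) (p ^ 5) m
    five-roots-finite a p zero = solve 0 (:1 :* :1 :* (:1 :* :1) :* :1 := :1) ≈-refl
    five-roots-finite a p (suc m) = begin
      _ ≈⟨ solve 12 (λ A B C D E x y z w a t f → (A :* (:1 :- x :* a :* t)) :* (B :* (:1 :- y :* a :* t)) :* ((C :* (:1 :- z :* a :* t)) :* (D :* (:1 :- w :* a :* t))) :* (E :* f)
             := (A :* B :* (C :* D) :* E) :* ((:1 :- x :* (a :* t)) :* (:1 :- y :* (a :* t)) :* ((:1 :- z :* (a :* t)) :* (:1 :- w :* (a :* t))) :* f))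
             ≈-refl _ _ _ _ _ x x′ (x ^ 2) (x′ ^ 2) a (p ^ m) _ ⟩
      _ ≈⟨ *-cong (five-roots-finite a p m) (five-factors (a * p ^ m)) ⟩
      qp (a ^ 5) (p ^ 5) m * (1# - (a * p ^ m) ^ 5)
        ≈⟨ *-congˡ (+-congˡ (-‿cong (≈-trans (*-^ a _ 5) (*-congˡ (^-*-comm p m 5))))) ⟩
      qp (a ^ 5) (p ^ 5) (suc m) ∎

    W W′ Y Y′ : Carrier
    W = qp∞ (x * q ^ 1) (q ^ 1)
    W′ = qp∞ (x′ * q ^ 1) (q ^ 1)
    Y = qp∞ (x ^ 2 * q ^ 1) (q ^ 1)
    Y′ = qp∞ (x′ ^ 2 * q ^ 1) (q ^ 1)

    five-roots : W * W′ * (Y * Y′) * qq 1 1 ≈ qq 5 5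
    five-roots = ≈-trans (⟶-unique
      (⟶-* (⟶-* (⟶-* (to _) (to _)) (⟶-* (to _) (to _))) (to _))
      (⟶-cong (λ m → ≈-sym (five-roots-finite (q ^ 1) (q ^ 1) m)) (qp∞-⟶ _ (O-*ˡ (O-q^ 0)))))
      (qp∞-cong (O-*ˡ (O-q^ 0)) (≈-sym (^-* q 5 1)) (≈-sym (^-* q 5 1)))
      where
      to : ∀ a → qp a (q ^ 1) ⟶ qp∞ a (q ^ 1)
      to a = qp∞-⟶ a (O-q^ 0)

    triple-head : ∀ c c′ → triple c (c′ * q ^ 1) (q ^ 1) ≈ (1# - c) * (qq 1 1 * (qp∞ (c * q ^ 1) (q ^ 1) * qp∞ (c′ * q ^ 1) (q ^ 1)))
    triple-head c c′ = ≈-trans (*-congˡ (*-congʳ (qp∞-head c (O-q^ 0))))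
      (solve 4 (λ f a b d → a :* (f :* b :* d) := f :* (a :* (b :* d))) ≈-refl _ _ _ _)

    -- (q;q)(q⁵;q⁵) is the norm from ℚ(ζ₅) of the theta series of dissect₁.
    quadratic : Unit ((1# - x) * (1# - x ^ 2)) →
      qq 1 1 * qq 5 5 ≈ jq 10 15 * jq 10 15 - q * (jq 5 20 * jq 10 15) - q ^ 2 * (jq 5 20 * jq 5 20)
    quadratic u = *-cancelˡ-unit u (begin
      (1# - x) * (1# - x ^ 2) * (qq 1 1 * qq 5 5)
        ≈⟨ *-congˡ (*-congˡ (≈-sym five-roots)) ⟩
      (1# - x) * (1# - x ^ 2) * (qq 1 1 * (W * W′ * (Y * Y′) * qq 1 1))
        ≈⟨ solve 5 (λ f g q w y → f :* g :* (q :* (w :* y :* q)) := f :* (q :* w) :* (g :* (q :* y))) ≈-refl _ _ _ _ _ ⟩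
      (1# - x) * (qq 1 1 * (W * W′)) * ((1# - x ^ 2) * (qq 1 1 * (Y * Y′)))
        ≈⟨ *-cong (≈-trans (≈-sym (triple-head x x′)) dissect₁) (≈-trans (≈-sym (triple-head (x ^ 2) (x′ ^ 2))) Square.dissect₁) ⟩
      ((1# - x) * jq 10 15 + (x ^ 2 - x ^ 4) * q * jq 5 20) * ((1# - x ^ 2) * jq 10 15 + ((x ^ 2) ^ 2 - (x ^ 2) ^ 4) * q * jq 5 20)
        ≈⟨ solve 4 (λ x q k j → ((:1 :- x) :* k :+ (x ↑ 2 :- x ↑ 4) :* q :* j) :* ((:1 :- x ↑ 2) :* k :+ ((x ↑ 2) ↑ 2 :- (x ↑ 2) ↑ 4) :* q :* j)
             := (:1 :- x) :* (:1 :- x ↑ 2) :* (k :* k :- q :* (j :* k) :- q ↑ 2 :* (j :* j))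
               :+ (:1 :- x ↑ 5) :* ((:1 :- x :+ x ↑ 3 :- x ↑ 4) :* q :* (j :* k) :+ (:1 :- x :- x ↑ 2 :+ x ↑ 3 :+ x ↑ 5 :- x ↑ 7) :* q ↑ 2 :* (j :* j)))
             ≈-refl x q (jq 10 15) (jq 5 20) ⟩
      _ ≈⟨ reduce _ _ ⟩
      (1# - x) * (1# - x ^ 2) * (jq 10 15 * jq 10 15 - q * (jq 5 20 * jq 10 15) - q ^ 2 * (jq 5 20 * jq 5 20)) ∎)

    -- One dissection carries x^k where its conjugate carries x^(-k); the weight x turns the latter
    -- into x^(1-k). The classes k and 1 - k mod 5 are {0,1}, {2,4} and {3}, hence the three
    -- constants 1 + x, x² + x⁴ and 2x³.
    numerator : x * triple (x′ * q ^ 1) (x * q ^ 2) (q ^ 3) + triple (x * q ^ 1) (x′ * q ^ 2) (q ^ 3) ≈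
      (1# + x) * (jq 35 40 - q * jq 25 50) + (x ^ 2 + x ^ 4) * (q ^ 5 * jq 10 65 - q ^ 2 * jq 20 55) + (1# + 1#) * x ^ 3 * (q ^ 7 * jq 5 70)
    numerator = begin
      x * triple (x′ * q ^ 1) (x * q ^ 2) (q ^ 3) + triple (x * q ^ 1) (x′ * q ^ 2) (q ^ 3)
        ≈⟨ +-cong (*-congˡ Conjugate.dissect₃) dissect₃ ⟩
      _ ≈⟨ solve 12 (λ x y y₂ y₃ y₄ q q₇ a b c d e →
             x :* (a :- y :* q :* b :- y₄ :* q ↑ 2 :* c :+ y₂ :* q ↑ 5 :* d :+ y₃ :* q₇ :* e)
               :+ (a :- x :* q :* b :- x ↑ 4 :* q ↑ 2 :* c :+ x ↑ 2 :* q ↑ 5 :* d :+ x ↑ 3 :* q₇ :* e)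
             := (:1 :+ x) :* a :- (x :* y :+ x) :* (q :* b) :- (x :* y₄ :+ x ↑ 4) :* (q ↑ 2 :* c)
               :+ (x :* y₂ :+ x ↑ 2) :* (q ↑ 5 :* d) :+ (x :* y₃ :+ x ↑ 3) :* (q₇ :* e))
             ≈-refl x x′ (x′ ^ 2) (x′ ^ 3) (x′ ^ 4) q (q ^ 7) (jq 35 40) (jq 25 50) (jq 20 55) (jq 10 65) (jq 5 70) ⟩
      _ ≈⟨ +-cong (+-cong (+-cong (+-congˡ (-‿cong (*-congʳ (+-congʳ xx′≈1))))
             (-‿cong (*-congʳ (+-congʳ (*-congˡ x′⁴≈x))))) (*-congʳ (+-congʳ (*-congˡ x′²≈x³)))) (*-congʳ (+-congʳ (*-congˡ x′³≈x²))) ⟩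
      _ ≈⟨ solve 8 (λ x q q₇ a b c d e →
             (:1 :+ x) :* a :- (:1 :+ x) :* (q :* b) :- (x :* x ↑ 1 :+ x ↑ 4) :* (q ↑ 2 :* c)
               :+ (x :* x ↑ 3 :+ x ↑ 2) :* (q ↑ 5 :* d) :+ (x :* x ↑ 2 :+ x ↑ 3) :* (q₇ :* e)
             := (:1 :+ x) :* (a :- q :* b) :+ (x ↑ 2 :+ x ↑ 4) :* (q ↑ 5 :* d :- q ↑ 2 :* c) :+ :2 :* x ↑ 3 :* (q₇ :* e))
             ≈-refl x q (q ^ 7) (jq 35 40) (jq 25 50) (jq 20 55) (jq 10 65) (jq 5 70) ⟩
      (1# + x) * (jq 35 40 - q * jq 25 50) + (x ^ 2 + x ^ 4) * (q ^ 5 * jq 10 65 - q ^ 2 * jq 20 55) + (1# + 1#) * x ^ 3 * (q ^ 7 * jq 5 70) ∎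

    rank-sum-dissection :
      (x - x′) * (1# - x) * (1# - x ^ 2) * RankSum.rank-sum x x′ r s * qq 5 5 ≈
      qq 1 1 * (((1# + x) * (jq 35 40 - q * jq 25 50) + (x ^ 2 + x ^ 4) * (q ^ 5 * jq 10 65 - q ^ 2 * jq 20 55) + (1# + 1#) * x ^ 3 * (q ^ 7 * jq 5 70))
        * ((1# - x ^ 2) * jq 10 15 + ((x ^ 2) ^ 2 - (x ^ 2) ^ 4) * q * jq 5 20))
    rank-sum-dissection = begin
      (x - x′) * (1# - x) * (1# - x ^ 2) * R * qq 5 5
        ≈⟨ *-congˡ (≈-sym five-roots) ⟩
      (x - x′) * (1# - x) * (1# - x ^ 2) * R * (W * W′ * (Y * Y′) * qq 1 1)
        ≈⟨ solve 6 (λ u f r w y q → u :* f :* r :* (w :* y :* q)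
            := (u :* r :* w) :* (f :* (q :* y))) ≈-refl ((x - x′) * (1# - x)) (1# - x ^ 2) R (W * W′) (Y * Y′) (qq 1 1) ⟩
      ((x - x′) * (1# - x) * R * (W * W′)) * ((1# - x ^ 2) * (qq 1 1 * (Y * Y′)))
        ≈⟨ *-cong (≈-trans (rank-sum-product x x′ r s xx′≈1 r-inverse s-inverse) (*-congˡ numerator))
             (≈-trans (≈-sym (triple-head (x ^ 2) (x′ ^ 2))) Square.dissect₁) ⟩
      _ ≈⟨ *-assoc _ _ _ ⟩
      qq 1 1 * _ ∎
      where
      R = RankSum.rank-sum x x′ r s

-- The substitution q ↦ q⁵ and the quintuple product identities

module Dilations (C : CompleteRing) (q : CommutativeRing.Carrier (CompleteRing.ring C)) (oq : CompleteRing.O C 1 q) where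
  open Dissection C q oq public

  -- The continuous endomorphism q ↦ q⁵; δ-unique says that a 5-dissection determines its components.
  record Dilation : Set where
    field
      δ        : Carrier → Carrier
      δ-cong   : ∀ {f g} → f ≈ g → δ f ≈ δ g
      δ-+      : ∀ f g → δ (f + g) ≈ δ f + δ g
      δ-*      : ∀ f g → δ (f * g) ≈ δ f * δ g
      δ-neg    : ∀ f → δ (- f) ≈ - δ f
      δ-1      : δ 1# ≈ 1#
      δ-q      : δ q ≈ q ^ 5
      δ-O      : ∀ {n f} → O n f → O n (δ f)
      δ-unique : ∀ {f₀ f₁ f₂ g₀ g₁ g₂} → δ f₀ - q * δ f₁ - q ^ 2 * δ f₂ ≈ δ g₀ - q * δ g₁ - q ^ 2 * δ g₂ → (f₀ ≈ g₀) × (f₂ ≈ g₂)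

  q²-unfold : ∀ h → q ^ 2 * h ≈ q * (q * h)
  q²-unfold h = solve 2 (λ q h → q ↑ 2 :* h := q :* (q :* h)) ≈-refl q h

  q⁵-unfold : ∀ h → q ^ 5 * h ≈ q * (q * (q * (q * (q * h))))
  q⁵-unfold h = solve 2 (λ q h → q ↑ 5 :* h := q :* (q :* (q :* (q :* (q :* h))))) ≈-refl q h

  0+q⁵1 : 0# + q ^ 5 * 1# ≈ q ^ 5
  0+q⁵1 = ≈-trans (+-identityˡ _) (*-identityʳ _)

  +q⁵0 : ∀ {a z} → z ≈ 0# → a + q ^ 5 * z ≈ a
  +q⁵0 e = ≈-trans (+-congˡ (≈-trans (*-congˡ e) (zeroʳ _))) (+-identityʳ _)

  -- The defect of multiplicativity of δ at (f , g) is q⁵ times that at (tail f , g): here F = δ f, F′ = δ (tail f), etc.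
  multiplicative-defect : ∀ {a b F F′ G G′ H H′} → F ≈ a + q ^ 5 * F′ → G ≈ b + q ^ 5 * G′ → H ≈ a * b + q ^ 5 * (a * G′ + H′) →
    H - F * G ≈ q ^ 5 * (H′ - F′ * G)
  multiplicative-defect {a} {b} {F} {F′} {G} {G′} {H} {H′} f g h = begin
    H - F * G
      ≈⟨ +-cong h (-‿cong (*-congʳ f)) ⟩
    (a * b + q ^ 5 * (a * G′ + H′)) - (a + q ^ 5 * F′) * G
      ≈⟨ solve 7 (λ a b y s t u v → (a :* b :+ y :* (a :* s :+ t)) :- (a :+ y :* u) :* v
          := (a :* ((b :+ y :* s) :- v)) :+ y :* (t :- u :* v)) ≈-refl a b (q ^ 5) G′ H′ F′ G ⟩
    a * ((b + q ^ 5 * G′) - G) + q ^ 5 * (H′ - F′ * G)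
      ≈⟨ +-congʳ (≈-trans (*-congˡ (≈-trans (+-congʳ (≈-sym g)) (-‿inverseʳ G))) (zeroʳ a)) ⟩
    0# + q ^ 5 * (H′ - F′ * G)
      ≈⟨ +-identityˡ _ ⟩
    q ^ 5 * (H′ - F′ * G) ∎

  module DilationProperties (Δ : Dilation) where
    open Dilation Δ public

    δ-- : ∀ f g → δ (f - g) ≈ δ f - δ g
    δ-- f g = ≈-trans (δ-+ f (- g)) (+-congˡ (δ-neg g))

    δ-^ : ∀ f n → δ (f ^ n) ≈ δ f ^ n
    δ-^ f zero = δ-1
    δ-^ f (suc n) = ≈-trans (δ-* f (f ^ n)) (*-congˡ (δ-^ f n))

    δ-q^ : ∀ n → δ (q ^ n) ≈ q ^ (5 ℕ.* n)
    δ-q^ n = ≈-trans (δ-^ q n) (≈-trans (^-cong n δ-q) (≈-trans (^-*-comm q 5 n) (≈-sym (^-* q 5 n))))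

    δ-⟶ : ∀ {F s} → F ⟶ s → (λ m → δ (F m)) ⟶ δ s
    δ-⟶ p n = let M , P = p n in M , λ m M≤m → O-≈ (δ-- _ _) (δ-O (P m M≤m))

    δ-qp : ∀ a p m → δ (qp a p m) ≈ qp (δ a) (δ p) m
    δ-qp a p zero = δ-1
    δ-qp a p (suc m) = ≈-trans (δ-* _ _) (*-cong (δ-qp a p m)
      (≈-trans (δ-- _ _) (+-cong δ-1 (-‿cong (≈-trans (δ-* a _) (*-congˡ (δ-^ p m)))))))

    δ-qp∞ : ∀ a {p} → O 1 p → δ (qp∞ a p) ≈ qp∞ (δ a) (δ p)
    δ-qp∞ a op = ⟶-unique (δ-⟶ (qp∞-⟶ a op)) (⟶-cong (λ m → ≈-sym (δ-qp a _ m)) (qp∞-⟶ (δ a) (δ-O op)))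

    δ-qq : ∀ e d → δ (qq e (suc d)) ≈ qq (5 ℕ.* e) (5 ℕ.* suc d)
    δ-qq e d = ≈-trans (δ-qp∞ _ (O-q^ d)) (qp∞-cong (δ-O (O-q^ d)) (δ-q^ e) (δ-q^ (suc d)))

    δ-jq : ∀ a b → δ (jq a (suc b)) ≈ jq (5 ℕ.* a) (5 ℕ.* suc b)
    δ-jq a b = ≈-trans (δ-* _ _) (*-cong (part (a ℕ.+ suc b) 5a+5b) (≈-trans (δ-* _ _) (*-cong (part a ≈-refl) (part (suc b) ≈-refl))))
      where
      op : O 1 (q ^ (a ℕ.+ suc b))
      op = O-≈ (≈-reflexive (cong (q ^_) (≡.sym (ℕP.+-suc a b)))) (O-q^ (a ℕ.+ b))
      5a+5b : q ^ (5 ℕ.* (a ℕ.+ suc b)) ≈ q ^ (5 ℕ.* a ℕ.+ 5 ℕ.* suc b)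
      5a+5b = ≈-reflexive (cong (q ^_) (ℕP.*-distribˡ-+ 5 a (suc b)))
      part : ∀ e {f} → q ^ (5 ℕ.* e) ≈ f → δ (qp∞ (q ^ e) (q ^ (a ℕ.+ suc b))) ≈ qp∞ f (q ^ (5 ℕ.* a ℕ.+ 5 ℕ.* suc b))
      part e p = ≈-trans (δ-qp∞ _ op) (qp∞-cong (δ-O op) (≈-trans (δ-q^ e) p) (≈-trans (δ-q^ (a ℕ.+ suc b)) 5a+5b))

    Q F : Carrier
    Q = qq 1 1
    F = qq 5 5

    -- `α` and `γ` are the sum sides of two quintuple product identities; their product sides are
    -- J₂²/(q;q) and J₁²/(q;q).
    J₁ J₂ T₁ T₂ T₄ T₅ T₇ α γ : Carrier
    J₁ = jq 1 4
    J₂ = jq 2 3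
    T₁ = jq 1 14
    T₂ = jq 2 13
    T₄ = jq 4 11
    T₅ = jq 5 10
    T₇ = jq 7 8
    α = T₇ + q * T₂
    γ = T₄ - q * T₁

    qq-unit : ∀ e d → Unit (qq (suc e) (suc d))
    qq-unit e d = qp∞-unit (O-q^ e) (O-q^ d)

    jq-unit : ∀ a b → Unit (jq (suc a) (suc b))
    jq-unit a b = *-unit (qq-unit (a ℕ.+ suc b) (a ℕ.+ suc b)) (*-unit (qq-unit a (a ℕ.+ suc b)) (qq-unit b (a ℕ.+ suc b)))

    QF≈J₁J₂ : Q * F ≈ J₁ * J₂
    QF≈J₁J₂ = ≈-trans (*-congʳ (qq-section₁ 4 1 0))
      (solve 5 (λ a b c d e → (:1 :* a :* b :* c :* d :* e) :* e := (e :* (a :* d)) :* (e :* (b :* c))) ≈-refl _ _ _ _ _)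

    T₅≈F : T₅ ≈ F
    T₅≈F = ≈-sym (≈-trans (qq-section₁ 2 5 4) (solve 3 (λ a b c → :1 :* a :* b :* c := c :* (a :* b)) ≈-refl _ _ _))

    δα : δ α ≈ jq 35 40 + q ^ 5 * jq 10 65
    δα = ≈-trans (δ-+ _ _) (+-cong (δ-jq 7 7) (≈-trans (δ-* _ _) (*-cong δ-q (δ-jq 2 12))))

    δγ : δ γ ≈ jq 20 55 - q ^ 5 * jq 5 70
    δγ = ≈-trans (δ-- _ _) (+-cong (δ-jq 4 10) (-‿cong (≈-trans (δ-* _ _) (*-cong δ-q (δ-jq 1 13)))))

    -- (q;q) = (q³;q³)(q;q³)(q²;q³) is itself a theta series, by which `dissect₃` applies with c =
    -- 1; its five components merge into three classes mod 5.
    Q-dissection : Q ≈ δ α - q * δ T₅ - q ^ 2 * δ γ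
    Q-dissection = begin
      Q
        ≈⟨ qq-section₁ 2 1 0 ⟩
      1# * qq 1 3 * qq 2 3 * qq 3 3
        ≈⟨ solve 3 (λ a b c → :1 :* a :* b :* c := c :* (a :* b)) ≈-refl _ _ _ ⟩
      triple (q ^ 1) (q ^ 2) (q ^ 3)
        ≈⟨ *-congˡ (*-cong (qp∞-cong (O-q^ 2) (≈-sym (*-identityˡ _)) ≈-refl) (qp∞-cong (O-q^ 2) (≈-sym (*-identityˡ _)) ≈-refl)) ⟩
      triple (1# * q ^ 1) (1# * q ^ 2) (q ^ 3)
        ≈⟨ FifthRoot.dissect₃ 1# 1# (1^ 5) (≈-sym (1^ 4)) ⟩
      _ ≈⟨ solve 6 (λ q a b c d e → a :- :1 :* q :* b :- :1 ↑ 4 :* q ↑ 2 :* c :+ :1 ↑ 2 :* q ↑ 5 :* d :+ :1 ↑ 3 :* q ↑ 7 :* e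
             := (a :+ q ↑ 5 :* d) :- q :* b :- q ↑ 2 :* (c :- q ↑ 5 :* e)) ≈-refl q (jq 35 40) (jq 25 50) (jq 20 55) (jq 10 65) (jq 5 70) ⟩
      (jq 35 40 + q ^ 5 * jq 10 65) - q * jq 25 50 - q ^ 2 * (jq 20 55 - q ^ 5 * jq 5 70)
        ≈⟨ +-cong (+-cong δα (-‿cong (*-congˡ (δ-jq 5 9)))) (-‿cong (*-congˡ δγ)) ⟨
      δ α - q * δ T₅ - q ^ 2 * δ γ ∎

    -- Comparing the 5-dissections of (q;q)(q⁵;q⁵) gives the :2 instances of the quintuple product identity.
    quintuple : Q * F ≈ jq 10 15 * jq 10 15 - q * (jq 5 20 * jq 10 15) - q ^ 2 * (jq 5 20 * jq 5 20) → (α * Q ≈ J₂ * J₂) × (γ * Q ≈ J₁ * J₁)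
    quintuple QδQ = δ-unique (begin
      δ (α * Q) - q * δ (T₅ * Q) - q ^ 2 * δ (γ * Q)
        ≈⟨ +-cong (+-cong (δ-* _ _) (-‿cong (*-congˡ (δ-* _ _)))) (-‿cong (*-congˡ (δ-* _ _))) ⟩
      δ α * δ Q - q * (δ T₅ * δ Q) - q ^ 2 * (δ γ * δ Q)
        ≈⟨ solve 6 (λ q p a b c d → a :* d :- q :* (b :* d) :- p :* (c :* d) := (a :- q :* b :- p :* c) :* d) ≈-refl q (q ^ 2) _ _ _ _ ⟩
      (δ α - q * δ T₅ - q ^ 2 * δ γ) * δ Q
        ≈⟨ *-cong (≈-sym Q-dissection) (δ-qq 1 0) ⟩
      Q * F
        ≈⟨ QδQ ⟩
      jq 10 15 * jq 10 15 - q * (jq 5 20 * jq 10 15) - q ^ 2 * (jq 5 20 * jq 5 20)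
        ≈⟨ +-cong (+-cong (δδ (δ-jq 2 2) (δ-jq 2 2)) (-‿cong (*-congˡ (δδ (δ-jq 1 3) (δ-jq 2 2))))) (-‿cong (*-congˡ (δδ (δ-jq 1 3) (δ-jq 1 3)))) ⟨
      δ (J₂ * J₂) - q * δ (J₁ * J₂) - q ^ 2 * δ (J₁ * J₁) ∎)
      where
      δδ : ∀ {f g h k} → δ f ≈ h → δ g ≈ k → δ (f * g) ≈ h * k
      δδ p r = ≈-trans (δ-* _ _) (*-cong p r)

    module Components (αQ : α * Q ≈ J₂ * J₂) (γQ : γ * Q ≈ J₁ * J₁) where

      private
        cross : ∀ {a j k} → Unit k → a * Q ≈ k * k → Q * F ≈ j * k → a * j ≈ F * k
        cross {a} {j} {k} u p r = *-cancelˡ-unit u (begin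
          k * (a * j)   ≈⟨ solve 3 (λ a j k → k :* (a :* j) := a :* (j :* k)) ≈-refl a j k ⟩
          a * (j * k)   ≈⟨ *-congˡ r ⟨
          a * (Q * F)   ≈⟨ *-assoc _ _ _ ⟨
          a * Q * F     ≈⟨ *-congʳ p ⟩
          k * k * F     ≈⟨ solve 2 (λ k f → k :* k :* f := k :* (f :* k)) ≈-refl k F ⟩
          k * (F * k) ∎)

      αJ₁≈FJ₂ : α * J₁ ≈ F * J₂
      αJ₁≈FJ₂ = cross (jq-unit 1 2) αQ QF≈J₁J₂

      γJ₂≈FJ₁ : γ * J₂ ≈ F * J₁
      γJ₂≈FJ₁ = cross (jq-unit 0 3) γQ (≈-trans QF≈J₁J₂ (*-comm _ _))

      -- [q^a ; q^b]_∞
      ϑ : ℕ → ℕ → Carrier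
      ϑ a b = qq a b * qq (b ∸ a) b

      ϑ₁ : ϑ 1 15 * ϑ 4 15 * ϑ 6 15 ≈ ϑ 1 5
      ϑ₁ = ≈-sym (≈-trans (*-cong (qq-section₁ 2 1 4) (qq-section₁ 2 4 4))
        (solve 6 (λ a b c d e f → (:1 :* a :* b :* c) :* (:1 :* d :* e :* f) := (a :* f) :* (d :* c) :* (b :* e)) ≈-refl _ _ _ _ _ _))

      ϑ₂ : ϑ 2 15 * ϑ 3 15 * ϑ 7 15 ≈ ϑ 2 5
      ϑ₂ = ≈-sym (≈-trans (*-cong (qq-section₁ 2 2 4) (qq-section₁ 2 3 4))
        (solve 6 (λ a b c d e f → (:1 :* a :* b :* c) :* (:1 :* d :* e :* f) := (a :* f) :* (d :* c) :* (b :* e)) ≈-refl _ _ _ _ _ _))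

      private
        α-ϑ : α * ϑ 1 5 ≈ J₂
        α-ϑ = *-cancelˡ-unit (qq-unit 4 4) (≈-trans (solve 3 (λ f a t → f :* (a :* t) := a :* (f :* t)) ≈-refl F α _) αJ₁≈FJ₂)

        γ-ϑ : γ * ϑ 2 5 ≈ J₁
        γ-ϑ = *-cancelˡ-unit (qq-unit 4 4) (≈-trans (solve 3 (λ f a t → f :* (a :* t) := a :* (f :* t)) ≈-refl F γ _) γJ₂≈FJ₁)

        -- One factor t of the squared denominator cancels against j = F t. The other would leave a
        -- quotient of theta series, which the quintuple product a t = j′ = F t′ turns into the sum
        -- a.
        square-quotient : ∀ {j j′ t t′ a i} → Q * F ≈ j * j′ → j ≈ F * t → j′ ≈ F * t′ → a * t ≈ j′ → t * (t * 1#) * i ≈ 1# → Q * F * (t′ * i) ≈ j′ * a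
        square-quotient {j} {j′} {t} {t′} {a} {i} p r s e d = begin
          Q * F * (t′ * i)              ≈⟨ *-congʳ (≈-trans p (*-congʳ r)) ⟩
          F * t * j′ * (t′ * i)         ≈⟨ solve 5 (λ f t j t' i → f :* t :* j :* (t' :* i)
              := j :* ((f :* t') :* (t :* i))) ≈-refl F t j′ t′ i ⟩
          j′ * (F * t′ * (t * i))       ≈⟨ *-congˡ (*-congʳ (≈-trans (≈-sym s) (≈-sym e))) ⟩
          j′ * (a * t * (t * i))        ≈⟨ solve 4 (λ j a t i → j :* (a :* t :* (t :* i))
              := (j :* a) :* (t :* (t :* :1) :* i)) ≈-refl j′ a t i ⟩
          j′ * a * (t * (t * 1#) * i)   ≈⟨ ≈-trans (*-congˡ d) (*-identityʳ _) ⟩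
          j′ * a ∎

        quotient : ∀ {j j′ t i} → Q * F ≈ j * j′ → j ≈ F * t → t * i ≈ 1# → Q * F * i ≈ F * j′
        quotient {j} {j′} {t} {i} p r d = begin
          Q * F * i          ≈⟨ *-congʳ (≈-trans p (*-congʳ r)) ⟩
          F * t * j′ * i     ≈⟨ solve 4 (λ f t j i → f :* t :* j :* i := f :* j :* (t :* i)) ≈-refl F t j′ i ⟩
          F * j′ * (t * i)   ≈⟨ ≈-trans (*-congˡ d) (*-identityʳ _) ⟩
          F * j′ ∎

        F≈ : F ≈ qq 15 15 * ϑ 5 15
        F≈ = ≈-sym T₅≈F

        -- F splits as (q¹⁵;q¹⁵)[q⁵;q¹⁵]. The second factor and t cover the denominator d, and the
        -- first is left to form a theta series of base q¹⁵ with the remaining b′ b.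
        theta-quotient : ∀ {j j′ t b b′ i d} → Q * F ≈ j * j′ → j ≈ F * t → ϑ 5 15 * t ≈ d * b′ → d * i ≈ 1# →
          Q * F * (b * i) ≈ j′ * (qq 15 15 * (b′ * b))
        theta-quotient {j} {j′} {t} {b} {b′} {i} {d} p r e m = begin
          Q * F * (b * i)                         ≈⟨ *-congʳ (≈-trans p (*-congʳ (≈-trans r (*-congʳ F≈)))) ⟩
          qq 15 15 * ϑ 5 15 * t * j′ * (b * i)    ≈⟨ solve 6 (λ P s t j b i → P :* s :* t :* j :* (b :* i)
              := j :* (P :* ((s :* t) :* (i :* b)))) ≈-refl _ _ t j′ b i ⟩
          j′ * (qq 15 15 * (ϑ 5 15 * t * (i * b))) ≈⟨ *-congˡ (*-congˡ (*-congʳ e)) ⟩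
          j′ * (qq 15 15 * (d * b′ * (i * b)))    ≈⟨ *-congˡ (*-congˡ (≈-trans (solve 4 (λ d b' i b → d :* b' :* (i :* b)
              := (d :* i) :* (b' :* b)) ≈-refl d b′ i b)
                                                      (≈-trans (*-congʳ m) (*-identityˡ _)))) ⟩
          j′ * (qq 15 15 * (b′ * b)) ∎

        times-1 : ∀ j′ b → j′ * (qq 15 15 * (1# * b)) ≈ j′ * (qq 15 15 * b)
        times-1 j′ b = *-congˡ (*-congˡ (*-identityˡ b))

        1-times : ∀ {i j′ b} → Q * F * (1# * i) ≈ j′ * (qq 15 15 * (b * 1#)) → Q * F * i ≈ j′ * (qq 15 15 * b)
        1-times p = ≈-trans (*-congˡ (≈-sym (*-identityˡ _))) (≈-trans p (*-congˡ (*-congˡ (*-identityʳ _))))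

        FJ₂J₁ : Q * F ≈ J₂ * J₁
        FJ₂J₁ = ≈-trans QF≈J₁J₂ (*-comm _ _)

      -- Subscripts: the index j of A_{35j} and the position of the summand. Here and below,
      -- (q;q)(q⁵;q⁵) clears the denominators, and the result is a product of theta series or of one
      -- with `α`, `γ` or F.
      component₀₁ : ∀ {i} → ϑ 1 5 * (ϑ 1 5 * 1#) * i ≈ 1# → Q * F * (ϑ 2 5 * i) ≈ J₂ * α
      component₀₁ = square-quotient {j′ = J₂} QF≈J₁J₂ ≈-refl ≈-refl α-ϑ

      component₀₂ : ∀ {i} → ϑ 1 15 * ϑ 4 15 * ϑ 5 15 * ϑ 6 15 * i ≈ 1# → Q * F * (ϑ 2 15 * i) ≈ J₂ * T₂
      component₀₂ e = ≈-trans (theta-quotient {b′ = 1#} QF≈J₁J₂ ≈-refl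
        (≈-trans (*-congˡ (≈-sym ϑ₁)) (solve 4 (λ a b c d → c :* (a :* b :* d) := a :* b :* c :* d :* :1) ≈-refl _ _ _ _)) e) (times-1 _ _)

      component₁₁ : ∀ {i} → ϑ 1 5 * i ≈ 1# → Q * F * i ≈ F * J₂
      component₁₁ = quotient QF≈J₁J₂ ≈-refl

      component₁₂ : ∀ {i} → ϑ 3 15 * ϑ 5 15 * ϑ 7 15 * i ≈ 1# → Q * F * i ≈ J₁ * T₂
      component₁₂ e = 1-times (theta-quotient {b = 1#} {b′ = ϑ 2 15} FJ₂J₁ ≈-refl
        (≈-trans (*-congˡ (≈-sym ϑ₂)) (solve 4 (λ a b c d → c :* (a :* b :* d) := b :* c :* d :* a) ≈-refl _ _ _ _)) e)

      component₂₁ : ∀ {i} → ϑ 2 5 * i ≈ 1# → Q * F * i ≈ F * J₁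
      component₂₁ = quotient FJ₂J₁ ≈-refl

      component₂₂ : ∀ {i} → ϑ 1 15 * ϑ 5 15 * ϑ 6 15 * i ≈ 1# → Q * F * i ≈ J₂ * T₄
      component₂₂ e = 1-times (theta-quotient {b = 1#} {b′ = ϑ 4 15} QF≈J₁J₂ ≈-refl
        (≈-trans (*-congˡ (≈-sym ϑ₁)) (solve 4 (λ a b c d → c :* (a :* b :* d) := a :* c :* d :* b) ≈-refl _ _ _ _)) e)

      component₃₁ : ∀ {i} → ϑ 2 5 * (ϑ 2 5 * 1#) * i ≈ 1# → Q * F * (ϑ 1 5 * i) ≈ J₁ * γ
      component₃₁ = square-quotient {j′ = J₁} FJ₂J₁ ≈-refl ≈-refl γ-ϑ

      component₃₂ : ∀ {i} → ϑ 2 15 * ϑ 3 15 * ϑ 5 15 * ϑ 7 15 * i ≈ 1# → Q * F * (ϑ 1 15 * i) ≈ J₁ * T₁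
      component₃₂ e = ≈-trans (theta-quotient {b′ = 1#} FJ₂J₁ ≈-refl
        (≈-trans (*-congˡ (≈-sym ϑ₂)) (solve 4 (λ a b c d → c :* (a :* b :* d) := a :* b :* c :* d :* :1) ≈-refl _ _ _ _)) e) (times-1 _ _)

-- Comparison of the two dissections

module Assembly (C : CompleteRing) (q : CommutativeRing.Carrier (CompleteRing.ring C)) (oq : CompleteRing.O C 1 q) where
  open Dilations C q oq public

  -- The product of the two dissections contains ten products of theta series. The two quintuple
  -- relations eliminate j₁t₇ and j₂t₁; the hypotheses compare the coefficients of the other eight.
  module _ (u a b d e f k₀ k₁ k₂ k₃ c : Carrier)
    (ae : a * e ≈ u * k₀) (af-ae : a * f - a * e ≈ u * k₁) (bf-af : b * f - a * f ≈ - (u * c)) (be : b * e ≈ u * k₀ - u)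
    (-af-de : - (a * f) - d * e ≈ u * k₂) (de-be : d * e - b * e ≈ - (u * c)) (-bf : - (b * f) ≈ u * k₃) (df : d * f ≈ u * (c - 1#) - u * k₃) where

    -- j₁, j₂, … stand for the theta products with q⁵ in place of q.
    match : ∀ (j₁ j₂ t₁ t₂ t₄ t₇ g : Carrier) → j₁ * (t₇ + q ^ 5 * t₂) ≈ g * j₂ → j₂ * (t₄ - q ^ 5 * t₁) ≈ g * j₁ →
      (a * (t₇ - q * g) + b * (q ^ 5 * t₂ - q ^ 2 * t₄) + d * (q ^ 7 * t₁)) * (e * j₂ + f * q * j₁) ≈
      u * ((k₀ * (j₂ * (t₇ + q ^ 5 * t₂)) - q ^ 5 * (j₂ * t₂)) + q ^ 1 * (k₁ * (g * j₂) - c * (q ^ 5 * (j₁ * t₂)))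
        + q ^ 2 * (k₂ * (g * j₁) - c * (j₂ * t₄)) + q ^ 3 * (k₃ * (j₁ * (t₄ - q ^ 5 * t₁)) + (c - 1#) * (q ^ 5 * (j₁ * t₁))))
    match j₁ j₂ t₁ t₂ t₄ t₇ g p r = begin
      (a * (t₇ - q * g) + b * (q ^ 5 * t₂ - q ^ 2 * t₄) + d * (q ^ 7 * t₁)) * (e * j₂ + f * q * j₁)
        ≈⟨ solve 13 (λ q a b d e f j₁ j₂ t₁ t₂ t₄ t₇ g →
             (a :* (t₇ :- q :* g) :+ b :* (q ↑ 5 :* t₂ :- q ↑ 2 :* t₄) :+ d :* (q ↑ 7 :* t₁)) :* (e :* j₂ :+ f :* q :* j₁)
             := ((a :* e) :* (j₂ :* t₇) :+ (b :* e) :* (q ↑ 5 :* (j₂ :* t₂)) :+ (a :* f :- a :* e) :* (q :* (g :* j₂)) :+ (b :* f :- a :* f) :* (q ↑ 6 :* (j₁ :* t₂))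
                 :+ (:- (a :* f) :- d :* e) :* (q ↑ 2 :* (g :* j₁)) :+ (d :* e :- b :* e) :* (q ↑ 2 :* (j₂ :* t₄))
                 :+ (:- (b :* f)) :* (q ↑ 3 :* (j₁ :* t₄)) :+ (d :* f) :* (q ↑ 8 :* (j₁ :* t₁)))
               :+ (a :* f :* q) :* (j₁ :* (t₇ :+ q ↑ 5 :* t₂) :- g :* j₂) :- (d :* e :* q ↑ 2) :* (j₂ :* (t₄ :- q ↑ 5 :* t₁) :- g :* j₁))
             ≈-refl q a b d e f j₁ j₂ t₁ t₂ t₄ t₇ g ⟩
      _ ≈⟨ +-cong (+-cong
             (+-cong (+-cong (+-cong (+-cong (+-cong (+-cong (+-cong (*-congʳ ae) (*-congʳ be)) (*-congʳ af-ae)) (*-congʳ bf-af)) (*-congʳ -af-de)) (*-congʳ de-be)) (*-congʳ -bf)) (*-congʳ df))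
             (*-congˡ (≈-trans (+-congʳ p) (-‿inverseʳ _)))) (-‿cong (*-congˡ (≈-trans (+-congʳ r) (-‿inverseʳ _)))) ⟩
      _ ≈⟨ solve 16 (λ q u k₀ k₁ k₂ k₃ c j₁ j₂ t₁ t₂ t₄ t₇ g z₁ z₂ →
             ((u :* k₀) :* (j₂ :* t₇) :+ (u :* k₀ :- u) :* (q ↑ 5 :* (j₂ :* t₂)) :+ (u :* k₁) :* (q :* (g :* j₂)) :+ (:- (u :* c)) :* (q ↑ 6 :* (j₁ :* t₂))
                 :+ (u :* k₂) :* (q ↑ 2 :* (g :* j₁)) :+ (:- (u :* c)) :* (q ↑ 2 :* (j₂ :* t₄))
                 :+ (u :* k₃) :* (q ↑ 3 :* (j₁ :* t₄)) :+ (u :* (c :- :1) :- u :* k₃) :* (q ↑ 8 :* (j₁ :* t₁)))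
               :+ z₁ :* :0 :- z₂ :* :0
             := u :* ((k₀ :* (j₂ :* (t₇ :+ q ↑ 5 :* t₂)) :- q ↑ 5 :* (j₂ :* t₂)) :+ q ↑ 1 :* (k₁ :* (g :* j₂) :- c :* (q ↑ 5 :* (j₁ :* t₂)))
                 :+ q ↑ 2 :* (k₂ :* (g :* j₁) :- c :* (j₂ :* t₄)) :+ q ↑ 3 :* (k₃ :* (j₁ :* (t₄ :- q ↑ 5 :* t₁)) :+ (c :- :1) :* (q ↑ 5 :* (j₁ :* t₁)))))
             ≈-refl q u k₀ k₁ k₂ k₃ c j₁ j₂ t₁ t₂ t₄ t₇ g (a * f * q) (d * e * q ^ 2) ⟩
      u * ((k₀ * (j₂ * (t₇ + q ^ 5 * t₂)) - q ^ 5 * (j₂ * t₂)) + q ^ 1 * (k₁ * (g * j₂) - c * (q ^ 5 * (j₁ * t₂)))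
        + q ^ 2 * (k₂ * (g * j₁) - c * (j₂ * t₄)) + q ^ 3 * (k₃ * (j₁ * (t₄ - q ^ 5 * t₁)) + (c - 1#) * (q ^ 5 * (j₁ * t₁)))) ∎

  module Main (Δ : Dilation) (x x′ : Carrier) (x⁵≈1 : x ^ 5 ≈ 1#) (x′≈x⁴ : x′ ≈ x ^ 4)
    (sum≈0 : 1# + x + x ^ 2 + x ^ 3 + x ^ 4 ≈ 0#) (r s : Carrier) (r-inverse : r * (1# - x) ≈ 1#) (s-inverse : s * (1# - x′) ≈ 1#)
    (x²-unit : Unit (1# - x ^ 2)) (x-x′-unit : Unit (x - x′)) (k₀ k₁ k₂ k₃ c : Carrier) where
    open DilationProperties Δ public
    open Cyclotomic x x′ x⁵≈1 x′≈x⁴ sum≈0 r s r-inverse s-inverse public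

    -- `a`, `b`, `d` are the constants of `numerator`, and `e`, `f` those of `dissect₁` at ζ². In
    -- `u`, x - x′ comes from the antisymmetrization, 1 - x from clearing the psi denominators and 1
    -- - x² from the theta series at ζ².
    u a b d e f : Carrier
    u = (x - x′) * (1# - x) * (1# - x ^ 2)
    a = 1# + x
    b = x ^ 2 + x ^ 4
    d = (1# + 1#) * x ^ 3
    e = 1# - x ^ 2
    f = (x ^ 2) ^ 2 - (x ^ 2) ^ 4

    combine₀ : ∀ {k h t j m n} → Q * F * h ≈ m → Q * F * (t * j) ≈ n → Q * F * (k * h - q ^ 1 * t * j) ≈ k * m - q * n
    combine₀ {k} {h} {t} {j} p r = ≈-trans
      (solve 6 (λ N q k h t j → N :* (k :* h :- q ↑ 1 :* t :* j) := k :* (N :* h) :- q :* (N :* (t :* j))) ≈-refl (Q * F) q k h t j)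
      (+-cong (*-congˡ p) (-‿cong (*-congˡ r)))

    combine₁ : ∀ {k h l j m n} → Q * F * h ≈ m → Q * F * j ≈ n → Q * F * (k * h - l * (q ^ 1 * j)) ≈ k * m - l * (q * n)
    combine₁ {k} {h} {l} {j} p r = ≈-trans
      (solve 6 (λ N q k h l j → N :* (k :* h :- l :* (q ↑ 1 :* j)) := k :* (N :* h) :- l :* (q :* (N :* j))) ≈-refl (Q * F) q k h l j)
      (+-cong (*-congˡ p) (-‿cong (*-congˡ (*-congˡ r))))

    combine₂ : ∀ {k h l j m n} → Q * F * h ≈ m → Q * F * j ≈ n → Q * F * (k * h - l * j) ≈ k * m - l * n
    combine₂ {k} {h} {l} {j} p r = ≈-trans
      (solve 5 (λ N k h l j → N :* (k :* h :- l :* j) := k :* (N :* h) :- l :* (N :* j)) ≈-refl (Q * F) k h l j)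
      (+-cong (*-congˡ p) (-‿cong (*-congˡ r)))

    combine₃ : ∀ {k h l t j m n} → Q * F * h ≈ m → Q * F * (t * j) ≈ n → Q * F * (k * h + l * (q ^ 1 * t * j)) ≈ k * m + l * (q * n)
    combine₃ {k} {h} {l} {t} {j} p r = ≈-trans
      (solve 7 (λ N q k h l t j → N :* (k :* h :+ l :* (q ↑ 1 :* t :* j))
          := k :* (N :* h) :+ l :* (q :* (N :* (t :* j)))) ≈-refl (Q * F) q k h l t j)
      (+-cong (*-congˡ p) (*-congˡ (*-congˡ r)))

    x-unit : Unit (1# - x)
    x-unit = unit r (≈-trans (*-comm _ _) r-inverse)

    open Components
      (proj₁ (quintuple (quadratic (*-unit x-unit x²-unit)))) (proj₂ (quintuple (quadratic (*-unit x-unit x²-unit)))) public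

    module _
      (ae : a * e ≈ u * k₀) (af-ae : a * f - a * e ≈ u * k₁) (bf-af : b * f - a * f ≈ - (u * c)) (be : b * e ≈ u * k₀ - u)
      (-af-de : - (a * f) - d * e ≈ u * k₂) (de-be : d * e - b * e ≈ - (u * c)) (-bf : - (b * f) ≈ u * k₃) (df : d * f ≈ u * (c - 1#) - u * k₃)
      (δk₀ : δ k₀ ≈ k₀) (δk₁ : δ k₁ ≈ k₁) (δk₂ : δ k₂ ≈ k₂) (δk₃ : δ k₃ ≈ k₃) (δc : δ c ≈ c)
      (A₀ A₁ A₂ A₃ : Carrier)
      (QFA₀ : Q * F * A₀ ≈ k₀ * (J₂ * α) - q * (J₂ * T₂)) (QFA₁ : Q * F * A₁ ≈ k₁ * (F * J₂) - c * (q * (J₁ * T₂)))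
      (QFA₂ : Q * F * A₂ ≈ k₂ * (F * J₁) - c * (J₂ * T₄)) (QFA₃ : Q * F * A₃ ≈ k₃ * (J₁ * γ) + (c - 1#) * (q * (J₁ * T₁)))
      where

      private
        j₁ j₂ t₁ t₂ t₄ t₇ g : Carrier
        j₁ = jq 5 20
        j₂ = jq 10 15
        t₁ = jq 5 70
        t₂ = jq 10 65
        t₄ = jq 20 55
        t₇ = jq 35 40
        g = jq 25 50

        δ-product : ∀ {f g h k} → δ f ≈ h → δ g ≈ k → δ (f * g) ≈ h * k
        δ-product p r = ≈-trans (δ-* _ _) (*-cong p r)

        δ-difference : ∀ {f g h k} → δ f ≈ h → δ g ≈ k → δ (f - g) ≈ h - k
        δ-difference p r = ≈-trans (δ-- _ _) (+-cong p (-‿cong r))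

        δj₁ : δ J₁ ≈ j₁
        δj₁ = δ-jq 1 3
        δj₂ : δ J₂ ≈ j₂
        δj₂ = δ-jq 2 2
        δt₁ : δ T₁ ≈ t₁
        δt₁ = δ-jq 1 13
        δt₂ : δ T₂ ≈ t₂
        δt₂ = δ-jq 2 12
        δt₄ : δ T₄ ≈ t₄
        δt₄ = δ-jq 4 10
        δF : δ F ≈ g
        δF = ≈-trans (δ-cong (≈-sym T₅≈F)) (δ-jq 5 9)

        δN₀ : δ (Q * F * A₀) ≈ k₀ * (j₂ * (t₇ + q ^ 5 * t₂)) - q ^ 5 * (j₂ * t₂)
        δN₀ = ≈-trans (δ-cong QFA₀) (δ-difference (δ-product δk₀ (δ-product δj₂ δα)) (δ-product δ-q (δ-product δj₂ δt₂)))
        δN₁ : δ (Q * F * A₁) ≈ k₁ * (g * j₂) - c * (q ^ 5 * (j₁ * t₂))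
        δN₁ = ≈-trans (δ-cong QFA₁) (δ-difference (δ-product δk₁ (δ-product δF δj₂)) (δ-product δc (δ-product δ-q (δ-product δj₁ δt₂))))
        δN₂ : δ (Q * F * A₂) ≈ k₂ * (g * j₁) - c * (j₂ * t₄)
        δN₂ = ≈-trans (δ-cong QFA₂) (δ-difference (δ-product δk₂ (δ-product δF δj₁)) (δ-product δc (δ-product δj₂ δt₄)))
        δN₃ : δ (Q * F * A₃) ≈ k₃ * (j₁ * (t₄ - q ^ 5 * t₁)) + (c - 1#) * (q ^ 5 * (j₁ * t₁))
        δN₃ = ≈-trans (δ-cong QFA₃) (≈-trans (δ-+ _ _) (+-cong (δ-product δk₃ (δ-product δj₁ δγ))
          (δ-product (δ-difference δc δ-1) (δ-product δ-q (δ-product δj₁ δt₁)))))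

        j₁α : j₁ * (t₇ + q ^ 5 * t₂) ≈ g * j₂
        j₁α = ≈-trans (≈-sym (δ-product δj₁ δα)) (≈-trans (δ-cong (≈-trans (*-comm _ _) αJ₁≈FJ₂)) (δ-product δF δj₂))
        j₂γ : j₂ * (t₄ - q ^ 5 * t₁) ≈ g * j₁
        j₂γ = ≈-trans (≈-sym (δ-product δj₂ δγ)) (≈-trans (δ-cong (≈-trans (*-comm _ _) γJ₂≈FJ₁)) (δ-product δF δj₁))

      -- The identity is multiplied by u (q⁵;q⁵)(q;q), all of whose factors are units, so that
      -- neither the A_{35j} nor the rank sum has denominators left to compare.
      main : ∀ iQ → Q * iQ ≈ 1# →
        iQ * RankSum.rank-sum x x′ r s ≈ δ F * (δ A₀ + q ^ 1 * δ A₁ + q ^ 2 * δ A₂ + q ^ 3 * δ A₃)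
      main iQ QiQ = *-cancelˡ-unit (*-unit (*-unit (*-unit (*-unit x-x′-unit x-unit) x²-unit) (qq-unit 4 4)) (qq-unit 0 0)) (begin
        u * F * Q * (iQ * R)
          ≈⟨ solve 5 (λ u F Q i R → u :* F :* Q :* (i :* R) := (Q :* i) :* (u :* R :* F)) ≈-refl u F Q iQ R ⟩
        (Q * iQ) * (u * R * F)
          ≈⟨ ≈-trans (*-congʳ QiQ) (*-identityˡ _) ⟩
        u * R * F
          ≈⟨ rank-sum-dissection ⟩
        Q * ((a * (t₇ - q * g) + b * (q ^ 5 * t₂ - q ^ 2 * t₄) + d * (q ^ 7 * t₁)) * (e * j₂ + f * q * j₁))
          ≈⟨ *-congˡ (match u a b d e f k₀ k₁ k₂ k₃ c ae af-ae bf-af be -af-de de-be -bf df j₁ j₂ t₁ t₂ t₄ t₇ g j₁α j₂γ) ⟩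
        Q * (u * _)
          ≈⟨ *-congˡ (*-congˡ (+-cong (+-cong (+-cong δN₀ (*-congˡ δN₁)) (*-congˡ δN₂)) (*-congˡ δN₃))) ⟨
        Q * (u * (δ (Q * F * A₀) + q ^ 1 * δ (Q * F * A₁) + q ^ 2 * δ (Q * F * A₂) + q ^ 3 * δ (Q * F * A₃)))
          ≈⟨ *-congˡ (*-congˡ (+-cong (+-cong (+-cong (split A₀) (*-congˡ (split A₁))) (*-congˡ (split A₂))) (*-congˡ (split A₃)))) ⟩
        Q * (u * (F * δ F * δ A₀ + q ^ 1 * (F * δ F * δ A₁) + q ^ 2 * (F * δ F * δ A₂) + q ^ 3 * (F * δ F * δ A₃)))
          ≈⟨ solve 11 (λ Q u F G a b c d q₁ q₂ q₃ → Q :* (u :* (F :* G :* a :+ q₁ :* (F :* G :* b) :+ q₂ :* (F :* G :* c) :+ q₃ :* (F :* G :* d)))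
               := u :* F :* Q :* (G :* (a :+ q₁ :* b :+ q₂ :* c :+ q₃ :* d))) ≈-refl Q u F (δ F) _ _ _ _ (q ^ 1) (q ^ 2) (q ^ 3) ⟩
        u * F * Q * (δ F * (δ A₀ + q ^ 1 * δ A₁ + q ^ 2 * δ A₂ + q ^ 3 * δ A₃)) ∎)
        where
        R = RankSum.rank-sum x x′ r s
        -- δ Q = F. Hence F splits off from every component and cancels, and δ F = (q²⁵;q²⁵) is the
        -- factor of the right-hand side.
        split : ∀ A → δ (Q * F * A) ≈ F * δ F * δ A
        split A = δ-product (δ-product (δ-qq 1 0) ≈-refl) ≈-refl

-- The power series over ℚ(ζ) as a complete ring

module Concrete where
  open Defs hiding (_≈_; _^_)

  private
    ⟨⟩-cong : ∀ {a b c d a' b' c' d'} → a ≡ a' → b ≡ b' → c ≡ c' → d ≡ d' → ⟨ a , b , c , d ⟩ ≡ ⟨ a' , b' , c' , d' ⟩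
    ⟨⟩-cong refl refl refl refl = refl
    open QuadRing ℚ K ℚ._+_ ℚ._-_ ℚ._*_ (λ p → ℚ.- p) 0ℚ 1ℚ ℚP.+-*-isCommutativeRing (λ _ _ → refl) ⟨_,_,_,_⟩
      using (quad; mul-comm; mul-assoc; mul-distribˡ; mul-identityˡ)

  +K-assoc : ∀ x y z → (x +K y) +K z ≡ x +K (y +K z)
  +K-assoc ⟨ a , b , c , d ⟩ ⟨ e , f , g , h ⟩ ⟨ i , j , k , l ⟩ =
    ⟨⟩-cong (ℚP.+-assoc a e i) (ℚP.+-assoc b f j) (ℚP.+-assoc c g k) (ℚP.+-assoc d h l)

  +K-comm : ∀ x y → x +K y ≡ y +K x
  +K-comm ⟨ a , b , c , d ⟩ ⟨ e , f , g , h ⟩ =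
    ⟨⟩-cong (ℚP.+-comm a e) (ℚP.+-comm b f) (ℚP.+-comm c g) (ℚP.+-comm d h)

  +K-identityˡ : ∀ x → 0K +K x ≡ x
  +K-identityˡ ⟨ a , b , c , d ⟩ = ⟨⟩-cong (ℚP.+-identityˡ a) (ℚP.+-identityˡ b) (ℚP.+-identityˡ c) (ℚP.+-identityˡ d)

  -K-inverseˡ : ∀ x → (-K x) +K x ≡ 0K
  -K-inverseˡ ⟨ a , b , c , d ⟩ = ⟨⟩-cong (ℚP.+-inverseˡ a) (ℚP.+-inverseˡ b) (ℚP.+-inverseˡ c) (ℚP.+-inverseˡ d)

  *K-assoc : ∀ x y z → (x *K y) *K z ≡ x *K (y *K z)
  *K-assoc ⟨ a , b , c , d ⟩ ⟨ e , f , g , h ⟩ ⟨ i , j , k , l ⟩ =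
    mul-assoc (quad a b c d) (quad e f g h) (quad i j k l)

  *K-comm : ∀ x y → x *K y ≡ y *K x
  *K-comm ⟨ a , b , c , d ⟩ ⟨ e , f , g , h ⟩ =
    mul-comm (quad a b c d) (quad e f g h)

  *K-distribˡ-+K : ∀ x y z → x *K (y +K z) ≡ x *K y +K x *K z
  *K-distribˡ-+K ⟨ a , b , c , d ⟩ ⟨ e , f , g , h ⟩ ⟨ i , j , k , l ⟩ =
    mul-distribˡ (quad a b c d) (quad e f g h) (quad i j k l)

  *K-identityˡ : ∀ x → 1K *K x ≡ x
  *K-identityˡ ⟨ a , b , c , d ⟩ =
    mul-identityˡ (quad a b c d)

  abstract
    K-isCommutativeRing : IsCommutativeRing _≡_ _+K_ _*K_ (λ x → -K x) 0K 1K
    K-isCommutativeRing = record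
      { isRing = record
        { +-isAbelianGroup = record
          { isGroup = record
            { isMonoid = record
              { isSemigroup = record
                { isMagma = record { isEquivalence = ≡.isEquivalence ; ∙-cong = cong₂ _+K_ }
                ; assoc = +K-assoc }
              ; identity = +K-identityˡ , λ x → ≡.trans (+K-comm x 0K) (+K-identityˡ x) }
            ; inverse = -K-inverseˡ , λ x → ≡.trans (+K-comm x (-K x)) (-K-inverseˡ x)
            ; ⁻¹-cong = cong (λ x → -K x) }
          ; comm = +K-comm }
        ; *-cong = cong₂ _*K_
        ; *-assoc = *K-assoc
        ; *-identity = *K-identityˡ , λ x → ≡.trans (*K-comm x 1K) (*K-identityˡ x)
        ; distrib = *K-distribˡ-+K , λ x y z → ≡.trans (*K-comm (y +K z) x)
                      (≡.trans (*K-distribˡ-+K x y z) (cong₂ _+K_ (*K-comm x y) (*K-comm x z))) }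
      ; *-comm = *K-comm }

  K-ring : CommutativeRing 0ℓ 0ℓ
  K-ring = record { isCommutativeRing = K-isCommutativeRing }

  -- Sealed copies of the operations of Defs: those unfold at every comparison of functions.
  infixl 6 _⊞_
  infixl 7 _⊠_
  abstract
    _⊞_ _⊠_ : Series → Series → Series
    _⊞_ = _⊕_
    _⊠_ = _⊗_

    ⊟_ : Series → Series
    (⊟ f) n = -K f n

    ⊞-at : ∀ f g n → (f ⊞ g) n ≡ f n +K g n
    ⊞-at f g n = refl

    ⊠-at : ∀ f g n → (f ⊠ g) n ≡ Σ≤ n (λ k → f k *K g (n ∸ k))
    ⊠-at f g n = refl

    ⊟-at : ∀ f n → (⊟ f) n ≡ -K f n
    ⊟-at f n = refl

    ⊗≡⊠ : ∀ f g → f ⊗ g ≡ f ⊠ g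
    ⊗≡⊠ f g = refl

  open SeriesRing K _+K_ _*K_ (λ x → -K x) 0K 1K K-isCommutativeRing Σ≤ (λ _ → refl) (λ _ _ → refl) _⊞_ _⊠_ ⊟_ const
    ⊞-at ⊠-at ⊟-at (λ _ → refl) (λ _ _ → refl)
    using (tail; scale; ⊗-zero; ⊗-tailˡ; tail-⊗; const-⊗; O-⊗; isCommutativeRing-Series)
    renaming (O to Order)

  abstract
    Series-isCommutativeRing : IsCommutativeRing _≋_ _⊞_ _⊠_ ⊟_ (const 0K) (const 1K)
    Series-isCommutativeRing = isCommutativeRing-Series

  private
    module KR = CommutativeRing K-ring
    open Solver K-ring using () renaming (solve to solveK; _:=_ to _:=K_; _:+_ to _:+K_; :-_ to :-K_)

  -- F n is correct only below order n, so coefficient n is read off from `F (suc n)`. The infinite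
  -- products, inverses and bilateral sums of the statement are truncated at the same place, and
  -- agree with limits coefficient by coefficient.
  diagonal-limit : (ℕ → Series) → Series
  diagonal-limit F n = F (suc n) n

  diagonal-limit-Order : ∀ F → (∀ m → Order m (F (suc m) ⊞ (⊟ F m))) → ∀ m → Order m (F m ⊞ (⊟ diagonal-limit F))
  diagonal-limit-Order F c m i i<m = trans (minus-at (F m) (diagonal-limit F) i) (trans (cong (_+K (-K F (suc i) i)) (stable m i<m)) (KR.-‿inverseʳ (F (suc i) i)))
    where
    minus-at : ∀ f g i → (f ⊞ (⊟ g)) i ≡ f i +K (-K g i)
    minus-at f g i = trans (⊞-at f (⊟ g) i) (cong (f i +K_) (⊟-at g i))
    stable : ∀ m → i < m → F m i ≡ F (suc i) i
    stable (suc m) (s≤s i≤m) with ℕP.m≤n⇒m<n∨m≡n i≤m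
    ... | inj₁ i<m = trans
      (trans (solveK 2 (λ a b → a :=K (a :+K :-K b) :+K b) refl (F (suc m) i) (F m i))
        (trans (cong (_+K F m i) (trans (sym (minus-at (F (suc m)) (F m) i)) (c m i i<m))) (KR.+-identityˡ (F m i)))) (stable m i<m)
    ... | inj₂ refl = refl

  power-series : CompleteRing
  power-series = record
    { ring = record { isCommutativeRing = Series-isCommutativeRing }
    ; O = Order
    ; O-≈ = λ e p i i<n → trans (sym (at e i)) (p i i<n)
    ; O-zero = λ _ _ ()
    ; O-0# = λ { n zero _ → refl ; n (suc i) _ → refl }
    ; O-+ = λ {n} {f} {g} p r i i<n → trans (⊞-at f g i) (trans (cong₂ _+K_ (p i i<n) (r i i<n)) refl)
    ; O-neg = λ {n} {f} p i i<n → trans (⊟-at f i) (cong (λ x → -K x) (p i i<n))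
    ; O-* = λ {m} {n} {f} {g} → O-⊗ {m} {n} {f} {g}
    ; O-≤ = λ m≤n p i i<m → p i (ℕP.≤-trans i<m m≤n)
    ; O-sep = λ p → pointwise λ { zero → p 1 0 (s≤s z≤n) ; (suc n) → p (suc (suc n)) (suc n) ℕP.≤-refl }
    ; lim = diagonal-limit
    ; lim-O = diagonal-limit-Order
    }

  X : Series
  X = q^ 1

  O-X : Order 1 X
  O-X zero _ = refl
  O-X (suc i) (s≤s ())

  open Assembly power-series X O-X public

  ⊗≈* : ∀ {f f′ g g′} → f ≈ f′ → g ≈ g′ → f ⊗ g ≈ f′ * g′
  ⊗≈* {f} {f′} {g} {g′} p r = ≈-trans (≈-reflexive (⊗≡⊠ f g)) (*-cong p r)

  ⊕≈+ : ∀ {f f′ g g′} → f ≈ f′ → g ≈ g′ → f ⊕ g ≈ f′ + g′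
  ⊕≈+ {f} {f′} {g} {g′} p r = ≈-trans (pointwise λ n → sym (⊞-at f g n)) (+-cong p r)

  ⊖≈- : ∀ {f f′ g g′} → f ≈ f′ → g ≈ g′ → f ⊖ g ≈ f′ - g′
  ⊖≈- {f} {f′} {g} {g′} p r = ≈-trans
    (pointwise λ n → trans (cong (f n +K_) (sym (⊟-at g n))) (sym (⊞-at f (⊟ g) n))) (+-cong p (-‿cong r))

  X-zero : ∀ f → (X * f) 0 ≡ 0K
  X-zero f = trans (⊗-zero X f) (KR.zeroˡ (f 0))

  X-suc : ∀ f n → (X * f) (suc n) ≡ f n
  X-suc f n = trans (⊗-tailˡ X f n) (trans (cong₂ _+K_ (KR.zeroˡ (f (suc n))) (at (≈-trans (*-congʳ {x = f} tail-X) (*-identityˡ f)) n)) (KR.+-identityˡ (f n)))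
    where
    tail-X : tail X ≈ 1#
    tail-X = pointwise λ { zero → refl ; (suc n) → refl }

  q^-same : ∀ e → q^ e e ≡ 1K
  q^-same e with e ℕ.≟ e
  ... | yes _ = refl
  ... | no e≢e = contradiction refl e≢e

  q^-other : ∀ e n → e ≢ n → q^ e n ≡ 0K
  q^-other e n e≢n with e ℕ.≟ n
  ... | yes e≡n = contradiction e≡n e≢n
  ... | no _ = refl

  X^≈q^ : ∀ e → X ^ e ≈ q^ e
  X^≈q^ zero = pointwise λ { zero → refl ; (suc n) → refl }
  X^≈q^ (suc e) = pointwise λ
    { zero → X-zero (X ^ e)
    ; (suc n) → trans (X-suc (X ^ e) n) (trans (at (X^≈q^ e) n) (shift-both e n)) }
    where
    shift-both : ∀ e n → q^ e n ≡ q^ (suc e) (suc n)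
    shift-both e n with e ℕ.≟ n
    ... | yes refl = sym (q^-same (suc e))
    ... | no e≢n = sym (q^-other (suc e) (suc n) (λ p → e≢n (ℕP.suc-injective p)))

  poch≈qq : ∀ e d → poch e d ≈ qq e d
  poch≈qq e d = pointwise λ n → at (finite (suc n)) n
    where
    finite : ∀ m → ∏< m (λ j → 𝟙 ⊖ q^ (e ℕ.+ d ℕ.* j)) ≈ qp (X ^ e) (X ^ d) m
    finite zero = ≈-refl
    finite (suc m) = ⊗≈* (finite m) (⊖≈- ≈-refl (≈-trans (≈-sym (X^≈q^ (e ℕ.+ d ℕ.* m)))
      (≈-trans (^-+ X e (d ℕ.* m)) (*-congˡ {x = X ^ e} (≈-trans (≈-reflexive (cong (X ^_) (ℕP.*-comm d m))) (^-* X m d))))))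

  const-+ : ∀ a b → const (a +K b) ≈ const a + const b
  const-+ a b = pointwise λ { zero → sym (⊞-at (const a) (const b) 0) ; (suc n) → sym (⊞-at (const a) (const b) (suc n)) }

  const-neg : ∀ a → const (-K a) ≈ - const a
  const-neg a = pointwise λ { zero → sym (⊟-at (const a) 0) ; (suc n) → sym (⊟-at (const a) (suc n)) }

  const-* : ∀ a b → const (a *K b) ≈ const a * const b
  const-* a b = pointwise λ n → trans (lemma n) (sym (const-⊗ a (const b) n))
    where
    lemma : ∀ n → const (a *K b) n ≡ a *K const b n
    lemma zero = refl
    lemma (suc n) = sym (KR.zeroʳ a)

  ·≈const : ∀ a f → (a · f) ≈ const a * f
  ·≈const a f = pointwise λ n → sym (const-⊗ a f n)

  Σ<-at : ∀ m F n → Σ< (suc m) F n ≡ Σ≤ m (λ k → F k n)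
  Σ<-at zero F n = trans (⊞-at 0# (F 0) n) (trans (cong (_+K F 0 n) (zero-at n)) (KR.+-identityˡ (F 0 n)))
    where
    zero-at : ∀ n → const 0K n ≡ 0K
    zero-at zero = refl
    zero-at (suc n) = refl
  Σ<-at (suc m) F n = trans (⊞-at (Σ< (suc m) F) (F (suc m)) n) (cong (_+K F (suc m) n) (Σ<-at m F n))

  inv-inverse : ∀ f → invK (f 0) *K f 0 ≡ 1K → f * inv f ≈ 1#
  inv-inverse f e = begin
    f * inv f                        ≈⟨ *-congˡ {x = f} inv≈geom ⟩
    f * (const a * geom h)           ≈⟨ solve 3 (λ f a g → f :* (a :* g) := (a :* f) :* g) ≈-refl f (const a) (geom h) ⟩
    (const a * f) * geom h           ≈⟨ *-congʳ {x = geom h} (≈-sym 1-h) ⟩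
    (1# - h) * geom h                ≈⟨ geom-inverse O-h ⟩
    1# ∎
    where
    a = invK (f 0)
    h : Series
    h = 𝟙 ⊖ (a · f)
    powers : ∀ k → (h Defs.^ k) ≈ h ^ k
    powers zero = ≈-refl
    powers (suc k) = ⊗≈* {h} ≈-refl (powers k)
    inv≈geom : inv f ≈ const a * geom h
    inv≈geom = pointwise λ n → trans (cong (a *K_) (trans (sym (Σ<-at n (λ k → h Defs.^ k) n)) (at (Σ<-cong (suc n) (λ k _ → powers k)) n))) (sym (const-⊗ a (geom h) n))
    1-h : 1# - h ≈ const a * f
    1-h = ≈-trans (+-congˡ {x = 1#} (-‿cong (⊖≈- {𝟙} ≈-refl (·≈const a f))))
      (solve 1 (λ t → :1 :- (:1 :- t) := t) ≈-refl (const a * f))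
    O-h : Order 1 h
    O-h zero _ = trans (cong (λ t → 1K +K (-K t)) e) (KR.-‿inverseʳ 1K)
    O-h (suc i) (s≤s ())

  inv-unit : ∀ f → f 0 ≡ 1K → f * inv f ≈ 1#
  inv-unit f e = inv-inverse f (trans (cong (λ t → invK t *K t) e) refl)

  inv-unique : ∀ {f g} → invK (f 0) *K f 0 ≡ 1K → f * g ≈ 1# → inv f ≈ g
  inv-unique {f} {g} e p = *-cancelˡ-unit {f} {inv f} {g} (unit (inv f) (inv-inverse f e)) (≈-trans {f * inv f} {1#} {f * g} (inv-inverse f e) (≈-sym {f * g} {1#} p))

  -- On both sides the coefficient of q^N is the finite sum over -(N+1) ≤ n ≤ N+1; what remains is a
  -- reindexing.
  Σℤ≈zsum∞ : ∀ F → Σℤ F ≈ zsum∞ F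
  Σℤ≈zsum∞ F = pointwise coefficient
    where
    shift-⊖ : ∀ N i → shift F N i ≡ F (i ℤ.⊖ N)
    shift-⊖ zero i = refl
    shift-⊖ (suc N) zero = refl
    shift-⊖ (suc N) (suc i) = trans (shift-⊖ N i) (cong F (sym (ℤP.[1+m]⊖[1+n]≡m⊖n i N)))
    Σ≤-cong′ : ∀ n {f g : ℕ → K} → (∀ i → f i ≡ g i) → Σ≤ n f ≡ Σ≤ n g
    Σ≤-cong′ zero e = e 0
    Σ≤-cong′ (suc n) e = cong₂ _+K_ (Σ≤-cong′ n e) (e (suc n))
    +-at : ∀ N {f f′ g g′ : Series} → f N ≡ f′ N → g N ≡ g′ N → (f + g) N ≡ (f′ + g′) N
    +-at N {f} {f′} {g} {g′} p r = trans (⊞-at f g N) (trans (cong₂ _+K_ p r) (sym (⊞-at f′ g′ N)))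
    coefficient : ∀ N → Σℤ F N ≡ zsum∞ F N
    coefficient N = trans (cong (λ k → Σ≤ k (λ i → F ((ℤ.+ i) ℤ.- (ℤ.+ m)) N)) (cong (m ℕ.+_) (ℕP.+-identityʳ m)))
      (trans (Σ≤-cong′ (m ℕ.+ m) (λ i → cong (λ s → s N) (trans (cong F (ℤP.m-n≡m⊖n i m)) (sym (shift-⊖ m i)))))
        (trans (sym (Σ<-at (m ℕ.+ m) (shift F m) N))
          (trans (sym (at (anti-Σ< (m ℕ.+ m) (shift F m)) N))
            (trans (at (anti-shift F m m) N) (trans (at (+-congˡ {x = Σ< m (λ l → F -[1+ l ])} (Σ<-head m (λ k → F (ℤ.+ k)))) N)
              (+-at N {neg m} {Σ∞ (λ l → F -[1+ l ])} {F (ℤ.+ 0) + pos m} {F (ℤ.+ 0) + Σ∞ (λ k → F (ℤ.+ suc k))} refl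
                (+-at N {F (ℤ.+ 0)} {F (ℤ.+ 0)} {pos m} {Σ∞ (λ k → F (ℤ.+ suc k))} refl refl)))))))
      where
      m = suc N
      neg pos : ℕ → Series
      neg m = Σ< m (λ l → F -[1+ l ])
      pos m = Σ< m (λ k → F (ℤ.+ suc k))

  -- The dilation q ↦ q⁵ on power series

  dilate-hit : ∀ f n → n ℕ.% 5 ≡ 0 → dilate 5 f n ≡ f (n ℕ./ 5)
  dilate-hit f n e with n ℕ.% 5 ℕ.≟ 0
  ... | yes _ = refl
  ... | no ¬e = contradiction e ¬e

  dilate-miss : ∀ f n → n ℕ.% 5 ≢ 0 → dilate 5 f n ≡ 0K
  dilate-miss f n ¬e with n ℕ.% 5 ℕ.≟ 0
  ... | yes e = contradiction e ¬e
  ... | no _ = refl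

  dilate-multiple : ∀ f n → dilate 5 f (n ℕ.* 5) ≡ f n
  dilate-multiple f n = trans (dilate-hit f (n ℕ.* 5) (ℕD.m*n%n≡0 n 5)) (cong f (ℕD.m*n/n≡m n 5))

  dilate-nonmultiple : ∀ f i n → i ℕ.% 5 ≢ 0 → dilate 5 f (i ℕ.+ n ℕ.* 5) ≡ 0K
  dilate-nonmultiple f i n ¬e = dilate-miss f (i ℕ.+ n ℕ.* 5) (λ e → ¬e (trans (sym (ℕD.[m+kn]%n≡m%n i n 5)) e))

  dilate-shift : ∀ f m → dilate 5 f (5 ℕ.+ m) ≡ dilate 5 (tail f) m
  dilate-shift f m with m ℕ.% 5 ℕ.≟ 0
  ... | yes _ = cong f (ℕD.+-distrib-/-∣ˡ {5} m {5} (ℕV.divides 1 refl))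
  ... | no _ = refl

  dilate-cong : ∀ {f g} → f ≈ g → dilate 5 f ≈ dilate 5 g
  dilate-cong {f} {g} p = pointwise λ n → coefficient n
    where
    coefficient : ∀ n → dilate 5 f n ≡ dilate 5 g n
    coefficient n with n ℕ.% 5 ℕ.≟ 0
    ... | yes _ = at p (n ℕ./ 5)
    ... | no _ = refl

  dilate-+ : ∀ f g → dilate 5 (f + g) ≈ dilate 5 f + dilate 5 g
  dilate-+ f g = pointwise λ n → trans (coefficient n) (sym (⊞-at (dilate 5 f) (dilate 5 g) n))
    where
    coefficient : ∀ n → dilate 5 (f ⊞ g) n ≡ dilate 5 f n +K dilate 5 g n
    coefficient n with n ℕ.% 5 ℕ.≟ 0
    ... | yes _ = ⊞-at f g (n ℕ./ 5)
    ... | no _ = refl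

  dilate-neg : ∀ f → dilate 5 (- f) ≈ - dilate 5 f
  dilate-neg f = pointwise λ n → trans (coefficient n) (sym (⊟-at (dilate 5 f) n))
    where
    coefficient : ∀ n → dilate 5 (⊟ f) n ≡ -K (dilate 5 f n)
    coefficient n with n ℕ.% 5 ℕ.≟ 0
    ... | yes _ = ⊟-at f (n ℕ./ 5)
    ... | no _ = refl

  dilate-const-* : ∀ a f → dilate 5 (const a * f) ≈ const a * dilate 5 f
  dilate-const-* a f = pointwise λ n → trans (coefficient n) (sym (const-⊗ a (dilate 5 f) n))
    where
    coefficient : ∀ n → dilate 5 (const a * f) n ≡ a *K dilate 5 f n
    coefficient n with n ℕ.% 5 ℕ.≟ 0
    ... | yes _ = const-⊗ a f (n ℕ./ 5)
    ... | no _ = sym (KR.zeroʳ a)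

  dilate-O : ∀ {n f} → Order n f → Order n (dilate 5 f)
  dilate-O {n} {f} p i i<n with i ℕ.% 5 ℕ.≟ 0
  ... | yes _ = p (i ℕ./ 5) (ℕP.≤-<-trans (ℕD.m/n≤m i 5) i<n)
  ... | no _ = refl

  X⁵ : Series → Series
  X⁵ h = X * (X * (X * (X * (X * h))))

  +K-identityʳ : ∀ a → a +K 0K ≡ a
  +K-identityʳ a = trans (+K-comm a 0K) (+K-identityˡ a)

  -- The image of f = f 0 + q · `tail f` under q ↦ q⁵. It reduces multiplicativity to a recursion on
  -- the tail and avoids sums over multiples of 5.
  dilate-step : ∀ f → dilate 5 f ≈ const (f 0) + X ^ 5 * dilate 5 (tail f)
  dilate-step f = ≈-trans expanded (+-congˡ (≈-sym (q⁵-unfold d)))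
    where
    d = dilate 5 (tail f)
    x₁ x₂ x₃ x₄ : Series
    x₁ = X * d
    x₂ = X * x₁
    x₃ = X * x₂
    x₄ = X * x₃
    sum : ∀ n a b c → dilate 5 f n ≡ a → const (f 0) n ≡ b → X⁵ d n ≡ c → a ≡ b +K c → dilate 5 f n ≡ const (f 0) n +K X⁵ d n
    sum n a b c p r s e = trans p (trans e (sym (cong₂ _+K_ r s)))
    coefficient : ∀ n → dilate 5 f n ≡ const (f 0) n +K X⁵ d n
    coefficient 0 = sum 0 (f 0) (f 0) 0K refl refl (X-zero x₄) (sym (+K-identityʳ (f 0)))
    coefficient 1 = sum 1 0K 0K 0K refl refl (trans (X-suc x₄ 0) (X-zero x₃)) refl
    coefficient 2 = sum 2 0K 0K 0K refl refl (trans (X-suc x₄ 1) (trans (X-suc x₃ 0) (X-zero x₂))) refl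
    coefficient 3 = sum 3 0K 0K 0K refl refl (trans (X-suc x₄ 2) (trans (X-suc x₃ 1) (trans (X-suc x₂ 0) (X-zero x₁)))) refl
    coefficient 4 = sum 4 0K 0K 0K refl refl (trans (X-suc x₄ 3) (trans (X-suc x₃ 2) (trans (X-suc x₂ 1) (trans (X-suc x₁ 0) (X-zero d))))) refl
    coefficient (suc (suc (suc (suc (suc m))))) = sum (5 ℕ.+ m) (d m) 0K (d m) (dilate-shift f m) refl
      (trans (X-suc x₄ (4 ℕ.+ m)) (trans (X-suc x₃ (3 ℕ.+ m)) (trans (X-suc x₂ (2 ℕ.+ m)) (trans (X-suc x₁ (1 ℕ.+ m)) (X-suc d m)))))
      (sym (+K-identityˡ (d m)))
    expanded : dilate 5 f ≈ const (f 0) + X⁵ d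
    expanded = pointwise λ n → trans (coefficient n) (sym (⊞-at (const (f 0)) (X⁵ d) n))

  -- Each passage to the tail of f gains a factor q⁵ in the defect, so the defect has every order
  -- and vanishes because the filtration is separated.
  dilate-* : ∀ f g → dilate 5 (f * g) ≈ dilate 5 f * dilate 5 g
  dilate-* f g = O-sep-≈ {dilate 5 (f * g)} {dilate 5 f * dilate 5 g} (λ n → approximate n f)
    where
    dg = dilate 5 g
    defect : ∀ f → dilate 5 (f * g) - dilate 5 f * dg ≈ X ^ 5 * (dilate 5 (tail f * g) - dilate 5 (tail f) * dg)
    defect f = multiplicative-defect {cf} {cg} {dilate 5 f} {dtf} {dg} {dtg} {dilate 5 (f * g)} {dtfg} (dilate-step f) (dilate-step g) product
      where
      cf cg dtg dtf dtfg : Series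
      cf = const (f 0)
      cg = const (g 0)
      dtg = dilate 5 (tail g)
      dtf = dilate 5 (tail f)
      dtfg = dilate 5 (tail f * g)
      tails : tail (f * g) ≈ cf * tail g + tail f * g
      tails = pointwise λ n → trans (tail-⊗ f g n) (trans (⊞-at (scale (f 0) (tail g)) (tail f * g) n) (trans (cong (_+K (tail f * g) n) (sym (const-⊗ (f 0) (tail g) n))) (sym (⊞-at (cf * tail g) (tail f * g) n))))
      product : dilate 5 (f * g) ≈ cf * cg + X ^ 5 * (cf * dtg + dtfg)
      product = ≈-trans (dilate-step (f * g)) (+-cong
        (≈-trans (≈-reflexive (cong const (⊗-zero f g))) (const-* (f 0) (g 0)))
        (*-congˡ {x = X ^ 5} (≈-trans (dilate-cong tails) (≈-trans (dilate-+ (cf * tail g) (tail f * g)) (+-congʳ {x = dtfg} (dilate-const-* (f 0) (tail g)))))))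
    approximate : ∀ n f → Order n (dilate 5 (f * g) - dilate 5 f * dg)
    approximate zero f _ ()
    approximate (suc n) f = O-≈ {suc n} (≈-sym (defect f)) (O-≤ {suc n} {5 ℕ.+ n} (s≤s (ℕP.m≤n+m n 4))
      (O-* {5} {n} {X ^ 5} {dilate 5 (tail f * g) - dilate 5 (tail f) * dg} (O1-^ 5 O-X) (approximate n (tail f))))

  dilate-const : ∀ a → dilate 5 (const a) ≈ const a
  dilate-const a = ≈-trans (dilate-step (const a)) (+q⁵0 {const a} {dilate 5 (tail (const a))} zeros)
    where
    zeros : dilate 5 (tail (const a)) ≈ 0#
    zeros = pointwise λ n → trans (go n) (zero-at n)
      where
      go : ∀ n → dilate 5 (tail (const a)) n ≡ 0K
      go n with n ℕ.% 5 ℕ.≟ 0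
      ... | yes _ = refl
      ... | no _ = refl
      zero-at : ∀ n → 0K ≡ const 0K n
      zero-at zero = refl
      zero-at (suc n) = refl

  dilate-X : dilate 5 X ≈ X ^ 5
  dilate-X = ≈-trans (dilate-step X) (≈-trans (+-congˡ {x = const 0K} (*-congˡ {x = X ^ 5} (≈-trans (dilate-cong tail-X) (dilate-const 1K)))) 0+q⁵1)
    where
    tail-X : tail X ≈ 1#
    tail-X = pointwise λ { zero → refl ; (suc n) → refl }

  module _ (f₀ f₁ f₂ : Series) where
    dissected : Series
    dissected = dilate 5 f₀ - X * dilate 5 f₁ - X ^ 2 * dilate 5 f₂

    private
      minus : ∀ f g n {a b} → f n ≡ a → g n ≡ b → (f - g) n ≡ a +K (-K b)
      minus f g n p r = trans (⊞-at f (⊟ g) n) (cong₂ _+K_ p (trans (⊟-at g n) (cong (λ t → -K t) r)))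

      combine : ∀ n {a b c} → dilate 5 f₀ n ≡ a → (X * dilate 5 f₁) n ≡ b → (X * (X * dilate 5 f₂)) n ≡ c →
        dissected n ≡ (a +K (-K b)) +K (-K c)
      combine n p r s = minus (dilate 5 f₀ - X * dilate 5 f₁) (X ^ 2 * dilate 5 f₂) n
        (minus (dilate 5 f₀) (X * dilate 5 f₁) n p r) (trans (at (q²-unfold (dilate 5 f₂)) n) s)

      -0K : -K 0K ≡ 0K
      -0K = refl

    dissected-0 : ∀ n → dissected (n ℕ.* 5) ≡ f₀ n
    dissected-0 n = trans (combine (n ℕ.* 5) (dilate-multiple f₀ n) (middle n) (last n))
      (trans (cong (λ t → (f₀ n +K t) +K t) -0K) (trans (+K-identityʳ (f₀ n +K 0K)) (+K-identityʳ (f₀ n))))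
      where
      middle : ∀ n → (X * dilate 5 f₁) (n ℕ.* 5) ≡ 0K
      middle zero = X-zero (dilate 5 f₁)
      middle (suc n) = trans (X-suc (dilate 5 f₁) (4 ℕ.+ n ℕ.* 5)) (dilate-nonmultiple f₁ 4 n (λ ()))
      last : ∀ n → (X * (X * dilate 5 f₂)) (n ℕ.* 5) ≡ 0K
      last zero = X-zero (X * dilate 5 f₂)
      last (suc n) = trans (X-suc (X * dilate 5 f₂) (4 ℕ.+ n ℕ.* 5)) (trans (X-suc (dilate 5 f₂) (3 ℕ.+ n ℕ.* 5)) (dilate-nonmultiple f₂ 3 n (λ ())))

    dissected-2 : ∀ n → dissected (2 ℕ.+ n ℕ.* 5) ≡ -K (f₂ n)
    dissected-2 n = trans (combine (2 ℕ.+ n ℕ.* 5) (dilate-nonmultiple f₀ 2 n (λ ()))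
        (trans (X-suc (dilate 5 f₁) (1 ℕ.+ n ℕ.* 5)) (dilate-nonmultiple f₁ 1 n (λ ())))
        (trans (X-suc (X * dilate 5 f₂) (1 ℕ.+ n ℕ.* 5)) (trans (X-suc (dilate 5 f₂) (n ℕ.* 5)) (dilate-multiple f₂ n))))
      (+K-identityˡ (-K f₂ n))

  dilation : Dilation
  dilation = record
    { δ = dilate 5
    ; δ-cong = dilate-cong
    ; δ-+ = dilate-+
    ; δ-* = dilate-*
    ; δ-neg = dilate-neg
    ; δ-1 = dilate-const 1K
    ; δ-q = dilate-X
    ; δ-O = λ {n} {f} → dilate-O {n} {f}
    ; δ-unique = λ {f₀} {f₁} {f₂} {g₀} {g₁} {g₂} p →
        (pointwise λ n → trans (sym (dissected-0 f₀ f₁ f₂ n)) (trans (at p (n ℕ.* 5)) (dissected-0 g₀ g₁ g₂ n)))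
      , (pointwise λ n → -K-injective (trans (sym (dissected-2 f₀ f₁ f₂ n)) (trans (at p (2 ℕ.+ n ℕ.* 5)) (dissected-2 g₀ g₁ g₂ n)))) }
    where
    -K-injective : ∀ {a b} → -K a ≡ -K b → a ≡ b
    -K-injective {a} {b} p = trans (sym (neg-neg a)) (trans (cong (λ t → -K t) p) (neg-neg b))
      where
      neg-neg : ∀ a → -K (-K a) ≡ a
      neg-neg a = solveK 1 (λ a → :-K (:-K a) :=K a) refl a

  -- Constants

  -- A series with its value in ℚ(ζ). Relations between constant series become closed equations in
  -- ℚ(ζ), where both sides are computed.
  Constant : Series → Set
  Constant f = Σ K λ a → f ≈ const a

  constant : ∀ a → Constant (const a)
  constant a = a , ≈-refl

  infixl 6 _+ᶜ_ _-ᶜ_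
  infixl 7 _*ᶜ_
  infixr 8 _^ᶜ_
  infix 8 -ᶜ_

  _+ᶜ_ : ∀ {f g} → Constant f → Constant g → Constant (f + g)
  (a , p) +ᶜ (b , r) = a +K b , ≈-trans (+-cong p r) (≈-sym (const-+ a b))

  _*ᶜ_ : ∀ {f g} → Constant f → Constant g → Constant (f * g)
  (a , p) *ᶜ (b , r) = a *K b , ≈-trans (*-cong p r) (≈-sym (const-* a b))

  -ᶜ_ : ∀ {f} → Constant f → Constant (- f)
  -ᶜ (a , p) = (-K a) , ≈-trans (-‿cong p) (≈-sym (const-neg a))

  _-ᶜ_ : ∀ {f g} → Constant f → Constant g → Constant (f - g)
  p -ᶜ r = p +ᶜ (-ᶜ r)

  1ᶜ : Constant 1#
  1ᶜ = constant 1K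

  _^ᶜ_ : ∀ {f} → Constant f → ∀ n → Constant (f ^ n)
  p ^ᶜ zero = 1ᶜ
  p ^ᶜ suc n = p *ᶜ (p ^ᶜ n)

  _≈ᶜ_∋_ : ∀ {f g} (p : Constant f) (r : Constant g) → proj₁ p ≡ proj₁ r → f ≈ g
  (a , p) ≈ᶜ (b , r) ∋ e = ≈-trans p (≈-trans (≈-reflexive (cong const e)) (≈-sym r))

  unitᶜ : ∀ {f} (p : Constant f) → proj₁ p *K invK (proj₁ p) ≡ 1K → Unit f
  unitᶜ p e = unit (const (invK (proj₁ p))) ((p *ᶜ constant (invK (proj₁ p))) ≈ᶜ 1ᶜ ∋ e)

  x x′ r s k₀ k₁ k₂ k₃ : Series
  x = const ζ
  x′ = const ζ⁻¹
  r = const (invK (1K -K ζ))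
  s = const (invK (1K -K ζ⁻¹))
  k₀ = const ((ℤ.+ 3) /5 +K (ℤ.+ 1) /5 *K c)
  k₁ = const ((ℤ.- (ℤ.+ 2)) /5 +K (ℤ.+ 1) /5 *K c)
  k₂ = const ((ℤ.+ 1) /5 +K (ℤ.+ 2) /5 *K c)
  k₃ = const ((ℤ.- (ℤ.+ 1)) /5 +K (ℤ.+ 3) /5 *K c)

  private
    xᶜ : Constant x
    xᶜ = constant ζ
    x′ᶜ : Constant x′
    x′ᶜ = constant ζ⁻¹
    rᶜ : Constant r
    rᶜ = constant (invK (1K -K ζ))
    sᶜ : Constant s
    sᶜ = constant (invK (1K -K ζ⁻¹))

  xx′≈1 : x * x′ ≈ 1#
  xx′≈1 = (xᶜ *ᶜ x′ᶜ) ≈ᶜ 1ᶜ ∋ refl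

  x⁵≈1 : x ^ 5 ≈ 1#
  x⁵≈1 = (xᶜ ^ᶜ 5) ≈ᶜ 1ᶜ ∋ refl

  x′≈x⁴ : x′ ≈ x ^ 4
  x′≈x⁴ = x′ᶜ ≈ᶜ (xᶜ ^ᶜ 4) ∋ refl

  x-sum : 1# + x + x ^ 2 + x ^ 3 + x ^ 4 ≈ 0#
  x-sum = (1ᶜ +ᶜ xᶜ +ᶜ (xᶜ ^ᶜ 2) +ᶜ (xᶜ ^ᶜ 3) +ᶜ (xᶜ ^ᶜ 4)) ≈ᶜ constant 0K ∋ refl

  r-inverse : r * (1# - x) ≈ 1#
  r-inverse = (rᶜ *ᶜ (1ᶜ -ᶜ xᶜ)) ≈ᶜ 1ᶜ ∋ refl

  s-inverse : s * (1# - x′) ≈ 1#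
  s-inverse = (sᶜ *ᶜ (1ᶜ -ᶜ x′ᶜ)) ≈ᶜ 1ᶜ ∋ refl

  open RankSum x x′ r s

  -- The summands and the bilateral sums of the statement

  1-ζX^ : ∀ a k → 𝟙 ⊖ (a · q^ k) ≈ 1# - const a * X ^ k
  1-ζX^ a k = ⊖≈- {𝟙} ≈-refl (≈-trans (·≈const a (q^ k)) (*-congˡ (≈-sym (X^≈q^ k))))

  product-inverse : ∀ f k → f ≈ (1# - x * X ^ suc k) * (1# - x′ * X ^ suc k) → f * G (X ^ suc k) ≈ 1#
  product-inverse f k e = ≈-trans (*-congʳ e) (inverse (*-unit (1-h-unit {x * X ^ suc k} (O-*ʳ {1} {x} (O-q^ k))) (1-h-unit {x′ * X ^ suc k} (O-*ʳ {1} {x′} (O-q^ k)))))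

  ζterm-zero : ζterm (ℤ.+ 0) (ℤ.+ 0) ≈ r * s
  ζterm-zero = ≈-trans (⊗≈* {q^ 0} {1#} (≈-sym (X^≈q^ 0)) (inv-unique {d} {r * s} refl d-inverse)) (*-identityˡ (r * s))
    where
    d : Series
    d = (𝟙 ⊖ (ζ · q^ 0)) ⊗ (𝟙 ⊖ (ζ⁻¹ · q^ 0))
    d-inverse : d * (r * s) ≈ 1#
    d-inverse = ≈-trans (*-congʳ (≈-trans (⊗≈* (1-ζX^ ζ 0) (1-ζX^ ζ⁻¹ 0)) (*-cong (+-congˡ (-‿cong (*-identityʳ x))) (+-congˡ (-‿cong (*-identityʳ x′))))))
      (((1ᶜ -ᶜ xᶜ) *ᶜ (1ᶜ -ᶜ x′ᶜ) *ᶜ (rᶜ *ᶜ sᶜ)) ≈ᶜ 1ᶜ ∋ refl)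

  ζterm-positive : ∀ e k → ζterm (ℤ.+ e) (ℤ.+ suc k) ≈ X ^ e * G (X ^ suc k)
  ζterm-positive e k = ⊗≈* (≈-sym (X^≈q^ e)) (inv-unique {d} {G (X ^ suc k)} refl (product-inverse d k (⊗≈* (1-ζX^ ζ (suc k)) (1-ζX^ ζ⁻¹ (suc k)))))
    where
    d : Series
    d = (𝟙 ⊖ (ζ · q^ (suc k))) ⊗ (𝟙 ⊖ (ζ⁻¹ · q^ (suc k)))

  -- After `reverse-factors` the denominator is the one for the positive index; the reversal itself
  -- is paid for by the exponent, e′ = e + 2(k + 1).
  ζterm-negative : ∀ e e′ k → e ℤ.+ ℤ.+ (2 ℕ.* suc k) ≡ ℤ.+ e′ → ζterm e -[1+ k ] ≈ X ^ e′ * G (X ^ suc k)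
  ζterm-negative e e′ k p = ⊗≈* (≈-trans (≈-reflexive (cong q^ℤ p)) (≈-sym (X^≈q^ e′))) (inv-unique {d} {G (X ^ suc k)} refl (product-inverse d k conjugate))
    where
    d : Series
    d = (q^ (suc k) ⊖ const ζ) ⊗ (q^ (suc k) ⊖ const ζ⁻¹)
    conjugate : d ≈ (1# - x * X ^ suc k) * (1# - x′ * X ^ suc k)
    conjugate = ≈-trans (⊗≈* (⊖≈- (≈-sym (X^≈q^ (suc k))) ≈-refl) (⊖≈- (≈-sym (X^≈q^ (suc k))) ≈-refl))
      (reverse-factors x x′ (X ^ suc k) xx′≈1)

  open Main dilation x x′ x⁵≈1 x′≈x⁴ x-sum r s r-inverse s-inverse
    (unitᶜ (1ᶜ -ᶜ (xᶜ ^ᶜ 2)) refl) (unitᶜ (xᶜ -ᶜ x′ᶜ) refl) k₀ k₁ k₂ k₃ (const c)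

  private
    uᶜ : Constant u
    uᶜ = (xᶜ -ᶜ x′ᶜ) *ᶜ (1ᶜ -ᶜ xᶜ) *ᶜ (1ᶜ -ᶜ (xᶜ ^ᶜ 2))
    aᶜ : Constant a
    aᶜ = 1ᶜ +ᶜ xᶜ
    bᶜ : Constant b
    bᶜ = (xᶜ ^ᶜ 2) +ᶜ (xᶜ ^ᶜ 4)
    dᶜ : Constant d
    dᶜ = (1ᶜ +ᶜ 1ᶜ) *ᶜ (xᶜ ^ᶜ 3)
    eᶜ : Constant e
    eᶜ = 1ᶜ -ᶜ (xᶜ ^ᶜ 2)
    fᶜ : Constant f
    fᶜ = (xᶜ ^ᶜ 2) ^ᶜ 2 -ᶜ (xᶜ ^ᶜ 2) ^ᶜ 4
    cᶜ : Constant (const c)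
    cᶜ = constant c
    k₀ᶜ : Constant k₀
    k₀ᶜ = constant ((ℤ.+ 3) /5 +K (ℤ.+ 1) /5 *K c)
    k₁ᶜ : Constant k₁
    k₁ᶜ = constant ((ℤ.- (ℤ.+ 2)) /5 +K (ℤ.+ 1) /5 *K c)
    k₂ᶜ : Constant k₂
    k₂ᶜ = constant ((ℤ.+ 1) /5 +K (ℤ.+ 2) /5 *K c)
    k₃ᶜ : Constant k₃
    k₃ᶜ = constant ((ℤ.- (ℤ.+ 1)) /5 +K (ℤ.+ 3) /5 *K c)

  -- k₀ = (1 + x)/((x - x′)(1 - x)) = 1/((1 - x)(1 - x′)) = 1/(2 - c), which is (3 + c)/5. This and
  -- the following seven relations determine the constants in front of the theta quotients.
  ae : a * e ≈ u * k₀
  ae = (aᶜ *ᶜ eᶜ) ≈ᶜ (uᶜ *ᶜ k₀ᶜ) ∋ refl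
  af-ae : a * f - a * e ≈ u * k₁
  af-ae = (aᶜ *ᶜ fᶜ -ᶜ aᶜ *ᶜ eᶜ) ≈ᶜ (uᶜ *ᶜ k₁ᶜ) ∋ refl
  bf-af : b * f - a * f ≈ - (u * const c)
  bf-af = (bᶜ *ᶜ fᶜ -ᶜ aᶜ *ᶜ fᶜ) ≈ᶜ (-ᶜ (uᶜ *ᶜ cᶜ)) ∋ refl
  be : b * e ≈ u * k₀ - u
  be = (bᶜ *ᶜ eᶜ) ≈ᶜ (uᶜ *ᶜ k₀ᶜ -ᶜ uᶜ) ∋ refl
  -af-de : - (a * f) - d * e ≈ u * k₂
  -af-de = (-ᶜ (aᶜ *ᶜ fᶜ) -ᶜ dᶜ *ᶜ eᶜ) ≈ᶜ (uᶜ *ᶜ k₂ᶜ) ∋ refl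
  de-be : d * e - b * e ≈ - (u * const c)
  de-be = (dᶜ *ᶜ eᶜ -ᶜ bᶜ *ᶜ eᶜ) ≈ᶜ (-ᶜ (uᶜ *ᶜ cᶜ)) ∋ refl
  -bf : - (b * f) ≈ u * k₃
  -bf = (-ᶜ (bᶜ *ᶜ fᶜ)) ≈ᶜ (uᶜ *ᶜ k₃ᶜ) ∋ refl
  df : d * f ≈ u * (const c - 1#) - u * k₃
  df = (dᶜ *ᶜ fᶜ) ≈ᶜ (uᶜ *ᶜ (cᶜ -ᶜ 1ᶜ) -ᶜ uᶜ *ᶜ k₃ᶜ) ∋ refl

  first second : ℤ → Series
  first n = ζterm (ℤ.+ 3 ℤ.* n ℤ.* n ℤ.+ ℤ.+ 2 ℤ.* n) (ℤ.+ 3 ℤ.* n)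
  second n = ζterm (ℤ.+ 3 ℤ.* n ℤ.* n ℤ.+ ℤ.+ 4 ℤ.* n ℤ.+ ℤ.+ 1) (ℤ.+ 3 ℤ.* n ℤ.+ ℤ.+ 1)

  private
    +-cancel : ∀ i j k {m n} → m ≡ n ℕ.+ k → i ℤ.+ j ≡ ℤ.+ m → i ℤ.+ ℤ.- (ℤ.+ k) ℤ.+ j ≡ ℤ.+ n
    +-cancel i j k {m} {n} refl e = trans (ℤP.+-assoc i (ℤ.- (ℤ.+ k)) j) (trans (cong (ℤ._+_ i) (ℤP.+-comm (ℤ.- (ℤ.+ k)) j))
      (trans (sym (ℤP.+-assoc i j (ℤ.- (ℤ.+ k)))) (trans (cong (ℤ._+ (ℤ.- (ℤ.+ k))) e)
        (trans (ℤP.+-assoc (ℤ.+ n) (ℤ.+ k) (ℤ.- (ℤ.+ k))) (trans (cong (ℤ._+_ (ℤ.+ n)) (ℤP.+-inverseʳ (ℤ.+ k))) (ℤP.+-identityʳ (ℤ.+ n)))))))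

    first-pos : ∀ k → first (ℤ.+ suc k) ≈ termA k
    first-pos k = ≈-trans (≈-reflexive (cong₂ ζterm exponent index)) (≈-trans (ζterm-positive (3 ℕ.* n ℕ.* n ℕ.+ 2 ℕ.* n) (k ℕ.+ 2 ℕ.* n)) (termA^ k))
      where
      n = suc k
      exponent : ℤ.+ 3 ℤ.* ℤ.+ suc k ℤ.* ℤ.+ suc k ℤ.+ ℤ.+ 2 ℤ.* ℤ.+ suc k ≡ ℤ.+ (3 ℕ.* n ℕ.* n ℕ.+ 2 ℕ.* n)
      exponent = refl
      index : ℤ.+ 3 ℤ.* ℤ.+ suc k ≡ ℤ.+ suc (k ℕ.+ 2 ℕ.* n)
      index = refl

    first-neg : ∀ k → first -[1+ k ] ≈ termB k
    first-neg k = ≈-trans (≈-reflexive (cong (ζterm exponent) index)) (≈-trans (ζterm-negative exponent (3 ℕ.* n ℕ.* n ℕ.+ 4 ℕ.* n) (k ℕ.+ 2 ℕ.* n) total) (termB^ k))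
      where
      n = suc k
      exponent : ℤ
      exponent = ℤ.+ 3 ℤ.* -[1+ k ] ℤ.* -[1+ k ] ℤ.+ ℤ.+ 2 ℤ.* -[1+ k ]
      index : ℤ.+ 3 ℤ.* -[1+ k ] ≡ -[1+ k ℕ.+ 2 ℕ.* n ]
      index = refl
      -- At index -n the exponent is 3n² - 2n, and reversing the two factors adds 2 · 3n.
      total : exponent ℤ.+ ℤ.+ (2 ℕ.* suc (k ℕ.+ 2 ℕ.* n)) ≡ ℤ.+ (3 ℕ.* n ℕ.* n ℕ.+ 4 ℕ.* n)
      total = +-cancel (ℤ.+ (3 ℕ.* n ℕ.* n)) (ℤ.+ (2 ℕ.* (3 ℕ.* n))) (2 ℕ.* n)
        (Exponents.B-total n) refl

    second-pos : ∀ k → second (ℤ.+ k) ≈ termC k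
    second-pos k = ≈-trans (≈-reflexive (cong₂ ζterm exponent index)) (≈-trans (ζterm-positive (3 ℕ.* k ℕ.* k ℕ.+ 4 ℕ.* k ℕ.+ 1) (3 ℕ.* k)) (termC^ k))
      where
      exponent : ℤ.+ 3 ℤ.* ℤ.+ k ℤ.* ℤ.+ k ℤ.+ ℤ.+ 4 ℤ.* ℤ.+ k ℤ.+ ℤ.+ 1 ≡ ℤ.+ (3 ℕ.* k ℕ.* k ℕ.+ 4 ℕ.* k ℕ.+ 1)
      exponent = cong (ℤ._+ ℤ.+ 1) (cong₂ ℤ._+_ (trans (cong (ℤ._* ℤ.+ k) (sym (ℤP.pos-* 3 k))) (sym (ℤP.pos-* (3 ℕ.* k) k))) (sym (ℤP.pos-* 4 k)))
      index : ℤ.+ 3 ℤ.* ℤ.+ k ℤ.+ ℤ.+ 1 ≡ ℤ.+ suc (3 ℕ.* k)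
      index = trans (cong (ℤ._+ ℤ.+ 1) (sym (ℤP.pos-* 3 k))) (cong ℤ.+_ (ℕP.+-comm (3 ℕ.* k) 1))

    second-neg : ∀ k → second -[1+ k ] ≈ termD k
    second-neg k = ≈-trans (≈-reflexive (cong (ζterm exponent) index)) (≈-trans (ζterm-negative exponent (3 ℕ.* k ℕ.* k ℕ.+ 8 ℕ.* k ℕ.+ 4) (3 ℕ.* k ℕ.+ 1) total) (termD^ k))
      where
      n = suc k
      exponent : ℤ
      exponent = ℤ.+ 3 ℤ.* -[1+ k ] ℤ.* -[1+ k ] ℤ.+ ℤ.+ 4 ℤ.* -[1+ k ] ℤ.+ ℤ.+ 1
      index : ℤ.+ 3 ℤ.* -[1+ k ] ℤ.+ ℤ.+ 1 ≡ -[1+ 3 ℕ.* k ℕ.+ 1 ]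
      index = trans (cong (λ t → ℤ.- (ℤ.+ t) ℤ.+ ℤ.+ 1) (Exponents.D-negative k)) refl
      -- With n = k + 1 the exponent is 3n² - 4n + 1, and the reversal adds 2(3n - 1); the sum is
      -- 3k² + 8k + 4.
      total : exponent ℤ.+ ℤ.+ (2 ℕ.* suc (3 ℕ.* k ℕ.+ 1)) ≡ ℤ.+ (3 ℕ.* k ℕ.* k ℕ.+ 8 ℕ.* k ℕ.+ 4)
      total = trans (ℤP.+-assoc (ℤ.+ (3 ℕ.* n ℕ.* n) ℤ.+ ℤ.- (ℤ.+ (4 ℕ.* n))) (ℤ.+ 1) (ℤ.+ (2 ℕ.* suc (3 ℕ.* k ℕ.+ 1))))
        (+-cancel (ℤ.+ (3 ℕ.* n ℕ.* n)) (ℤ.+ (1 ℕ.+ 2 ℕ.* suc (3 ℕ.* k ℕ.+ 1))) (4 ℕ.* n)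
          (Exponents.D-total k) refl)

  rank-sum≈ : Σℤ first ⊖ Σℤ second ≈ rank-sum
  rank-sum≈ = ⊖≈-
    (≈-trans (Σℤ≈zsum∞ first) (+-cong (≈-sym (Σ∞-cong {termB} oB (λ k → ≈-sym (first-neg k))))
      (+-cong ζterm-zero (≈-sym (Σ∞-cong {termA} oA (λ k → ≈-sym (first-pos k)))))))
    (≈-trans (Σℤ≈zsum∞ second) (+-cong (≈-sym (Σ∞-cong {termD} oD (λ k → ≈-sym (second-neg k))))
      -- The bilateral sum sets its term of index 0 apart, whereas here that term is the first of
      -- the half-sum C.
      (≈-trans (+-cong (second-pos 0) (≈-sym (Σ∞-cong {λ k → termC (suc k)} (λ k → O-≤ {k} {suc k} (ℕP.n≤1+n k) (oC (suc k))) (λ k → ≈-sym (second-pos (suc k))))))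
        (≈-sym (Σ∞-head {termC} oC)))))

  -- The series A_{35j} and the conclusion

  private
    θ≈ϑ : ∀ a b → θ a b ≈ ϑ a b
    θ≈ϑ a b = ⊗≈* (poch≈qq a b) (poch≈qq (b ∸ a) b)

    inv-of : ∀ {f g} → f 0 ≡ 1K → f ≈ g → g * inv f ≈ 1#
    inv-of {f} e p = ≈-trans (*-congʳ (≈-sym p)) (inv-unit f e)

    X≈ : ∀ e → q^ e ≈ X ^ e
    X≈ e = ≈-sym (X^≈q^ e)

    ·≈ : ∀ a {f g} → f ≈ g → a · f ≈ const a * g
    ·≈ a {f} p = ≈-trans (·≈const a f) (*-congˡ p)

    mul : ∀ f g {f′ g′} → f ≈ f′ → g ≈ g′ → f ⊗ g ≈ f′ * g′
    mul f g p r = ⊗≈* {f} {_} {g} p r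

    mulθ : ∀ f {f′} → f ≈ f′ → ∀ a b → f ⊗ θ a b ≈ f′ * ϑ a b
    mulθ f p a b = mul f (θ a b) p (θ≈ϑ a b)

    square-θ : ∀ a b → θ a b Defs.^ 2 ≈ ϑ a b * (ϑ a b * 1#)
    square-θ a b = mul (θ a b) (θ a b ⊗ 𝟙) (θ≈ϑ a b) (mul (θ a b) 𝟙 (θ≈ϑ a b) ≈-refl)

    d₀≈ : (θ 1 15 ⊗ θ 4 15 ⊗ θ 5 15 ⊗ θ 6 15) ≈ ϑ 1 15 * ϑ 4 15 * ϑ 5 15 * ϑ 6 15
    d₀≈ = mulθ (θ 1 15 ⊗ θ 4 15 ⊗ θ 5 15) (mulθ (θ 1 15 ⊗ θ 4 15) (mulθ (θ 1 15) (θ≈ϑ 1 15) 4 15) 5 15) 6 15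
    d₁≈ : (θ 3 15 ⊗ θ 5 15 ⊗ θ 7 15) ≈ ϑ 3 15 * ϑ 5 15 * ϑ 7 15
    d₁≈ = mulθ (θ 3 15 ⊗ θ 5 15) (mulθ (θ 3 15) (θ≈ϑ 3 15) 5 15) 7 15
    d₂≈ : (θ 1 15 ⊗ θ 5 15 ⊗ θ 6 15) ≈ ϑ 1 15 * ϑ 5 15 * ϑ 6 15
    d₂≈ = mulθ (θ 1 15 ⊗ θ 5 15) (mulθ (θ 1 15) (θ≈ϑ 1 15) 5 15) 6 15
    d₃≈ : (θ 2 15 ⊗ θ 3 15 ⊗ θ 5 15 ⊗ θ 7 15) ≈ ϑ 2 15 * ϑ 3 15 * ϑ 5 15 * ϑ 7 15
    d₃≈ = mulθ (θ 2 15 ⊗ θ 3 15 ⊗ θ 5 15) (mulθ (θ 2 15 ⊗ θ 3 15) (mulθ (θ 2 15) (θ≈ϑ 2 15) 3 15) 5 15) 7 15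

    A₀≈ : A350 ≈ k₀ * (ϑ 2 5 * inv (θ 1 5 Defs.^ 2)) - X ^ 1 * ϑ 2 15 * inv (θ 1 15 ⊗ θ 4 15 ⊗ θ 5 15 ⊗ θ 6 15)
    A₀≈ = ⊖≈- {((ℤ.+ 3) /5 +K (ℤ.+ 1) /5 *K c) · (θ 2 5 ⊗ inv (θ 1 5 Defs.^ 2))} {_} {q^ 1 ⊗ θ 2 15 ⊗ inv (θ 1 15 ⊗ θ 4 15 ⊗ θ 5 15 ⊗ θ 6 15)}
      (·≈ ((ℤ.+ 3) /5 +K (ℤ.+ 1) /5 *K c) {θ 2 5 ⊗ inv (θ 1 5 Defs.^ 2)} (mul (θ 2 5) (inv (θ 1 5 Defs.^ 2)) (θ≈ϑ 2 5) ≈-refl))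
      (mul (q^ 1 ⊗ θ 2 15) (inv (θ 1 15 ⊗ θ 4 15 ⊗ θ 5 15 ⊗ θ 6 15)) (mulθ (q^ 1) (X≈ 1) 2 15) ≈-refl)

    A₁≈ : A351 ≈ k₁ * inv (θ 1 5) - const c * (X ^ 1 * inv (θ 3 15 ⊗ θ 5 15 ⊗ θ 7 15))
    A₁≈ = ⊖≈- {((ℤ.- (ℤ.+ 2)) /5 +K (ℤ.+ 1) /5 *K c) · inv (θ 1 5)} {_} {c · (q^ 1 ⊗ inv (θ 3 15 ⊗ θ 5 15 ⊗ θ 7 15))} (·≈ ((ℤ.- (ℤ.+ 2)) /5 +K (ℤ.+ 1) /5 *K c) {inv (θ 1 5)} ≈-refl) (·≈ c {q^ 1 ⊗ inv (θ 3 15 ⊗ θ 5 15 ⊗ θ 7 15)} (mul (q^ 1) (inv (θ 3 15 ⊗ θ 5 15 ⊗ θ 7 15)) (X≈ 1) ≈-refl))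

    A₂≈ : A352 ≈ k₂ * inv (θ 2 5) - const c * inv (θ 1 15 ⊗ θ 5 15 ⊗ θ 6 15)
    A₂≈ = ⊖≈- {((ℤ.+ 1) /5 +K (ℤ.+ 2) /5 *K c) · inv (θ 2 5)} {_} {c · inv (θ 1 15 ⊗ θ 5 15 ⊗ θ 6 15)} (·≈ ((ℤ.+ 1) /5 +K (ℤ.+ 2) /5 *K c) {inv (θ 2 5)} ≈-refl) (·≈ c {inv (θ 1 15 ⊗ θ 5 15 ⊗ θ 6 15)} ≈-refl)

    A₃≈ : A353 ≈ k₃ * (ϑ 1 5 * inv (θ 2 5 Defs.^ 2)) + (const c - 1#) * (X ^ 1 * ϑ 1 15 * inv (θ 2 15 ⊗ θ 3 15 ⊗ θ 5 15 ⊗ θ 7 15))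
    A₃≈ = ⊕≈+ {((ℤ.- (ℤ.+ 1)) /5 +K (ℤ.+ 3) /5 *K c) · (θ 1 5 ⊗ inv (θ 2 5 Defs.^ 2))} {_} {(c -K 1K) · (q^ 1 ⊗ θ 1 15 ⊗ inv (θ 2 15 ⊗ θ 3 15 ⊗ θ 5 15 ⊗ θ 7 15))}
      (·≈ ((ℤ.- (ℤ.+ 1)) /5 +K (ℤ.+ 3) /5 *K c) {θ 1 5 ⊗ inv (θ 2 5 Defs.^ 2)} (mul (θ 1 5) (inv (θ 2 5 Defs.^ 2)) (θ≈ϑ 1 5) ≈-refl))
      (≈-trans (·≈ (c -K 1K) {q^ 1 ⊗ θ 1 15 ⊗ inv (θ 2 15 ⊗ θ 3 15 ⊗ θ 5 15 ⊗ θ 7 15)} (mul (q^ 1 ⊗ θ 1 15) (inv (θ 2 15 ⊗ θ 3 15 ⊗ θ 5 15 ⊗ θ 7 15)) (mulθ (q^ 1) (X≈ 1) 1 15) ≈-refl))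
        (*-congʳ (≈-trans (const-+ c (-K 1K)) (+-congˡ (const-neg 1K)))))

    QFA₀ : Q * F * A350 ≈ k₀ * (J₂ * α) - X * (J₂ * T₂)
    QFA₀ = ≈-trans (*-congˡ A₀≈) (combine₀ (component₀₁ (inv-of {θ 1 5 Defs.^ 2} refl (square-θ 1 5))) (component₀₂ (inv-of {θ 1 15 ⊗ θ 4 15 ⊗ θ 5 15 ⊗ θ 6 15} refl d₀≈)))

    QFA₁ : Q * F * A351 ≈ k₁ * (F * J₂) - const c * (X * (J₁ * T₂))
    QFA₁ = ≈-trans (*-congˡ A₁≈) (combine₁ (component₁₁ (inv-of {θ 1 5} refl (θ≈ϑ 1 5))) (component₁₂ (inv-of {θ 3 15 ⊗ θ 5 15 ⊗ θ 7 15} refl d₁≈)))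

    QFA₂ : Q * F * A352 ≈ k₂ * (F * J₁) - const c * (J₂ * T₄)
    QFA₂ = ≈-trans (*-congˡ A₂≈) (combine₂ (component₂₁ (inv-of {θ 2 5} refl (θ≈ϑ 2 5))) (component₂₂ (inv-of {θ 1 15 ⊗ θ 5 15 ⊗ θ 6 15} refl d₂≈)))

    QFA₃ : Q * F * A353 ≈ k₃ * (J₁ * γ) + (const c - 1#) * (X * (J₁ * T₁))
    QFA₃ = ≈-trans (*-congˡ A₃≈) (combine₃ (component₃₁ (inv-of {θ 2 5 Defs.^ 2} refl (square-θ 2 5))) (component₃₂ (inv-of {θ 2 15 ⊗ θ 3 15 ⊗ θ 5 15 ⊗ θ 7 15} refl d₃≈)))

  private
    expanded-sum : dilate 5 A350 ⊕ q^ 1 ⊗ dilate 5 A351 ⊕ q^ 2 ⊗ dilate 5 A352 ⊕ q^ 3 ⊗ dilate 5 A353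
      ≈ dilate 5 A350 + X ^ 1 * dilate 5 A351 + X ^ 2 * dilate 5 A352 + X ^ 3 * dilate 5 A353
    expanded-sum = ⊕≈+ {dilate 5 A350 ⊕ q^ 1 ⊗ dilate 5 A351 ⊕ q^ 2 ⊗ dilate 5 A352} {_} {q^ 3 ⊗ dilate 5 A353}
      (⊕≈+ {dilate 5 A350 ⊕ q^ 1 ⊗ dilate 5 A351} {_} {q^ 2 ⊗ dilate 5 A352}
        (⊕≈+ {dilate 5 A350} {_} {q^ 1 ⊗ dilate 5 A351} ≈-refl (mul (q^ 1) (dilate 5 A351) (X≈ 1) ≈-refl))
        (mul (q^ 2) (dilate 5 A352) (X≈ 2) ≈-refl))
      (mul (q^ 3) (dilate 5 A353) (X≈ 3) ≈-refl)

    right-side : poch 25 25 ⊗ (dilate 5 A350 ⊕ q^ 1 ⊗ dilate 5 A351 ⊕ q^ 2 ⊗ dilate 5 A352 ⊕ q^ 3 ⊗ dilate 5 A353)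
      ≈ δ F * (dilate 5 A350 + X ^ 1 * dilate 5 A351 + X ^ 2 * dilate 5 A352 + X ^ 3 * dilate 5 A353)
    right-side = mul (poch 25 25) (dilate 5 A350 ⊕ q^ 1 ⊗ dilate 5 A351 ⊕ q^ 2 ⊗ dilate 5 A352 ⊕ q^ 3 ⊗ dilate 5 A353)
      (≈-trans (poch≈qq 25 25) (≈-sym (δ-qq 5 4))) expanded-sum

    left-side : inv (poch 1 1) ⊗ (Σℤ first ⊖ Σℤ second) ≈ inv (poch 1 1) * rank-sum
    left-side = mul (inv (poch 1 1)) (Σℤ first ⊖ Σℤ second) ≈-refl rank-sum≈

    sealed : inv (poch 1 1) * rank-sum ≈ δ F * (dilate 5 A350 + X ^ 1 * dilate 5 A351 + X ^ 2 * dilate 5 A352 + X ^ 3 * dilate 5 A353)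
    sealed = main ae af-ae bf-af be -af-de de-be -bf df (dilate-const _) (dilate-const _) (dilate-const _) (dilate-const _) (dilate-const c)
      A350 A351 A352 A353 QFA₀ QFA₁ QFA₂ QFA₃ (inv (poch 1 1)) (inv-of {poch 1 1} refl (poch≈qq 1 1))

  dissection : inv (poch 1 1) ⊗ (Σℤ first ⊖ Σℤ second) ≈
    poch 25 25 ⊗ (dilate 5 A350 ⊕ q^ 1 ⊗ dilate 5 A351 ⊕ q^ 2 ⊗ dilate 5 A352 ⊕ q^ 3 ⊗ dilate 5 A353)
  dissection = ≈-trans left-side (≈-trans sealed (≈-sym right-side))

open import Defs
open import Data.Integer using (ℤ; +_; _+_; _*_)

theorem5 : inv (poch 1 1)
    ⊗ ( Σℤ (λ n → ζterm (+ 3 * n * n + + 2 * n) (+ 3 * n))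
    ⊖ Σℤ (λ n → ζterm (+ 3 * n * n + + 4 * n + + 1) (+ 3 * n + + 1)) )
    ≈ poch 25 25
    ⊗ ( dilate 5 A350
    ⊕ q^ 1 ⊗ dilate 5 A351
    ⊕ q^ 2 ⊗ dilate 5 A352
    ⊕ q^ 3 ⊗ dilate 5 A353 )
theorem5 = at Concrete.dissection
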